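{- Assume $x+x=x$ for all $x\in\mathbb K$. Then $\mathcal P_{\mathbb K}$ is generated by totally ordered traces: for every term $P$ there exist finitely many traces $T_1,\dots,T_n$ whose orders $\le_{T_i}$ are total, and $k_1,\dots,k_n\in\mathbb K$, such that $P\simeq k_1\cdot\{T_1\}\oplus\cdots\oplus k_n\cdot\{T_n\}$.
   Context: Calculus: fix a commutative semiring $\mathbb K$, a countable set $\mathcal N$ of names, polarities $+,-$ ($\neg$ exchanges them). Actions $u^\varepsilon(x)$ (subject $u$, bound name $x$); $u(x):=u^+(x)$, $\bar u(x):=u^-(x)$; an action written without object has a fresh bound object. Terms $P::=k\mid\alpha.P\mid\diamond P\mid P|Q\mid P\parallel Q\mid\nu xP$ ($k\in\mathbb K$), up to injective renaming of bound names and commutation of restrictions. Positions: finite integer sequences, prefix order, independent = incomparable. Labels: visible $u^\varepsilon(x):\iota$, internal $(\iota,\kappa)$. Transitions: $\alpha.P\xrightarrow{\alpha:\epsilon}\diamond P$; if $P\xrightarrow{a}P'$ then $\diamond P\xrightarrow{1.a}\diamond P'$, $P|Q\xrightarrow{1.a}P'|Q$, $Q|P\xrightarrow{2.a}Q|P'$, likewise for $\parallel$, $\nu xP\xrightarrow{a}\nu xP'$ if $x\notin a$; if $P\xrightarrow{u^\varepsilon(x):\iota}P'$, $Q\xrightarrow{u^{\neg\varepsilon}(y):\kappa}Q'$ then $P|Q\xrightarrow{(1.\iota,2.\kappa)}\nu x(P'|Q'[x/y])$. Homotopy: smallest congruence on label sequences with $ab\sim ba$ when all positions of $a,b$ are pairwise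 independent. Run: homotopy class of maximal internal-label transition sequences from $P$, end term $P/\rho$. State $s(k)=k$, $s(\alpha.P)=1$, $s(\diamond P)=s(\nu xP)=s(P)$, $s(P|Q)=s(P\parallel Q)=s(P)s(Q)$; outcome $\langle P\rangle=\sum_{\rho\in\mathrm{Runs}(P)}s(P/\rho)$; $P\simeq Q$ iff $\langle P|R\rangle=\langle Q|R\rangle$ for all $R$; $\mathcal P_{\mathbb K}$ is the $\mathbb K$-module of $\simeq$-classes with $P\oplus Q:=\nu u((u.P|u.Q)|\bar u.1)$ ($u$ fresh), $k\cdot P:=k|P$. Linear action $\underline{\alpha}.P:=\nu w(\alpha.(P|w.1)|(w.0|\bar w.1))$ ($w$ fresh); a prefix without continuation has continuation $1$. Trace $T=(|T|,p,s,\le_T,N)$: finite set $|T|$ of events, $p:|T|\to\{+,-\}$, $s:|T|\to\mathcal N\uplus|T|$, partial order $\le_T$ on $|T|$ with $s(b)=a\Rightarrow a<b$, finite $N\subseteq\{+,-\}\times(\mathcal N\uplus|T|)$. Implementation $\{T\}$: with fresh names $x_{ab},y_{ab},z_a$ ($a,b\in|T|$), $\mathrm{act}(a)=s(a)^{p(a)}(z_a)$ if $s(a)\in\mathcal N$, else $z_{s(a)}^{p(a)}(z_a)$; $A_a^T:=\{\underline{x}_{ba}\}_{b<a}.\underline{\mathrm{act}(a)}.(\prod_{a<c}\underline{\bar y}_{ac}\parallel\prod_{s(c)=a}A_c^T\parallel\prod_{(\varepsilon,a)\in N}z_a^\varepsilon.0)$, where $\{\underline{x}_{ba}\}_{b<a}$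 is a sequence of linear prefixes $\underline{x_{ba}}$ for all $b<a$ and $\prod$ is $\parallel$-composition; $\{T\}:=\nu(x_{ab},y_{ab})_{a,b}(\prod_{s(a)\in\mathcal N}A_a^T\,|\,\prod_{a<b}\underline{y}_{ab}.\underline{\bar x}_{ab})\parallel\prod_{(\varepsilon,u)\in N,u\in\mathcal N}u^\varepsilon.0$. -}

module Defs where

open import Level using (Level; 0ℓ; _⊔_)
open import Algebra.Bundles using (CommutativeSemiring)
open import Data.Nat.Base as ℕ using (ℕ; zero; suc)
import Data.Nat.Properties as ℕ
open import Data.Integer.Base using (ℤ; +_)
open import Data.Fin.Base using (Fin; toℕ; combine)
import Data.Fin.Properties as Fin
open import Data.Fin.Induction using (spo-noetherian)
open import Data.Sign.Base as Sign using (Sign; opposite)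
open import Data.List.Base using (List; []; _∷_; _++_; map; mapMaybe; filter; allFin; foldr; cartesianProduct)
open import Data.List.Relation.Unary.All using (All)
open import Data.List.Relation.Unary.Any using (Any)
open import Data.List.Relation.Unary.AllPairs using (AllPairs)
open import Data.List.Relation.Unary.Unique.Propositional using (Unique)
open import Data.List.Relation.Binary.Prefix.Heterogeneous using (Prefix)
import Data.Maybe.Base as Maybe
open Maybe using (Maybe; just; nothing)
open import Data.Product.Base using (∃; _×_; _,_; uncurry)
open import Data.Sum.Base using (_⊎_; inj₁; inj₂)
import Data.Sum.Properties as Sum
open import Function.Base using (flip)
open import Induction.WellFounded using (Acc; acc; WellFounded)
open import Relation.Binary.Core using (Rel)
open import Relation.Binary.Definitions using (Decidable)
open import Relation.Binary.Structures using (IsDecPartialOrder)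
import Relation.Binary.Construct.NonStrictToStrict as ToStrict
open import Relation.Binary.PropositionalEquality.Core using (_≡_)
open import Relation.Nullary.Negation.Core using (¬_)
open import Relation.Nullary.Decidable.Core using (dec⇒maybe; _×-dec_)

-- The countable set 𝒩 of names.  In terms, names are de Bruijn indices:
-- under d binders, the free name u : 𝒩 is written d + u, and the indices
-- below d are the bound names, innermost first.  Terms are therefore
-- identified up to renaming of bound names.  Commutation of restrictions is
-- not imposed: it changes neither the labels of transitions nor the states.

Name : Set
Name = ℕ

Polarity : Set
Polarity = Sign

Position : Set
Position = List ℤ

data Label : Set where
  vis : Name → Polarity → Position → Label
  int : Position → Position → Label

positions : Label → List Position
positions (vis u ε ι) = ι ∷ []
positions (int ι κ)   = ι ∷ κ ∷ []

_≼_ : Position → Position → Set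
_≼_ = Prefix _≡_

Independent : Position → Position → Set
Independent ι κ = ¬ (ι ≼ κ) × ¬ (κ ≼ ι)

IndependentLabels : Label → Label → Set
IndependentLabels a b =
  All (λ ι → All (λ κ → Independent ι κ) (positions b)) (positions a)

infix 4 _∼_

data _∼_ : List Label → List Label → Set where
  swap    : ∀ {a b} → IndependentLabels a b → a ∷ b ∷ [] ∼ b ∷ a ∷ []
  ++-cong : ∀ {as as′ bs bs′} → as ∼ as′ → bs ∼ bs′ → as ++ bs ∼ as′ ++ bs′
  refl    : ∀ {as} → as ∼ as
  sym     : ∀ {as bs} → as ∼ bs → bs ∼ as
  trans   : ∀ {as bs cs} → as ∼ bs → bs ∼ cs → as ∼ cs

ext : (Name → Name) → Name → Name
ext ρ zero    = zero
ext ρ (suc u) = suc (ρ u)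

exchange : Name → Name
exchange zero          = suc zero
exchange (suc zero)    = zero
exchange (suc (suc u)) = suc (suc u)

record Trace : Set₁ where
  infix 4 _≤_
  field
    size    : ℕ
    pol     : Fin size → Polarity
    subj    : Fin size → Name ⊎ Fin size
    _≤_     : Rel (Fin size) 0ℓ
    isOrder : IsDecPartialOrder _≡_ _≤_

  open ToStrict _≡_ _≤_ public using (_<_)

  field
    subj-<  : ∀ {a b} → subj b ≡ inj₂ a → a < b
    N       : List (Polarity × (Name ⊎ Fin size))
    N-set   : Unique N

  _<?_ : Decidable _<_
  _<?_ = ToStrict.<-decidable _≡_ _≤_
           (IsDecPartialOrder._≟_ isOrder) (IsDecPartialOrder._≤?_ isOrder)

  >-wellFounded : WellFounded (flip _<_)
  >-wellFounded = spo-noetherian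
    (ToStrict.<-isStrictPartialOrder _≡_ _≤_
      (IsDecPartialOrder.isPartialOrder isOrder))

  events : List (Fin size)
  events = allFin size

  below above : Fin size → List (Fin size)
  below a = filter (_<? a) events
  above a = filter (a <?_) events

  <-pairs : List (Fin size × Fin size)
  <-pairs = filter (uncurry _<?_) (cartesianProduct events events)

  roots : List (Fin size × Name)
  roots = mapMaybe (λ a → named a (subj a)) events
    where
    named : Fin size → Name ⊎ Fin size → Maybe (Fin size × Name)
    named a (inj₁ u) = just (a , u)
    named a (inj₂ _) = nothing

  children : (a : Fin size) → List (∃ λ c → subj c ≡ inj₂ a)
  children a = mapMaybe
    (λ c → Maybe.map (c ,_) (dec⇒maybe (Sum.≡-dec ℕ._≟_ Fin._≟_ (subj c) (inj₂ a))))
    events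

  N-free : List (Polarity × Name)
  N-free = mapMaybe free N
    where
    free : Polarity × (Name ⊎ Fin size) → Maybe (Polarity × Name)
    free (ε , inj₁ u) = just (ε , u)
    free (ε , inj₂ _) = nothing

  N-at : Fin size → List Polarity
  N-at a = mapMaybe at N
    where
    at : Polarity × (Name ⊎ Fin size) → Maybe Polarity
    at (ε , inj₁ _) = nothing
    at (ε , inj₂ b) = Maybe.map (λ _ → ε) (dec⇒maybe (b Fin.≟ a))

module Calculus {c ℓ : Level} (𝕂 : CommutativeSemiring c ℓ) where

  open CommutativeSemiring 𝕂 using (Carrier; _≈_; _+_; _*_; 0#; 1#)

  infixr 6 _∣_ _∥_
  infixr 7 _·_
  infixr 5 _⊕_

  -- act u ε P is u^ε(x).P and ν P is νx P, where x is index 0 in P.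
  data Term : Set c where
    const : Carrier → Term
    act   : Name → Polarity → Term → Term
    ◇     : Term → Term
    _∣_   : Term → Term → Term
    _∥_   : Term → Term → Term
    ν     : Term → Term

  rename : (Name → Name) → Term → Term
  rename ρ (const k)   = const k
  rename ρ (act u ε P) = act (ρ u) ε (rename (ext ρ) P)
  rename ρ (◇ P)       = ◇ (rename ρ P)
  rename ρ (P ∣ Q)     = rename ρ P ∣ rename ρ Q
  rename ρ (P ∥ Q)     = rename ρ P ∥ rename ρ Q
  rename ρ (ν P)       = ν (rename (ext ρ) P)

  weaken : Term → Term
  weaken = rename suc

  -- The target of a visible transition u^ε(x):ι lives under the binder of x,
  -- which is its index 0; the target of an internal transition is in the scope
  -- of its source.  This builds in the freshness of x and, in the rule for
  -- synchronisation, the identification of the two objects.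
  infix 4 _—[_]→_

  data _—[_]→_ : Term → Label → Term → Set c where
    act  : ∀ {u ε P} → act u ε P —[ vis u ε [] ]→ ◇ P

    ◇ᵛ   : ∀ {P P′ u ε ι} → P —[ vis u ε ι ]→ P′ →
           ◇ P —[ vis u ε (+ 1 ∷ ι) ]→ ◇ P′
    ◇ⁱ   : ∀ {P P′ ι κ} → P —[ int ι κ ]→ P′ →
           ◇ P —[ int (+ 1 ∷ ι) (+ 1 ∷ κ) ]→ ◇ P′

    ∣ˡᵛ  : ∀ {P P′ Q u ε ι} → P —[ vis u ε ι ]→ P′ →
           P ∣ Q —[ vis u ε (+ 1 ∷ ι) ]→ P′ ∣ weaken Q
    ∣ˡⁱ  : ∀ {P P′ Q ι κ} → P —[ int ι κ ]→ P′ →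
           P ∣ Q —[ int (+ 1 ∷ ι) (+ 1 ∷ κ) ]→ P′ ∣ Q
    ∣ʳᵛ  : ∀ {P P′ Q u ε ι} → P —[ vis u ε ι ]→ P′ →
           Q ∣ P —[ vis u ε (+ 2 ∷ ι) ]→ weaken Q ∣ P′
    ∣ʳⁱ  : ∀ {P P′ Q ι κ} → P —[ int ι κ ]→ P′ →
           Q ∣ P —[ int (+ 2 ∷ ι) (+ 2 ∷ κ) ]→ Q ∣ P′

    ∥ˡᵛ  : ∀ {P P′ Q u ε ι} → P —[ vis u ε ι ]→ P′ →
           P ∥ Q —[ vis u ε (+ 1 ∷ ι) ]→ P′ ∥ weaken Q
    ∥ˡⁱ  : ∀ {P P′ Q ι κ} → P —[ int ι κ ]→ P′ →
           P ∥ Q —[ int (+ 1 ∷ ι) (+ 1 ∷ κ) ]→ P′ ∥ Q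
    ∥ʳᵛ  : ∀ {P P′ Q u ε ι} → P —[ vis u ε ι ]→ P′ →
           Q ∥ P —[ vis u ε (+ 2 ∷ ι) ]→ weaken Q ∥ P′
    ∥ʳⁱ  : ∀ {P P′ Q ι κ} → P —[ int ι κ ]→ P′ →
           Q ∥ P —[ int (+ 2 ∷ ι) (+ 2 ∷ κ) ]→ Q ∥ P′

    -- The subject suc u is a name other than the restricted index 0.
    νᵛ   : ∀ {P P′ u ε ι} → P —[ vis (suc u) ε ι ]→ P′ →
           ν P —[ vis u ε ι ]→ ν (rename exchange P′)
    νⁱ   : ∀ {P P′ ι κ} → P —[ int ι κ ]→ P′ →
           ν P —[ int ι κ ]→ ν P′

    sync : ∀ {P P′ Q Q′ u ε ι κ} →
           P —[ vis u ε ι ]→ P′ → Q —[ vis u (opposite ε) κ ]→ Q′ →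
           P ∣ Q —[ int (+ 1 ∷ ι) (+ 2 ∷ κ) ]→ ν (P′ ∣ Q′)

  data _⟶*[_]_ : Term → List Label → Term → Set c where
    []  : ∀ {P} → P ⟶*[ [] ] P
    _∷_ : ∀ {P Q R ι κ as} → P —[ int ι κ ]→ Q → Q ⟶*[ as ] R →
          P ⟶*[ int ι κ ∷ as ] R

  record MaximalSequence (P : Term) : Set c where
    field
      labels  : List Label
      end     : Term
      path    : P ⟶*[ labels ] end
      maximal : ∀ {ι κ Q} → ¬ (end —[ int ι κ ]→ Q)

  open MaximalSequence public

  _≈ₕ_ : ∀ {P} → MaximalSequence P → MaximalSequence P → Set
  ρ ≈ₕ σ = labels ρ ∼ labels σ

  state : Term → Carrier
  state (const k)   = k
  state (act u ε P) = 1#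
  state (◇ P)       = state P
  state (P ∣ Q)     = state P * state Q
  state (P ∥ Q)     = state P * state Q
  state (ν P)       = state P

  -- A run is a class of maximal sequences modulo ≈ₕ.  The sum over runs is
  -- taken along a list with exactly one representative of each class:
  -- Outcome P v states that ⟨P⟩ is v.  This determines v up to ≈, because the
  -- ends of homotopic sequences differ only by commutation of restrictions and
  -- so have the same state.
  record Outcome (P : Term) (v : Carrier) : Set (c ⊔ ℓ) where
    field
      runs     : List (MaximalSequence P)
      distinct : AllPairs (λ ρ σ → ¬ (ρ ≈ₕ σ)) runs
      complete : ∀ ρ → Any (ρ ≈ₕ_) runs
      sum      : v ≈ foldr _+_ 0# (map (λ ρ → state (end ρ)) runs)

  infix 4 _≃_

  -- For every R the outcomes ⟨P|R⟩ and ⟨Q|R⟩ have a common value v.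
  _≃_ : Term → Term → Set (c ⊔ ℓ)
  P ≃ Q = ∀ R → ∃ λ v → Outcome (P ∣ R) v × Outcome (Q ∣ R) v

  -- Prefix u^ε.P with a fresh bound object.
  act₀ : Name → Polarity → Term → Term
  act₀ u ε P = act u ε (weaken P)

  _·_ : Carrier → Term → Term
  k · P = const k ∣ P

  _⊕_ : Term → Term → Term
  P ⊕ Q = ν ((act₀ 0 Sign.+ (weaken P) ∣ act₀ 0 Sign.+ (weaken Q)) ∣
             act₀ 0 Sign.- (const 1#))

  ⨁ : List Term → Term
  ⨁ = foldr _⊕_ (const 0#)

  ∏ : List Term → Term
  ∏ = foldr _∥_ (const 1#)

  -- In lin u ε P the continuation P is under the binder of the object (index 0),
  -- as in act u ε P.  Outside the action w is index 0; in its continuation w is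
  -- index 1.
  lin : Name → Polarity → Term → Term
  lin u ε P =
    ν (act (suc u) ε (rename (ext suc) P ∣ act₀ 1 Sign.+ (const 1#)) ∣
       (act₀ 0 Sign.+ (const 0#) ∣ act₀ 0 Sign.- (const 1#)))

  lin₀ : Name → Polarity → Term → Term
  lin₀ u ε P = lin u ε (weaken P)

  ν^ : ℕ → Term → Term
  ν^ zero    P = P
  ν^ (suc n) P = ν (ν^ n P)

  module Implementation (T : Trace) where

    open Trace T

    -- The names x_ab and y_ab, as seen under d binders inside the restriction
    -- of the n² names x followed by the n² names y.
    x y : ℕ → Fin size → Fin size → Name
    x d a b = d ℕ.+ toℕ (combine a b)
    y d a b = d ℕ.+ (size ℕ.* size ℕ.+ toℕ (combine a b))

    #xy : ℕ
    #xy = size ℕ.* size ℕ.+ size ℕ.* size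

    -- A d v a is A_a under d binders, v being the index of the subject of
    -- act(a).  In the continuation of act(a) the name z_a is index 0; it is the
    -- subject of act(c) for every c with s(c) = a.
    A : (d : ℕ) (v : Name) (a : Fin size) → Acc (flip _<_) a → Term
    A d v a (acc above-acc) =
      foldr (λ b P → lin₀ (x d b a) Sign.+ P)
        (lin v (pol a)
          (∏ (map (λ e → lin₀ (y (suc d) a e) Sign.- (const 1#)) (above a))
           ∥ ∏ (map (λ (e , se≡a) → A (suc d) 0 e (above-acc (subj-< se≡a)))
                    (children a))
           ∥ ∏ (map (λ ε → act₀ 0 ε (const 0#)) (N-at a))))
        (below a)

    relay : Fin size × Fin size → Term
    relay (a , b) = lin₀ (y 0 a b) Sign.+ (lin₀ (x 0 a b) Sign.- (const 1#))

    implementation : Term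
    implementation =
      ν^ #xy (∏ (map (λ (a , u) → A 0 (#xy ℕ.+ u) a (>-wellFounded a)) roots)
              ∣ ∏ (map relay <-pairs))
      ∥ ∏ (map (λ (ε , u) → act₀ u ε (const 0#)) N-free)

  ⦅_⦆ : Trace → Term
  ⦅ T ⦆ = Implementation.implementation T

{-# OPTIONS --safe #-}

-- When addition is idempotent, ⟨P|R⟩ is the sum of the states reached by all the
-- maximal sequences of P|R, however often a state occurs and whatever the
-- homotopies.  A maximal sequence of P|R consists of a word w of visible actions
-- of P, leading P to a stuck term E, and of the co-actions of R, interleaved with
-- internal steps of both; its last term is stuck when R ends stuck and offers no
-- co-action of an offer of E.  So P contributes, for each of its finitely many
-- pairs (w, E), what state E · ⦅T⦆ contributes, where T is the totally ordered
-- trace whose events are the letters of w and whose set N consists of the offers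
-- of E.  That ⦅T⦆ runs only through w, up to runs of value 0, is seen as follows:
-- terms are compared with an idealised calculus where linear prefixes
-- are primitive.  There, an event can occur only after the relays have carried a
-- signal from all earlier events, and every event occurs exactly once.

module Submission where

open import Defs
open import Level using (Level; _⊔_)
open import Algebra.Bundles using (CommutativeSemiring)
open import Data.Nat.Base as ℕ using (ℕ; zero; suc; s≤s; z≤n)
import Data.Nat.Properties as ℕ
open import Algebra.Properties.CommutativeSemigroup ℕ.+-commutativeSemigroup using (interchange; x∙yz≈y∙xz)
open import Data.Bool.Base using (Bool; true; false; if_then_else_; _∧_; _∨_)
open import Data.Empty.Polymorphic using (⊥)
open import Data.Fin.Base as Fin using (Fin; zero; suc; toℕ; fromℕ; fromℕ<; inject; inject₁; combine; remQuot)
open import Data.Fin.Induction using (spo-wellFounded)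
import Data.Fin.Properties as Fin
open import Data.Integer.Base using (+_)
import Data.Integer.Properties as ℤ
open import Data.List.Base
  using (List; []; _∷_; _++_; map; mapMaybe; concatMap; foldr; cartesianProduct; drop; length; lookup; deduplicate)
open import Data.List.Membership.Propositional using (_∈_; _∉_; find; lose)
open import Data.List.Membership.Propositional.Properties
  using (∈-map⁺; ∈-map⁻; ∈-++⁺ˡ; ∈-++⁺ʳ; ∈-concatMap⁺; ∈-filter⁺; ∈-filter⁻; ∈-allFin;
         ∈-cartesianProduct⁺; ∈-deduplicate⁺; ∈-deduplicate⁻)
open import Data.List.Properties as List using (map-cong; mapMaybe-cong; drop-all)
open import Data.List.Relation.Binary.Prefix.Heterogeneous using ([]; _∷_)
open import Data.List.Relation.Binary.Prefix.Heterogeneous.Properties using (prefix?)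
open import Data.List.Relation.Binary.Subset.Propositional using (_⊆_)
open import Data.List.Relation.Binary.Subset.Propositional.Properties using (∷⁺ʳ)
open import Data.List.Relation.Unary.All as All using (All; []; _∷_; all?)
import Data.List.Relation.Unary.All.Properties as All
open import Data.List.Relation.Unary.AllPairs using (AllPairs; []; _∷_)
open import Data.List.Relation.Unary.Any as Any using (Any; here; there; any?)
import Data.List.Relation.Unary.Any.Properties as Any
open import Data.List.Relation.Unary.Unique.Propositional using (Unique)
open import Data.List.Relation.Unary.Unique.Propositional.Properties
  using (allFin⁺; filter⁺; cartesianProduct⁺; Unique[x∷xs]⇒x∉xs)
import Data.List.Relation.Unary.Unique.DecPropositional.Properties as UniqueDec
open import Data.Maybe.Base as Maybe using (Maybe; just; nothing)
open import Data.Maybe.Properties using (just-injective)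
open import Data.Nat.Induction using (<-wellFounded)
open import Data.Nat.ListAction using (sum)
open import Data.Nat.Solver using (module +-*-Solver)
open import Data.Product.Base using (∃; _×_; _,_; proj₁; proj₂; uncurry)
import Data.Product.Properties as Product
open import Data.Sign.Base as Sign using (opposite)
import Data.Sign.Properties as Sign
open import Data.Sum.Base using (_⊎_; inj₁; inj₂; [_,_]′; map₂)
import Data.Sum.Properties as Sum
open import Data.Unit.Polymorphic.Base using (⊤; tt)
open import Function.Base using (_∘_; case_of_; flip; id)
open import Induction.WellFounded using (Acc; acc; WellFounded)
open import Relation.Binary.Definitions using (Total; DecidableEquality; tri<; tri≈; tri>)
open import Relation.Binary.PropositionalEquality as ≡ using (_≡_; _≢_; refl; cong; cong₂; subst; subst₂)
import Relation.Binary.Construct.NonStrictToStrict as ToStrict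
import Relation.Binary.Reasoning.Setoid as ≈-Reasoning
open import Relation.Binary.Structures using (IsDecPartialOrder; IsDecTotalOrder)
open import Relation.Nullary using (¬_; Dec; yes; no; does; contradiction)
open import Relation.Nullary.Decidable using (_×-dec_; ¬?; map′)
open import Relation.Nullary.Decidable.Core using (dec⇒maybe)

-- Decidability of homotopy

-- The gap between a linear prefix and its encoding is closed by values. The guard of a linear
-- action, `w.0` beside a co-action on `w`, can always synchronise with itself and uncover a 0, so a
-- prefix that never fires cannot survive in a nonzero run. Once the prefix has fired, the
-- acknowledgement `w.1` can take the co-action away and leave `w.0` inert. Offers `u.0` act
-- likewise: a run cannot stop while one of them has a partner, and using it makes the run worth 0.
-- Hence each step of an encoding is an ideal step, is administrative, or is fatal. Idempotence
-- turns sums into joins with 0 least, so two terms are compared by the values of their runs alone,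
-- one inclusion at a time, and fatal runs drop out. Homotopy must still be decided, because an
-- outcome lists exactly one representative of each class. That events fire only in the order of `w`
-- is an invariant on the wires and events used so far; it starts from a count showing that every
-- action is present exactly once.

_≟ₗ_ : DecidableEquality Label
vis u ε ι ≟ₗ vis u′ ε′ ι′ =
  map′ (λ { (refl , refl , refl) → refl }) (λ { refl → refl , refl , refl })
    ((u ℕ.≟ u′) ×-dec (ε Sign.≟ ε′) ×-dec List.≡-dec ℤ._≟_ ι ι′)
vis _ _ _ ≟ₗ int _ _ = no λ ()
int _ _ ≟ₗ vis _ _ _ = no λ ()
int ι κ ≟ₗ int ι′ κ′ =
  map′ (λ { (refl , refl) → refl }) (λ { refl → refl , refl })
    (List.≡-dec ℤ._≟_ ι ι′ ×-dec List.≡-dec ℤ._≟_ κ κ′)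

independent? : ∀ a b → Dec (IndependentLabels a b)
independent? a b = all? (λ ι → all? (λ κ →
  ¬? (prefix? ℤ._≟_ ι κ) ×-dec ¬? (prefix? ℤ._≟_ κ ι)) (positions b)) (positions a)

≼-refl : ∀ ι → ι ≼ ι
≼-refl []      = []
≼-refl (i ∷ ι) = refl ∷ ≼-refl ι

independent-irrefl : ∀ a → ¬ IndependentLabels a a
independent-irrefl (vis u ε ι) (((¬p , _) ∷ _) ∷ _) = ¬p (≼-refl ι)
independent-irrefl (int ι κ)   (((¬p , _) ∷ _) ∷ _) = ¬p (≼-refl ι)

independent-sym : ∀ a b → IndependentLabels a b → IndependentLabels b a
independent-sym a b ind =
  All.tabulate λ κ∈ → All.tabulate λ ι∈ →
    case All.lookup (All.lookup ind ι∈) κ∈ of λ { (p , q) → q , p }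

-- Extract a bs bs′ : bs is homotopic to a ∷ bs′ by moving an occurrence of a
-- to the front.
data Extract (a : Label) : List Label → List Label → Set where
  here  : ∀ {bs} → Extract a (a ∷ bs) bs
  there : ∀ {b bs bs′} → IndependentLabels a b → Extract a bs bs′ →
          Extract a (b ∷ bs) (b ∷ bs′)

extract⇒∼ : ∀ {a bs bs′} → Extract a bs bs′ → bs ∼ (a ∷ bs′)
extract⇒∼ here = refl
extract⇒∼ {a} (there {b} ind e) =
  trans (++-cong (refl {b ∷ []}) (extract⇒∼ e))
        (++-cong (swap (independent-sym a b ind)) refl)

-- No label is independent of itself, so only the first occurrence of `a` can be moved to the front.
-- The decision procedure relies on this to refute homotopy from a single extraction.
extract-functional : ∀ {a bs cs ds} → Extract a bs cs → Extract a bs ds → cs ≡ ds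
extract-functional here here = refl
extract-functional {a} here (there ind _) = contradiction ind (independent-irrefl a)
extract-functional {a} (there ind _) here = contradiction ind (independent-irrefl a)
extract-functional (there _ d) (there _ e) = cong (_ ∷_) (extract-functional d e)

extract? : ∀ a bs → Dec (∃ (Extract a bs))
extract? a [] = no λ { (_ , ()) }
extract? a (b ∷ bs) with a ≟ₗ b
... | yes refl = yes (bs , here)
... | no a≢b with independent? a b | extract? a bs
... | yes ind | yes (bs′ , e) = yes (b ∷ bs′ , there ind e)
... | yes ind | no ¬e = no λ { (_ , here) → a≢b refl ; (_ , there _ e) → ¬e (_ , e) }
... | no dep | _ = no λ { (_ , here) → a≢b refl ; (_ , there ind _) → dep ind }

Passes : Label → List Label → Set
Passes a = All (IndependentLabels a)

-- Homotopy only permutes labels. Both directions are carried together because `sym` exchanges them.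
passes-resp-∼ : ∀ {a as bs} → as ∼ bs → (Passes a as → Passes a bs) × (Passes a bs → Passes a as)
passes-resp-∼ (swap _) = (λ { (p ∷ q ∷ []) → q ∷ p ∷ [] }) , (λ { (p ∷ q ∷ []) → q ∷ p ∷ [] })
passes-resp-∼ (++-cong {as} {as′} p q) =
  (λ i → All.++⁺ (proj₁ (passes-resp-∼ p) (All.++⁻ˡ as i)) (proj₁ (passes-resp-∼ q) (All.++⁻ʳ as i))) ,
  (λ i → All.++⁺ (proj₂ (passes-resp-∼ p) (All.++⁻ˡ as′ i)) (proj₂ (passes-resp-∼ q) (All.++⁻ʳ as′ i)))
passes-resp-∼ refl = (λ i → i) , (λ i → i)
passes-resp-∼ (sym p) = proj₂ (passes-resp-∼ p) , proj₁ (passes-resp-∼ p)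
passes-resp-∼ (trans p q) =
  (λ i → proj₁ (passes-resp-∼ q) (proj₁ (passes-resp-∼ p) i)) ,
  (λ i → proj₂ (passes-resp-∼ p) (proj₂ (passes-resp-∼ q) i))

extract-++ˡ : ∀ {a as as′} bs → Extract a as as′ → Extract a (as ++ bs) (as′ ++ bs)
extract-++ˡ bs here        = here
extract-++ˡ bs (there i e) = there i (extract-++ˡ bs e)

extract-++ʳ : ∀ {a as bs bs′} → Passes a as → Extract a bs bs′ →
              Extract a (as ++ bs) (as ++ bs′)
extract-++ʳ []       e = e
extract-++ʳ (i ∷ is) e = there i (extract-++ʳ is e)

extract-++⁻ : ∀ {a} as {bs cs} → Extract a (as ++ bs) cs →
  (∃ λ as′ → Extract a as as′ × cs ≡ as′ ++ bs) ⊎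
  (∃ λ bs′ → Passes a as × Extract a bs bs′ × cs ≡ as ++ bs′)
extract-++⁻ []       e           = inj₂ (_ , [] , e , refl)
extract-++⁻ (_ ∷ as) here        = inj₁ (as , here , refl)
extract-++⁻ (a ∷ as) (there i e) with extract-++⁻ as e
... | inj₁ (as′ , e′ , refl)     = inj₁ (a ∷ as′ , there i e′ , refl)
... | inj₂ (bs′ , p , e′ , refl) = inj₂ (bs′ , i ∷ p , e′ , refl)

Simulates : List Label → List Label → Set
Simulates as bs = ∀ {a as′} → Extract a as as′ → ∃ λ bs′ → Extract a bs bs′ × as′ ∼ bs′

simulates-swap : ∀ {a b} → IndependentLabels a b → Simulates (a ∷ b ∷ []) (b ∷ a ∷ [])
simulates-swap {a} {b} ind here             = _ , there ind here , refl
simulates-swap         ind (there _ here)   = _ , here , refl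
simulates-swap         ind (there _ (there _ ()))

simulates-++ : ∀ {as as′ bs bs′} → as ∼ as′ → Simulates as as′ → bs ∼ bs′ → Simulates bs bs′ →
               Simulates (as ++ bs) (as′ ++ bs′)
simulates-++ {as} {bs′ = bs′} p sp q sq e with extract-++⁻ as e
... | inj₁ (_ , e′ , refl) with sp e′
...   | _ , f , r = _ , extract-++ˡ bs′ f , ++-cong r q
simulates-++ {as} {bs′ = bs′} p sp q sq e | inj₂ (_ , i , e′ , refl) with sq e′
...   | _ , f , r = _ , extract-++ʳ (proj₁ (passes-resp-∼ p) i) f , ++-cong p r

simulates-trans : ∀ {as bs cs} → Simulates as bs → Simulates bs cs → Simulates as cs
simulates-trans s t e with s e
... | _ , f , p with t f
... | _ , g , q = _ , g , trans p q

-- This inversion makes homotopy decidable: `a ∷ as ∼ bs` forces `a` to be extractable from `bs`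
-- with a remainder homotopic to `as`. In a concatenation, a label of the right half reaches the
-- front only by passing the left half, which is why passing must respect homotopy.
∼⇒simulates : ∀ {as bs} → as ∼ bs → Simulates as bs × Simulates bs as
∼⇒simulates (swap {a} {b} ind) = simulates-swap ind , simulates-swap (independent-sym a b ind)
∼⇒simulates (++-cong p q) with ∼⇒simulates p | ∼⇒simulates q
... | sp , sp′ | sq , sq′ = simulates-++ p sp q sq , simulates-++ (sym p) sp′ (sym q) sq′
∼⇒simulates refl = (λ e → _ , e , refl) , (λ e → _ , e , refl)
∼⇒simulates (sym p) with ∼⇒simulates p
... | s , s′ = s′ , s
∼⇒simulates (trans p q) with ∼⇒simulates p | ∼⇒simulates q
... | sp , sp′ | sq , sq′ = simulates-trans sp sq , simulates-trans sq′ sp′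

_∼?_ : ∀ as bs → Dec (as ∼ bs)
[] ∼? [] = yes refl
[] ∼? (b ∷ bs) = no λ p → case proj₂ (∼⇒simulates p) here of λ { (_ , () , _) }
(a ∷ as) ∼? bs with extract? a bs
... | no ¬e = no λ p → case proj₁ (∼⇒simulates p) here of λ { (_ , e , _) → ¬e (_ , e) }
... | yes (bs′ , e) with as ∼? bs′
...   | yes p = yes (trans (++-cong (refl {a ∷ []}) p) (sym (extract⇒∼ e)))
...   | no ¬p = no λ p → case proj₁ (∼⇒simulates p) here of λ
        { (_ , f , q) → ¬p (subst (as ∼_) (extract-functional f e) q) }

-- Global names and environments

-- The names visible from the outside, and the wires x_ab and y_ab.
data Shared : Set where
  free   : Name → Shared
  object : ℕ → Shared

data Wire : Set where
  wx wy : ℕ → ℕ → Wire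

Global : Set
Global = Shared ⊎ Wire

-- Maps the indices in scope to global names; nothing stands for the bound
-- names internal to linear actions and sums.
Env : Set
Env = Name → Maybe Global

infixr 5 _◂_

_◂_ : Maybe Global → Env → Env
(x ◂ η) zero    = x
(x ◂ η) (suc u) = η u

data Action : Set where
  event : Shared → Polarity → ℕ → Action
  wire  : Wire → Polarity → Action

wire-injective : ∀ {p q ε δ} → wire p ε ≡ wire q δ → p ≡ q
wire-injective refl = refl

event-injective : ∀ {s t ε δ a b} → event s ε a ≡ event t δ b → a ≡ b
event-injective refl = refl

subjectOf : Action → Global
subjectOf (event s ε a) = inj₁ s
subjectOf (wire p ε)    = inj₂ p

polarityOf : Action → Polarity
polarityOf (event s ε a) = ε
polarityOf (wire p ε)    = ε

objectOf : Action → Maybe Global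
objectOf (event s ε a) = just (inj₁ (object a))
objectOf (wire p ε)    = nothing

NotPrivate NotShared : Maybe Global → Set
NotPrivate x = ∀ p → x ≢ just (inj₂ p)
NotShared  x = ∀ s → x ≢ just (inj₁ s)

objectOf-notPrivate : ∀ α → NotPrivate (objectOf α)
objectOf-notPrivate (event s ε a) p ()
objectOf-notPrivate (wire q ε)    p ()

-- Two sides that use the same wire must name it by the same index, or the term could not perform
-- their ideal synchronisation.
PrivateInjective : Env → Set
PrivateInjective η = ∀ {u v p} → η u ≡ just (inj₂ p) → η v ≡ just (inj₂ p) → u ≡ v

privateInjective-◂ : ∀ {x η} → NotPrivate x → PrivateInjective η → PrivateInjective (x ◂ η)
privateInjective-◂ np inj {zero}  {_}     p q = contradiction p (np _)
privateInjective-◂ np inj {suc u} {zero}  p q = contradiction q (np _)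
privateInjective-◂ np inj {suc u} {suc v} p q = cong suc (inj p q)

-- The condition on private names keeps PrivateInjective stable under renaming.
record Renaming (η : Env) (ρ : Name → Name) (η′ : Env) : Set where
  field
    resp  : ∀ u → η′ (ρ u) ≡ η u
    cover : ∀ {v p} → η′ v ≡ just (inj₂ p) → ∃ λ u → ρ u ≡ v

open Renaming

renaming-ext : ∀ {η ρ η′ x} → Renaming η ρ η′ → Renaming (x ◂ η) (ext ρ) (x ◂ η′)
renaming-ext r .resp zero    = refl
renaming-ext r .resp (suc u) = resp r u
renaming-ext r .cover {zero}  _ = zero , refl
renaming-ext r .cover {suc v} p = let u , eq = cover r p in suc u , cong suc eq

renaming-suc : ∀ {η x} → NotPrivate x → Renaming η suc (x ◂ η)
renaming-suc np .resp u = refl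
renaming-suc np .cover {zero}  p = contradiction p (np _)
renaming-suc np .cover {suc v} p = v , refl

renaming-exchange : ∀ {η x y} → Renaming (x ◂ y ◂ η) exchange (y ◂ x ◂ η)
renaming-exchange .resp zero          = refl
renaming-exchange .resp (suc zero)    = refl
renaming-exchange .resp (suc (suc u)) = refl
renaming-exchange .cover {zero}        _ = 1 , refl
renaming-exchange .cover {suc zero}    _ = 0 , refl
renaming-exchange .cover {suc (suc v)} _ = suc (suc v) , refl

renaming-privateInjective : ∀ {η ρ η′} → Renaming η ρ η′ → PrivateInjective η → PrivateInjective η′
renaming-privateInjective {ρ = ρ} r inj {u} {v} p q with cover r p | cover r q
... | u′ , refl | v′ , refl =
  cong ρ (inj (≡.trans (≡.sym (resp r u′)) p) (≡.trans (≡.sym (resp r v′)) q))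

notPrivate-nothing : NotPrivate nothing
notPrivate-nothing p ()

notShared-nothing : NotShared nothing
notShared-nothing p ()

freeEnv : Env
freeEnv u = just (inj₁ (free u))

-- Wires are numbered as in the implementation: first the n² names x, then the
-- n² names y, then the free names.
module WireEnv (n : ℕ) where

  #x #xy : ℕ
  #x  = n ℕ.* n
  #xy = #x ℕ.+ #x

  data View : Name → Set where
    x-view    : ∀ a b → View (toℕ (combine {n} {n} a b))
    y-view    : ∀ a b → View (#x ℕ.+ toℕ (combine {n} {n} a b))
    free-view : ∀ u → View (#xy ℕ.+ u)

  private
    combine-fromℕ< : ∀ {u} (u< : u ℕ.< #x) → ∃ λ a → ∃ λ b → u ≡ toℕ (combine {n} {n} a b)
    combine-fromℕ< {u} u< = let a , b = remQuot {n} n (fromℕ< u<) in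
      a , b , ≡.sym (≡.trans (cong toℕ (Fin.combine-remQuot {n} n (fromℕ< u<))) (Fin.toℕ-fromℕ< u<))

  view : ∀ u → View u
  view u with u ℕ.<? #x
  ... | yes u< with combine-fromℕ< u<
  ...   | a , b , refl = x-view a b
  view u | no u≮ with ℕ.m≤n⇒∃[o]m+o≡n (ℕ.≮⇒≥ u≮)
  ...   | v , refl with v ℕ.<? #x
  ...     | no v≮ with ℕ.m≤n⇒∃[o]m+o≡n (ℕ.≮⇒≥ v≮)
  ...       | w , refl = subst View (ℕ.+-assoc #x #x w) (free-view w)
  view u | no u≮ | v , refl | yes v< with combine-fromℕ< v<
  ...       | a , b , refl = y-view a b

  fromView : ∀ {u} → View u → Maybe Global
  fromView (x-view a b)  = just (inj₂ (wx (toℕ a) (toℕ b)))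
  fromView (y-view a b)  = just (inj₂ (wy (toℕ a) (toℕ b)))
  fromView (free-view u) = just (inj₁ (free u))

  wireEnv : Env
  wireEnv u = fromView (view u)

  private
    combine-cong : ∀ {a b a′ b′ : Fin n} → toℕ (combine a b) ≡ toℕ (combine a′ b′) → a ≡ a′ × b ≡ b′
    combine-cong eq = Fin.combine-injective _ _ _ _ (Fin.toℕ-injective eq)

    combine-< : ∀ (a b : Fin n) → toℕ (combine a b) ℕ.< #x
    combine-< a b = Fin.toℕ<n (combine a b)

    too-big : ∀ {m k} (a b : Fin n) → #x ℕ.≤ m → toℕ (combine a b) ≢ m ℕ.+ k
    too-big a b p eq = ℕ.<-irrefl eq (ℕ.<-≤-trans (combine-< a b) (ℕ.≤-trans p (ℕ.m≤m+n _ _)))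

    +-assoc-cancel : ∀ {a b u} → #x ℕ.+ a ≡ #xy ℕ.+ u → b ≡ a → b ≡ #x ℕ.+ u
    +-assoc-cancel {u = u} eq refl = ℕ.+-cancelˡ-≡ #x _ _ (≡.trans eq (ℕ.+-assoc #x #x u))

    -- Allows `wireEnv` to be evaluated at whichever form an index is written in, not only at the
    -- one that `view` computes.
    fromView-unique : ∀ {u v} (p : View u) (q : View v) → u ≡ v → fromView p ≡ fromView q
    fromView-unique (x-view a b) (x-view a′ b′) eq with combine-cong eq
    ... | refl , refl = refl
    fromView-unique (x-view a b) (y-view a′ b′) eq = contradiction eq (too-big a b ℕ.≤-refl)
    fromView-unique (x-view a b) (free-view u)  eq = contradiction eq (too-big a b (ℕ.m≤m+n _ _))
    fromView-unique (y-view a b) (x-view a′ b′) eq = contradiction (≡.sym eq) (too-big a′ b′ ℕ.≤-refl)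
    fromView-unique (y-view a b) (y-view a′ b′) eq with combine-cong (ℕ.+-cancelˡ-≡ #x _ _ eq)
    ... | refl , refl = refl
    fromView-unique (y-view a b) (free-view u)  eq =
      contradiction (+-assoc-cancel eq refl) (too-big a b ℕ.≤-refl)
    fromView-unique (free-view u) (x-view a b)  eq = contradiction (≡.sym eq) (too-big a b (ℕ.m≤m+n _ _))
    fromView-unique (free-view u) (y-view a b)  eq =
      contradiction (+-assoc-cancel (≡.sym eq) refl) (too-big a b ℕ.≤-refl)
    fromView-unique (free-view u) (free-view v) eq with ℕ.+-cancelˡ-≡ #xy _ _ eq
    ... | refl = refl

    fromView-injective : ∀ {u v p} (w : View u) (w′ : View v) →
      fromView w ≡ just (inj₂ p) → fromView w′ ≡ just (inj₂ p) → u ≡ v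
    fromView-injective (x-view a b) (x-view a′ b′) refl eq with eqs eq
      where
      eqs : ∀ {a b a′ b′ : Fin n} → fromView (x-view a′ b′) ≡ fromView (x-view a b) → a ≡ a′ × b ≡ b′
      eqs {a} {b} {a′} {b′} eq with toℕ a | toℕ b | Fin.toℕ-injective {i = a} {j = a′} | Fin.toℕ-injective {i = b} {j = b′}
      eqs refl | _ | _ | f | g = f refl , g refl
    ... | refl , refl = refl
    fromView-injective (y-view a b) (y-view a′ b′) refl eq with eqs eq
      where
      eqs : ∀ {a b a′ b′ : Fin n} → fromView (y-view a′ b′) ≡ fromView (y-view a b) → a ≡ a′ × b ≡ b′
      eqs {a} {b} {a′} {b′} eq with toℕ a | toℕ b | Fin.toℕ-injective {i = a} {j = a′} | Fin.toℕ-injective {i = b} {j = b′}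
      eqs refl | _ | _ | f | g = f refl , g refl
    ... | refl , refl = refl

  wireEnv-x : ∀ a b → wireEnv (toℕ (combine {n} {n} a b)) ≡ just (inj₂ (wx (toℕ a) (toℕ b)))
  wireEnv-x a b = fromView-unique (view _) (x-view a b) refl

  wireEnv-y : ∀ a b → wireEnv (#x ℕ.+ toℕ (combine {n} {n} a b)) ≡ just (inj₂ (wy (toℕ a) (toℕ b)))
  wireEnv-y a b = fromView-unique (view _) (y-view a b) refl

  wireEnv-free : ∀ u → wireEnv (#xy ℕ.+ u) ≡ freeEnv u
  wireEnv-free u = fromView-unique (view _) (free-view u) refl

  wireEnv-privateInjective : PrivateInjective wireEnv
  wireEnv-privateInjective = fromView-injective (view _) (view _)

  wireEnv-notShared : ∀ {u} → u ℕ.< #xy → NotShared (wireEnv u)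
  wireEnv-notShared {u} u< s eq = go (view u) u< eq
    where
    go : ∀ {u} (w : View u) → u ℕ.< #xy → fromView w ≢ just (inj₁ s)
    go (free-view v) v< _ = ℕ.m+n≮m #xy v v<

Item : Set
Item = Action ⊎ (Shared × Polarity)

-- The trace of a word of visible actions

resolve : ∀ i → Name → Name ⊎ Fin i
resolve zero    u       = inj₁ u
resolve (suc i) zero    = inj₂ (fromℕ i)
resolve (suc i) (suc u) = map₂ inject₁ (resolve i u)

-- The environment that agrees with `resolve`: in both, index 0 after `suc i` events is the object
-- of the latest one, which has number `i`.
scope : ℕ → Env
scope zero    = freeEnv
scope (suc i) = just (inj₁ (object i)) ◂ scope i

scope-object : ∀ i {u k} → scope i u ≡ just (inj₁ (object k)) → k ℕ.< i
scope-object (suc i) {zero}  refl = ℕ.n<1+n i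
scope-object (suc i) {suc u} eq   = ℕ.m<n⇒m<1+n (scope-object i eq)

-- Recovers an index from the global name it denotes, and thereby a letter of the word from the
-- subject of an event.
scope-injective : ∀ i {u v} → scope i u ≡ scope i v → u ≡ v
scope-injective zero refl = refl
scope-injective (suc i) {zero}  {zero}  eq = refl
scope-injective (suc i) {zero}  {suc v} eq = contradiction (scope-object i (≡.sym eq)) (ℕ.<-irrefl refl)
scope-injective (suc i) {suc u} {zero}  eq = contradiction (scope-object i eq) (ℕ.<-irrefl refl)
scope-injective (suc i) {suc u} {suc v} eq = cong suc (scope-injective i eq)

scope-notPrivate : ∀ i {u} → NotPrivate (scope i u)
scope-notPrivate zero    {u}     p ()
scope-notPrivate (suc i) {zero}  p ()
scope-notPrivate (suc i) {suc u} p eq = scope-notPrivate i p eq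

_≟ʳ_ : ∀ {n} → DecidableEquality (Polarity × (Name ⊎ Fin n))
_≟ʳ_ = Product.≡-dec Sign._≟_ (Sum.≡-dec ℕ._≟_ Fin._≟_)

drop-lookup : ∀ {a} {A : Set a} (xs : List A) i → drop (toℕ i) xs ≡ lookup xs i ∷ drop (suc (toℕ i)) xs
drop-lookup (x ∷ xs) zero    = refl
drop-lookup (x ∷ xs) (suc i) = drop-lookup xs i

-- The events are the positions of the word in their numerical order, which is total. A term may
-- make the same offer several times whereas `N` is a set, hence the deduplication.
traceOf : List (Name × Polarity) → List (Polarity × Name) → Trace
traceOf w M = record
  { size    = length w
  ; pol     = proj₂ ∘ lookup w
  ; subj    = subject
  ; _≤_     = Fin._≤_
  ; isOrder = IsDecTotalOrder.isDecPartialOrder Fin.≤-isDecTotalOrder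
  ; subj-<  = λ {a} {b} eq → earlier b (resolve (toℕ b) (proj₁ (lookup w b))) eq
  ; N       = deduplicate _≟ʳ_ (map (λ (ε , u) → ε , resolve (length w) u) M)
  ; N-set   = UniqueDec.deduplicate-! _≟ʳ_ (map (λ (ε , u) → ε , resolve (length w) u) M)
  }
  where
  subject : Fin (length w) → Name ⊎ Fin (length w)
  subject a = map₂ inject (resolve (toℕ a) (proj₁ (lookup w a)))
  earlier : ∀ {a} b (s : Name ⊎ Fin (toℕ b)) → map₂ inject s ≡ inj₂ a → a Fin.≤ b × a ≢ b
  earlier b (inj₂ j) refl = ℕ.<⇒≤ j<b , λ { p → ℕ.<-irrefl (cong toℕ p) j<b }
    where
    j<b : toℕ (inject j) ℕ.< toℕ b
    j<b = subst (ℕ._< toℕ b) (≡.sym (Fin.toℕ-inject j)) (Fin.toℕ<n j)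

-- The forest of the events of a trace

weigh : ∀ {a} {A : Set a} → (A → ℕ) → Maybe A → ℕ
weigh f (just x) = f x
weigh f nothing  = 0

module _ {a} {A : Set a} where

  sum-+ : ∀ (f g : A → ℕ) xs → sum (map (λ x → f x ℕ.+ g x) xs) ≡ sum (map f xs) ℕ.+ sum (map g xs)
  sum-+ f g []       = refl
  sum-+ f g (x ∷ xs) rewrite sum-+ f g xs = interchange (f x) (g x) _ _

  sum-zero : ∀ (f : A → ℕ) {xs} → All (λ x → f x ≡ 0) xs → sum (map f xs) ≡ 0
  sum-zero f []       = refl
  sum-zero f (p ∷ ps) = cong₂ ℕ._+_ p (sum-zero f ps)

  sum-zero′ : ∀ (f : A → ℕ) xs → (∀ x → f x ≡ 0) → sum (map f xs) ≡ 0
  sum-zero′ f xs p = sum-zero f {xs} (All.tabulate λ {x} _ → p x)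

  sum-single : ∀ (f : A → ℕ) {e xs} → Unique xs → e ∈ xs → (∀ x → x ≢ e → f x ≡ 0) →
    sum (map f xs) ≡ f e
  sum-single f {e} (d ∷ _) (here refl) z =
    ≡.trans (cong (f e ℕ.+_) (sum-zero f (All.map (λ e≢x → z _ (e≢x ∘ ≡.sym)) d))) (ℕ.+-identityʳ _)
  sum-single f (d ∷ u) (there p) z =
    cong₂ ℕ._+_ (z _ (All.lookup d p)) (sum-single f u p z)

  sum-∈ : ∀ (f : A → ℕ) {e xs} → e ∈ xs → f e ℕ.≤ sum (map f xs)
  sum-∈ f (here refl) = ℕ.m≤m+n _ _
  sum-∈ f (there q)   = ℕ.≤-trans (sum-∈ f q) (ℕ.m≤n+m _ _)

  sum-mapMaybe : ∀ {b} {B : Set b} (f : B → ℕ) (g : A → Maybe B) xs →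
    sum (map f (mapMaybe g xs)) ≡ sum (map (weigh f ∘ g) xs)
  sum-mapMaybe f g [] = refl
  sum-mapMaybe f g (x ∷ xs) with g x
  ... | just y  = cong (f y ℕ.+_) (sum-mapMaybe f g xs)
  ... | nothing = sum-mapMaybe f g xs

  ∈-mapMaybe⁺ : ∀ {b} {B : Set b} (g : A → Maybe B) {x y xs} → x ∈ xs → g x ≡ just y → y ∈ mapMaybe g xs
  ∈-mapMaybe⁺ g {x} (here refl) p rewrite p = here refl
  ∈-mapMaybe⁺ g (there {x = z} q) p with g z
  ... | just _  = there (∈-mapMaybe⁺ g q p)
  ... | nothing = ∈-mapMaybe⁺ g q p

  ∈-mapMaybe⁻ : ∀ {b} {B : Set b} (g : A → Maybe B) {y} xs → y ∈ mapMaybe g xs → ∃ λ x → x ∈ xs × g x ≡ just y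
  ∈-mapMaybe⁻ g (x ∷ xs) p with g x in eq
  ∈-mapMaybe⁻ g (x ∷ xs) (here refl) | just _ = x , here refl , eq
  ∈-mapMaybe⁻ g (x ∷ xs) (there p)   | just _ with ∈-mapMaybe⁻ g xs p
  ... | z , q , r = z , there q , r
  ∈-mapMaybe⁻ g (x ∷ xs) p | nothing with ∈-mapMaybe⁻ g xs p
  ... | z , q , r = z , there q , r

module TraceProperties (T : Trace) where
  open Trace T

  <-wf : WellFounded _<_
  <-wf = spo-wellFounded (ToStrict.<-isStrictPartialOrder _≡_ _≤_ (IsDecPartialOrder.isPartialOrder isOrder))

  private
    rootOf : Fin size → Name ⊎ Fin size → Maybe (Fin size × Name)
    rootOf a (inj₁ u) = just (a , u)
    rootOf a (inj₂ _) = nothing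

    rootFunction : ∃ λ f → roots ≡ mapMaybe f events
    rootFunction = _ , refl

    rootFunction≗ : ∀ a → proj₁ rootFunction a ≡ rootOf a (subj a)
    rootFunction≗ a with subj a
    ... | inj₁ u = refl
    ... | inj₂ b = refl

    -- roots is defined through a local function; this names it.
    roots≡ : roots ≡ mapMaybe (λ a → rootOf a (subj a)) events
    roots≡ = mapMaybe-cong rootFunction≗ events

    _≟ₛ_ : ∀ (s t : Name ⊎ Fin size) → Dec (s ≡ t)
    _≟ₛ_ = Sum.≡-dec ℕ._≟_ Fin._≟_

  ∈-roots⁻ : ∀ {a u} → (a , u) ∈ roots → subj a ≡ inj₁ u
  ∈-roots⁻ p with ∈-mapMaybe⁻ _ events (subst (_ ∈_) roots≡ p)
  ... | a , _ , q with subj a in eq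
  ∈-roots⁻ p | a , _ , refl | inj₁ u = eq

  ∈-roots⁺ : ∀ {a u} → subj a ≡ inj₁ u → (a , u) ∈ roots
  ∈-roots⁺ {a} {u} eq = subst (_ ∈_) (≡.sym roots≡) (∈-mapMaybe⁺ _ (∈-allFin a) (cong (rootOf a) eq))

  ∈-children⁺ : ∀ {a c} → subj c ≡ inj₂ a → ∃ λ eq → (c , eq) ∈ children a
  ∈-children⁺ {a} {c} eq with subj c ≟ₛ inj₂ a in dec
  ... | yes eq′ = eq′ , ∈-mapMaybe⁺ _ (∈-allFin c) (cong (Maybe.map (c ,_) ∘ dec⇒maybe) dec)
  ... | no ¬eq  = contradiction eq ¬eq

  ∈-below⁻ : ∀ {a b} → b ∈ below a → b < a
  ∈-below⁻ {a} p = proj₂ (∈-filter⁻ (_<? a) {xs = events} p)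

  ∈-below⁺ : ∀ {a b} → b < a → b ∈ below a
  ∈-below⁺ {a} {b} p = ∈-filter⁺ (_<? a) (∈-allFin b) p

  ∈-above⁻ : ∀ {a b} → b ∈ above a → a < b
  ∈-above⁻ {a} p = proj₂ (∈-filter⁻ (a <?_) {xs = events} p)

  ∈-above⁺ : ∀ {a b} → a < b → b ∈ above a
  ∈-above⁺ {a} {b} p = ∈-filter⁺ (a <?_) (∈-allFin b) p

  below-unique : ∀ a → Unique (below a)
  below-unique a = filter⁺ (_<? a) (allFin⁺ size)

  above-unique : ∀ a → Unique (above a)
  above-unique a = filter⁺ (a <?_) (allFin⁺ size)

  ∈-N-free⁻ : ∀ {ε u} → (ε , u) ∈ N-free → (ε , inj₁ u) ∈ N
  ∈-N-free⁻ p with ∈-mapMaybe⁻ _ N p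
  ... | (ε , inj₁ u) , q , refl = q

  ∈-N-free⁺ : ∀ {ε u} → (ε , inj₁ u) ∈ N → (ε , u) ∈ N-free
  ∈-N-free⁺ p = ∈-mapMaybe⁺ _ p refl

  ∈-N-at⁻ : ∀ {a ε} → ε ∈ N-at a → (ε , inj₂ a) ∈ N
  ∈-N-at⁻ {a} p with ∈-mapMaybe⁻ _ N p
  ... | (ε , inj₂ b) , q , r with b Fin.≟ a
  ∈-N-at⁻ p | (ε , inj₂ b) , q , refl | yes refl = q

  ∈-N-at⁺ : ∀ {a ε} → (ε , inj₂ a) ∈ N → ε ∈ N-at a
  ∈-N-at⁺ {a} {ε} p = ∈-mapMaybe⁺ _ p eq
    where
    eq : Maybe.map (λ _ → ε) (dec⇒maybe (a Fin.≟ a)) ≡ just ε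
    eq with a Fin.≟ a
    ... | yes _ = refl
    ... | no ¬p = contradiction refl ¬p

  -- Follows the recursion by which the implementation nests `A` for the children inside `A` for the
  -- parent, so that `weight-tree` can identify it with a weight of the encoded forest.
  treeSum : (Fin size → ℕ) → ∀ a → Acc (flip _<_) a → ℕ
  treeSum f a (acc rs) = f a ℕ.+ sum (map (λ (c , eq) → treeSum f c (rs (subj-< eq))) (children a))

  private
    SupportedAt : (Fin size → ℕ) → Fin size → Set
    SupportedAt f e = ∀ a → a ≢ e → f a ≡ 0

    sum-children : ∀ (f : Fin size → ℕ) a → sum (map (λ (c , _) → f c) (children a)) ≡
      sum (map (λ c → weigh (λ _ → f c) (dec⇒maybe (subj c ≟ₛ inj₂ a))) events)
    sum-children f a = ≡.trans (sum-mapMaybe (λ (c , _) → f c) _ events) (cong sum (map-cong pointwise events))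
      where
      pointwise : ∀ c → weigh {A = ∃ λ c → subj c ≡ inj₂ a} (λ (c , _) → f c)
          (Maybe.map (c ,_) (dec⇒maybe (subj c ≟ₛ inj₂ a))) ≡
        weigh (λ _ → f c) (dec⇒maybe (subj c ≟ₛ inj₂ a))
      pointwise c with subj c ≟ₛ inj₂ a
      ... | yes _ = refl
      ... | no  _ = refl

    moved : (Fin size → ℕ) → Fin size → Fin size → Fin size → ℕ
    moved f e p a with a Fin.≟ p
    ... | yes _ = f e
    ... | no  _ = 0

    moved-supported : ∀ f e p → SupportedAt (moved f e p) p
    moved-supported f e p a a≢p with a Fin.≟ p
    ... | yes a≡p = contradiction a≡p a≢p
    ... | no  _   = refl

    moved-at : ∀ f e p → moved f e p p ≡ f e
    moved-at f e p with p Fin.≟ p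
    ... | yes _ = refl
    ... | no ¬p = contradiction refl ¬p

    sum-children-single : ∀ f {e p} → SupportedAt f e → subj e ≡ inj₂ p → ∀ a →
      sum (map (λ (c , _) → f c) (children a)) ≡ moved f e p a
    sum-children-single f {e} {p} sup eq a = ≡.trans (sum-children f a)
      (≡.trans (sum-single g (allFin⁺ size) (∈-allFin e) g-supported) g-at)
      where
      g : Fin size → ℕ
      g c = weigh (λ _ → f c) (dec⇒maybe (subj c ≟ₛ inj₂ a))
      g-supported : ∀ c → c ≢ e → g c ≡ 0
      g-supported c c≢e with subj c ≟ₛ inj₂ a
      ... | yes _ = sup c c≢e
      ... | no  _ = refl
      g-at : g e ≡ moved f e p a
      g-at with subj e ≟ₛ inj₂ a | a Fin.≟ p
      ... | yes _  | yes _    = refl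
      ... | no _   | no _     = refl
      ... | yes q  | no a≢p   = contradiction (Sum.inj₂-injective (≡.trans (≡.sym q) eq)) a≢p
      ... | no ¬q  | yes refl = contradiction eq ¬q

    -- Below the start of a tree, `e` is met once for each visit to its parent, so its weight may be
    -- put at the parent instead. The summand `f a` accounts for a tree that starts at `e` itself.
    treeSum-child : ∀ f {e p} → SupportedAt f e → subj e ≡ inj₂ p → ∀ a (rs : Acc (flip _<_) a) →
      treeSum f a rs ≡ f a ℕ.+ treeSum (moved f e p) a rs
    treeSum-child f {e} {p} sup eq a (acc rs) = cong (f a ℕ.+_) (begin
      sum (map (λ (c , q) → treeSum f c (rs (subj-< q))) (children a))
        ≡⟨ cong sum (map-cong (λ (c , q) → treeSum-child f sup eq c (rs (subj-< q))) (children a)) ⟩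
      sum (map (λ (c , q) → f c ℕ.+ treeSum (moved f e p) c (rs (subj-< q))) (children a))
        ≡⟨ sum-+ (λ (c , _) → f c) _ (children a) ⟩
      sum (map (λ (c , _) → f c) (children a)) ℕ.+
      sum (map (λ (c , q) → treeSum (moved f e p) c (rs (subj-< q))) (children a))
        ≡⟨ cong (ℕ._+ sum (map (λ (c , q) → treeSum (moved f e p) c (rs (subj-< q))) (children a))) (sum-children-single f sup eq a) ⟩
      treeSum (moved f e p) a (acc rs) ∎)
      where open ≡.≡-Reasoning

    -- An event whose subject is a free name is a child of no event, so it is met only where a tree
    -- starts.
    treeSum-root : ∀ f {e u} → SupportedAt f e → subj e ≡ inj₁ u → ∀ a (rs : Acc (flip _<_) a) →
      treeSum f a rs ≡ f a
    treeSum-root f {e} sup eq a (acc rs) = ≡.trans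
      (cong (f a ℕ.+_) (sum-zero′ _ (children a) λ (c , q) →
        ≡.trans (treeSum-root f sup eq c (rs (subj-< q))) (sup c λ { refl → contradiction (≡.trans (≡.sym q) eq) λ () })))
      (ℕ.+-identityʳ _)

    sum-roots : ∀ (f : Fin size → ℕ) → sum (map (λ (a , _) → f a) roots) ≡
      sum (map (λ a → weigh (λ _ → f a) (rootOf a (subj a))) events)
    sum-roots f rewrite roots≡ = ≡.trans (sum-mapMaybe (λ (a , _) → f a) _ events) (cong sum (map-cong pointwise events))
      where
      pointwise : ∀ a → weigh (λ (a , _) → f a) (rootOf a (subj a)) ≡
        weigh (λ _ → f a) (rootOf a (subj a))
      pointwise a with subj a
      ... | inj₁ u = refl
      ... | inj₂ b = refl

    forestSum : (Fin size → ℕ) → ℕ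
    forestSum f = sum (map (λ (a , _) → treeSum f a (>-wellFounded a)) roots)

    sum-roots-single : ∀ f {e} → SupportedAt f e →
      sum (map (λ (a , _) → f a) roots) ≡ weigh (λ _ → f e) (rootOf e (subj e))
    sum-roots-single f {e} sup = ≡.trans (sum-roots f) (sum-single g (allFin⁺ size) (∈-allFin e) g-supported)
      where
      g : Fin size → ℕ
      g a = weigh (λ _ → f a) (rootOf a (subj a))
      g-supported : ∀ a → a ≢ e → g a ≡ 0
      g-supported a a≢e with subj a
      ... | inj₁ u = sup a a≢e
      ... | inj₂ b = refl

  -- Every event belongs to exactly one tree of the forest of the A_a, once: a
  -- weight at a child can be moved to its parent, and so on up to a root.
  forestSum-single : ∀ f {e} → SupportedAt f e →
    sum (map (λ (a , _) → treeSum f a (>-wellFounded a)) roots) ≡ f e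
  forestSum-single f {e} sup = go f (<-wf e) sup
    where
    open ≡.≡-Reasoning
    go : ∀ f {e} → Acc _<_ e → SupportedAt f e → forestSum f ≡ f e
    go f {e} (acc rs) sup with subj e in eq
    ... | inj₁ u = begin
      forestSum f                               ≡⟨ cong sum (map-cong (λ (a , _) → treeSum-root f sup eq a (>-wellFounded a)) roots) ⟩
      sum (map (λ (a , _) → f a) roots)         ≡⟨ sum-roots-single f sup ⟩
      weigh (λ _ → f e) (rootOf e (subj e))   ≡⟨ cong (weigh (λ _ → f e) ∘ rootOf e) eq ⟩
      f e                                       ∎
    ... | inj₂ p = begin
      forestSum f
        ≡⟨ cong sum (map-cong (λ (a , _) → treeSum-child f sup eq a (>-wellFounded a)) roots) ⟩
      sum (map (λ (a , _) → f a ℕ.+ treeSum (moved f e p) a (>-wellFounded a)) roots)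
        ≡⟨ sum-+ (λ (a , _) → f a) _ roots ⟩
      sum (map (λ (a , _) → f a) roots) ℕ.+ forestSum (moved f e p)
        ≡⟨ cong₂ ℕ._+_ (sum-roots-single f sup) (go (moved f e p) (rs (subj-< eq)) (moved-supported f e p)) ⟩
      weigh (λ _ → f e) (rootOf e (subj e)) ℕ.+ moved f e p p
        ≡⟨ cong₂ ℕ._+_ (cong (weigh (λ _ → f e) ∘ rootOf e) eq) (moved-at f e p) ⟩
      f e ∎

-- Facts and occurrence counts

_≟ˢ_ : DecidableEquality Shared
free u   ≟ˢ free v   = map′ (cong free) (λ { refl → refl }) (u ℕ.≟ v)
free u   ≟ˢ object b = no λ ()
object a ≟ˢ free v   = no λ ()
object a ≟ˢ object b = map′ (cong object) (λ { refl → refl }) (a ℕ.≟ b)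

_≟ʷ_ : DecidableEquality Wire
wx a b ≟ʷ wx c d = map′ (uncurry (cong₂ wx)) (λ { refl → refl , refl }) ((a ℕ.≟ c) ×-dec (b ℕ.≟ d))
wx a b ≟ʷ wy c d = no λ ()
wy a b ≟ʷ wx c d = no λ ()
wy a b ≟ʷ wy c d = map′ (uncurry (cong₂ wy)) (λ { refl → refl , refl }) ((a ℕ.≟ c) ×-dec (b ℕ.≟ d))

_≟ᵃ_ : DecidableEquality Action
event s ε a ≟ᵃ event t δ b =
  map′ (λ { (refl , refl , refl) → refl }) (λ { refl → refl , refl , refl })
    ((s ≟ˢ t) ×-dec (ε Sign.≟ δ) ×-dec (a ℕ.≟ b))
event s ε a ≟ᵃ wire q δ    = no λ ()
wire p ε    ≟ᵃ event t δ b = no λ ()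
wire p ε    ≟ᵃ wire q δ    = map′ (uncurry (cong₂ wire)) (λ { refl → refl , refl }) ((p ≟ʷ q) ×-dec (ε Sign.≟ δ))

_≟ⁱ_ : DecidableEquality Item
_≟ⁱ_ = Sum.≡-dec _≟ᵃ_ (Product.≡-dec _≟ˢ_ Sign._≟_)

indicator : Item → Item → ℕ
indicator j i = if does (i ≟ⁱ j) then 1 else 0

indicator-≡ : ∀ j → indicator j j ≡ 1
indicator-≡ j with j ≟ⁱ j
... | yes _ = refl
... | no ¬p = contradiction refl ¬p

indicator-≢ : ∀ j {i} → i ≢ j → indicator j i ≡ 0
indicator-≢ j {i} i≢j with i ≟ⁱ j
... | yes p = contradiction p i≢j
... | no _  = refl

-- What has happened so far: a wire has been used, or the event with this number has occurred.
-- Polarity is dropped because both ends of a wire establish the same fact.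
Fact : Set
Fact = Wire ⊎ ℕ

factOf : Action → Fact
factOf (event s ε a) = inj₂ a
factOf (wire p ε)    = inj₁ p

_≟ᶠ_ : DecidableEquality Fact
_≟ᶠ_ = Sum.≡-dec _≟ʷ_ ℕ._≟_

-- Whether the action establishing a fact has occurred, against the number of
-- its occurrences that remain.
Count : List Fact → Fact → ℕ → Set
Count K f n = (f ∈ K × n ≡ 0) ⊎ (f ∉ K × n ≡ 1)

count-weaken : ∀ {K f g n} → f ≢ g → Count K f n → Count (g ∷ K) f n
count-weaken f≢g (inj₁ (p , q)) = inj₁ (there p , q)
count-weaken f≢g (inj₂ (p , q)) = inj₂ ((λ { (here e) → f≢g e ; (there r) → p r }) , q)

count-∈ : ∀ {K f n} → Count K f n → f ∈ K → n ≡ 0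
count-∈ (inj₁ (_ , q)) _ = q
count-∈ (inj₂ (p , _)) r = contradiction r p

count-∉ : ∀ {K f n} → Count K f n → f ∉ K → n ≡ 1
count-∉ (inj₁ (p , _)) r = contradiction p r
count-∉ (inj₂ (_ , q)) _ = q

module Development {c ℓ : Level} (𝕂 : CommutativeSemiring c ℓ) where
  open CommutativeSemiring 𝕂
    using (Carrier; _≈_; _+_; _*_; 0#; 1#; setoid; +-cong; +-assoc; +-comm; +-identityˡ;
           *-cong; *-identityˡ; *-identityʳ; zeroˡ; zeroʳ)
    renaming (refl to ≈-refl; sym to ≈-sym; trans to ≈-trans; reflexive to ≈-reflexive)
  open Calculus 𝕂

  -- Enumeration of transitions

  actions : Term → ℕ
  actions (const k)   = 0
  actions (act u ε P) = suc (actions P)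
  actions (◇ P)       = actions P
  actions (P ∣ Q)     = actions P ℕ.+ actions Q
  actions (P ∥ Q)     = actions P ℕ.+ actions Q
  actions (ν P)       = actions P

  actions-rename : ∀ ρ P → actions (rename ρ P) ≡ actions P
  actions-rename ρ (const k)   = refl
  actions-rename ρ (act u ε P) = cong suc (actions-rename (ext ρ) P)
  actions-rename ρ (◇ P)       = actions-rename ρ P
  actions-rename ρ (P ∣ Q)     = cong₂ ℕ._+_ (actions-rename ρ P) (actions-rename ρ Q)
  actions-rename ρ (P ∥ Q)     = cong₂ ℕ._+_ (actions-rename ρ P) (actions-rename ρ Q)
  actions-rename ρ (ν P)       = actions-rename (ext ρ) P

  -- Each step turns one or two action prefixes into `◇`. This decrease grounds the enumerations of
  -- maximal sequences and of observations, and the completion of outstanding acknowledgements.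
  actions-< : ∀ {P a Q} → P —[ a ]→ Q → actions Q ℕ.< actions P
  actions-< act        = ℕ.≤-refl
  actions-< (◇ᵛ d)     = actions-< d
  actions-< (◇ⁱ d)     = actions-< d
  actions-< (∣ˡᵛ {Q = Q} d) rewrite actions-rename suc Q = ℕ.+-monoˡ-< (actions Q) (actions-< d)
  actions-< (∣ˡⁱ {Q = Q} d) = ℕ.+-monoˡ-< (actions Q) (actions-< d)
  actions-< (∣ʳᵛ {Q = Q} d) rewrite actions-rename suc Q = ℕ.+-monoʳ-< (actions Q) (actions-< d)
  actions-< (∣ʳⁱ {Q = Q} d) = ℕ.+-monoʳ-< (actions Q) (actions-< d)
  actions-< (∥ˡᵛ {Q = Q} d) rewrite actions-rename suc Q = ℕ.+-monoˡ-< (actions Q) (actions-< d)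
  actions-< (∥ˡⁱ {Q = Q} d) = ℕ.+-monoˡ-< (actions Q) (actions-< d)
  actions-< (∥ʳᵛ {Q = Q} d) rewrite actions-rename suc Q = ℕ.+-monoʳ-< (actions Q) (actions-< d)
  actions-< (∥ʳⁱ {Q = Q} d) = ℕ.+-monoʳ-< (actions Q) (actions-< d)
  actions-< (νᵛ {P′ = P′} d) rewrite actions-rename exchange P′ = actions-< d
  actions-< (νⁱ d)     = actions-< d
  actions-< (sync d e) = ℕ.+-mono-< (actions-< d) (actions-< e)

  data VisibleStep (P : Term) : Set c where
    step : ∀ {u ε ι P′} → P —[ vis u ε ι ]→ P′ → VisibleStep P

  data InternalStep (P : Term) : Set c where
    step : ∀ {ι κ P′} → P —[ int ι κ ]→ P′ → InternalStep P

  visibleSteps : ∀ P → List (VisibleStep P)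
  visibleSteps (const k)   = []
  visibleSteps (act u ε P) = step act ∷ []
  visibleSteps (◇ P)       = map (λ { (step d) → step (◇ᵛ d) }) (visibleSteps P)
  visibleSteps (P ∣ Q)     = map (λ { (step d) → step (∣ˡᵛ d) }) (visibleSteps P) ++
                             map (λ { (step d) → step (∣ʳᵛ d) }) (visibleSteps Q)
  visibleSteps (P ∥ Q)     = map (λ { (step d) → step (∥ˡᵛ d) }) (visibleSteps P) ++
                             map (λ { (step d) → step (∥ʳᵛ d) }) (visibleSteps Q)
  visibleSteps (ν P)       = concatMap
    (λ { (step {zero} d) → [] ; (step {suc u} d) → step (νᵛ d) ∷ [] }) (visibleSteps P)

  ∈-visibleSteps : ∀ {P u ε ι P′} (d : P —[ vis u ε ι ]→ P′) → step d ∈ visibleSteps P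
  ∈-visibleSteps act     = here refl
  ∈-visibleSteps (◇ᵛ d)  = ∈-map⁺ _ (∈-visibleSteps d)
  ∈-visibleSteps (∣ˡᵛ d) = ∈-++⁺ˡ (∈-map⁺ _ (∈-visibleSteps d))
  ∈-visibleSteps (∣ʳᵛ {Q = Q} d) = ∈-++⁺ʳ (map _ (visibleSteps Q)) (∈-map⁺ _ (∈-visibleSteps d))
  ∈-visibleSteps (∥ˡᵛ d) = ∈-++⁺ˡ (∈-map⁺ _ (∈-visibleSteps d))
  ∈-visibleSteps (∥ʳᵛ {Q = Q} d) = ∈-++⁺ʳ (map _ (visibleSteps Q)) (∈-map⁺ _ (∈-visibleSteps d))
  ∈-visibleSteps (νᵛ d)  = ∈-concatMap⁺ _ (lose (∈-visibleSteps d) (here refl))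

  syncSteps : ∀ {P Q} → VisibleStep P → VisibleStep Q → List (InternalStep (P ∣ Q))
  syncSteps (step {u} {ε} d) (step {u′} {ε′} e) with u ℕ.≟ u′ | ε′ Sign.≟ opposite ε
  ... | yes refl | yes refl = step (sync d e) ∷ []
  ... | _        | _        = []

  ∈-syncSteps : ∀ {P Q u ε ι κ P′ Q′} (d : P —[ vis u ε ι ]→ P′) (e : Q —[ vis u (opposite ε) κ ]→ Q′) →
                step (sync d e) ∈ syncSteps (step d) (step e)
  ∈-syncSteps {u = u} {ε = ε} d e with u ℕ.≟ u | opposite ε Sign.≟ opposite ε
  ... | yes refl | yes refl = here refl
  ... | yes refl | no ¬p    = contradiction refl ¬p
  ... | no ¬p    | _        = contradiction refl ¬p

  internalSteps : ∀ P → List (InternalStep P)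
  internalSteps (const k)   = []
  internalSteps (act u ε P) = []
  internalSteps (◇ P)       = map (λ { (step d) → step (◇ⁱ d) }) (internalSteps P)
  internalSteps (P ∣ Q)     = map (λ { (step d) → step (∣ˡⁱ d) }) (internalSteps P) ++
                              map (λ { (step d) → step (∣ʳⁱ d) }) (internalSteps Q) ++
    concatMap (λ d → concatMap (λ e → syncSteps d e) (visibleSteps Q)) (visibleSteps P)
  internalSteps (P ∥ Q)     = map (λ { (step d) → step (∥ˡⁱ d) }) (internalSteps P) ++
                              map (λ { (step d) → step (∥ʳⁱ d) }) (internalSteps Q)
  internalSteps (ν P)       = map (λ { (step d) → step (νⁱ d) }) (internalSteps P)

  ∈-internalSteps : ∀ {P ι κ P′} (d : P —[ int ι κ ]→ P′) → step d ∈ internalSteps P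
  ∈-internalSteps (◇ⁱ d)  = ∈-map⁺ _ (∈-internalSteps d)
  ∈-internalSteps (∣ˡⁱ d) = ∈-++⁺ˡ (∈-map⁺ _ (∈-internalSteps d))
  ∈-internalSteps (∣ʳⁱ {Q = Q} d) =
    ∈-++⁺ʳ (map _ (internalSteps Q)) (∈-++⁺ˡ (∈-map⁺ _ (∈-internalSteps d)))
  ∈-internalSteps (∥ˡⁱ d) = ∈-++⁺ˡ (∈-map⁺ _ (∈-internalSteps d))
  ∈-internalSteps (∥ʳⁱ {Q = Q} d) = ∈-++⁺ʳ (map _ (internalSteps Q)) (∈-map⁺ _ (∈-internalSteps d))
  ∈-internalSteps (νⁱ d)  = ∈-map⁺ _ (∈-internalSteps d)
  ∈-internalSteps {P ∣ Q} (sync d e) =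
    ∈-++⁺ʳ (map _ (internalSteps P)) (∈-++⁺ʳ (map _ (internalSteps Q))
      (∈-concatMap⁺ _ (lose (∈-visibleSteps d) (∈-concatMap⁺ _ (lose (∈-visibleSteps e) (∈-syncSteps d e))))))

  Stuck : Term → Set c
  Stuck P = ¬ InternalStep P

  stuck? : ∀ P → Dec (Stuck P)
  stuck? P with internalSteps P in eq
  ... | [] = yes λ { (step d) → case subst (step d ∈_) eq (∈-internalSteps d) of λ () }
  ... | step d ∷ _ = no λ ¬d → ¬d (step d)

  stay : ∀ {P} → Stuck P → MaximalSequence P
  stay {P} ¬d = record { labels = [] ; end = P ; path = [] ; maximal = λ d → ¬d (step d) }

  prefix : ∀ {P ι κ P′} → P —[ int ι κ ]→ P′ → MaximalSequence P′ → MaximalSequence P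
  prefix d ρ = record
    { labels = int _ _ ∷ labels ρ ; end = end ρ ; path = d ∷ path ρ ; maximal = maximal ρ }

  maximalSequences′ : ∀ P → Acc ℕ._<_ (actions P) → List (MaximalSequence P)
  maximalSequences′ P (acc rs) with stuck? P
  ... | yes ¬d = stay ¬d ∷ []
  ... | no  _  = concatMap
    (λ { (step d) → map (prefix d) (maximalSequences′ _ (rs (actions-< d))) }) (internalSteps P)

  SameSequence : ∀ {P} → MaximalSequence P → MaximalSequence P → Set c
  SameSequence ρ σ = labels ρ ≡ labels σ × end ρ ≡ end σ

  maximalSequences′-complete : ∀ {P} (rs : Acc ℕ._<_ (actions P)) {as Q} →
    P ⟶*[ as ] Q → Stuck Q →
    Any (λ σ → as ≡ labels σ × Q ≡ end σ) (maximalSequences′ P rs)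
  maximalSequences′-complete {P} (acc rs) p ¬q with stuck? P
  maximalSequences′-complete {P} (acc rs) []      ¬q | yes _  = here (refl , refl)
  maximalSequences′-complete {P} (acc rs) (d ∷ p) ¬q | yes ¬d = contradiction (step d) ¬d
  maximalSequences′-complete {P} (acc rs) []      ¬q | no  ¬s = contradiction ¬q ¬s
  maximalSequences′-complete {P} (acc rs) (d ∷ p) ¬q | no  ¬s =
    Any.concat⁺ (Any.map⁺ (lose (∈-internalSteps d)
      (Any.map⁺ (Any.map (λ { (refl , refl) → refl , refl }) (maximalSequences′-complete (rs (actions-< d)) p ¬q)))))

  maximalSequences : ∀ P → List (MaximalSequence P)
  maximalSequences P = maximalSequences′ P (<-wellFounded _)

  maximalSequences-complete : ∀ {P} (ρ : MaximalSequence P) → Any (SameSequence ρ) (maximalSequences P)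
  maximalSequences-complete ρ = maximalSequences′-complete (<-wellFounded _) (path ρ) (λ { (step d) → maximal ρ d })

  -- stateAfter P F is the state of P once the actions at the positions in F have
  -- been consumed.  It depends on a path only through the set of its positions,
  -- so homotopic paths have the same final state.
  stateAfter : Term → (Position → Bool) → Carrier
  stateAfter (const k)   F = k
  stateAfter (act u ε P) F = if F [] then stateAfter P (F ∘ (+ 1 ∷_)) else 1#
  stateAfter (◇ P)       F = stateAfter P (F ∘ (+ 1 ∷_))
  stateAfter (P ∣ Q)     F = stateAfter P (F ∘ (+ 1 ∷_)) * stateAfter Q (F ∘ (+ 2 ∷_))
  stateAfter (P ∥ Q)     F = stateAfter P (F ∘ (+ 1 ∷_)) * stateAfter Q (F ∘ (+ 2 ∷_))
  stateAfter (ν P)       F = stateAfter P F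

  stateAfter-rename : ∀ ρ P F → stateAfter (rename ρ P) F ≡ stateAfter P F
  stateAfter-rename ρ (const k)   F = refl
  stateAfter-rename ρ (act u ε P) F = cong (if F [] then_else 1#) (stateAfter-rename (ext ρ) P _)
  stateAfter-rename ρ (◇ P)       F = stateAfter-rename ρ P _
  stateAfter-rename ρ (P ∣ Q)     F = cong₂ _*_ (stateAfter-rename ρ P _) (stateAfter-rename ρ Q _)
  stateAfter-rename ρ (P ∥ Q)     F = cong₂ _*_ (stateAfter-rename ρ P _) (stateAfter-rename ρ Q _)
  stateAfter-rename ρ (ν P)       F = stateAfter-rename (ext ρ) P F

  stateAfter-cong : ∀ P {F G} → (∀ ι → F ι ≡ G ι) → stateAfter P F ≡ stateAfter P G
  stateAfter-cong (const k)   F≗G = refl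
  stateAfter-cong (act u ε P) F≗G =
    cong₂ (if_then_else 1#) (F≗G []) (stateAfter-cong P (λ ι → F≗G (+ 1 ∷ ι)))
  stateAfter-cong (◇ P)       F≗G = stateAfter-cong P (λ ι → F≗G (+ 1 ∷ ι))
  stateAfter-cong (P ∣ Q)     F≗G =
    cong₂ _*_ (stateAfter-cong P (λ ι → F≗G (+ 1 ∷ ι))) (stateAfter-cong Q (λ ι → F≗G (+ 2 ∷ ι)))
  stateAfter-cong (P ∥ Q)     F≗G =
    cong₂ _*_ (stateAfter-cong P (λ ι → F≗G (+ 1 ∷ ι))) (stateAfter-cong Q (λ ι → F≗G (+ 2 ∷ ι)))
  stateAfter-cong (ν P)       F≗G = stateAfter-cong P F≗G

  stateAfter-∅ : ∀ P → stateAfter P (λ _ → false) ≡ state P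
  stateAfter-∅ (const k)   = refl
  stateAfter-∅ (act u ε P) = refl
  stateAfter-∅ (◇ P)       = stateAfter-∅ P
  stateAfter-∅ (P ∣ Q)     = cong₂ _*_ (stateAfter-∅ P) (stateAfter-∅ Q)
  stateAfter-∅ (P ∥ Q)     = cong₂ _*_ (stateAfter-∅ P) (stateAfter-∅ Q)
  stateAfter-∅ (ν P)       = stateAfter-∅ P

  infix 4 _==_

  _==_ : Position → Position → Bool
  []      == []      = true
  []      == (j ∷ κ) = false
  (i ∷ ι) == []      = false
  (i ∷ ι) == (j ∷ κ) = does (i ℤ.≟ j) ∧ (ι == κ)

  insert : List Position → (Position → Bool) → Position → Bool
  insert []       F κ = F κ
  insert (ι ∷ ιs) F κ = (ι == κ) ∨ insert ιs F κ

  insertAll : List Label → (Position → Bool) → Position → Bool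
  insertAll []       F = F
  insertAll (a ∷ as) F = insert (positions a) (insertAll as F)

  -- `stateAfter` walks through a consumed prefix exactly as through `◇`, which is what the step
  -- puts in its place. Transitions leave positions unchanged, so the rest of `F` keeps its meaning.
  stateAfter-step : ∀ {P a P′} → P —[ a ]→ P′ → ∀ F →
                    stateAfter P′ F ≡ stateAfter P (insert (positions a) F)
  stateAfter-step act      F = refl
  stateAfter-step (◇ᵛ d)   F = stateAfter-step d _
  stateAfter-step (◇ⁱ d)   F = stateAfter-step d _
  stateAfter-step (∣ˡᵛ {Q = Q} d) F = cong₂ _*_ (stateAfter-step d _) (stateAfter-rename suc Q _)
  stateAfter-step (∣ˡⁱ d)  F = cong₂ _*_ (stateAfter-step d _) refl
  stateAfter-step (∣ʳᵛ {Q = Q} d) F = cong₂ _*_ (stateAfter-rename suc Q _) (stateAfter-step d _)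
  stateAfter-step (∣ʳⁱ d)  F = cong₂ _*_ refl (stateAfter-step d _)
  stateAfter-step (∥ˡᵛ {Q = Q} d) F = cong₂ _*_ (stateAfter-step d _) (stateAfter-rename suc Q _)
  stateAfter-step (∥ˡⁱ d)  F = cong₂ _*_ (stateAfter-step d _) refl
  stateAfter-step (∥ʳᵛ {Q = Q} d) F = cong₂ _*_ (stateAfter-rename suc Q _) (stateAfter-step d _)
  stateAfter-step (∥ʳⁱ d)  F = cong₂ _*_ refl (stateAfter-step d _)
  stateAfter-step (νᵛ {P′ = P′} d) F = ≡.trans (stateAfter-rename exchange P′ F) (stateAfter-step d F)
  stateAfter-step (νⁱ d)   F = stateAfter-step d F
  stateAfter-step (sync d e) F = cong₂ _*_ (stateAfter-step d _) (stateAfter-step e _)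

  state-end : ∀ {P as Q} → P ⟶*[ as ] Q → state Q ≡ stateAfter P (insertAll as (λ _ → false))
  state-end {P} []  = ≡.sym (stateAfter-∅ P)
  state-end (d ∷ p) = ≡.trans (state-end p) (stateAfter-step d _)

  insert-cong : ∀ ιs {F G} → (∀ κ → F κ ≡ G κ) → ∀ κ → insert ιs F κ ≡ insert ιs G κ
  insert-cong []       F≗G κ = F≗G κ
  insert-cong (ι ∷ ιs) F≗G κ = cong ((ι == κ) ∨_) (insert-cong ιs F≗G κ)

  insertAll-cong : ∀ as {F G} → (∀ κ → F κ ≡ G κ) → ∀ κ → insertAll as F κ ≡ insertAll as G κ
  insertAll-cong []       F≗G = F≗G
  insertAll-cong (a ∷ as) F≗G = insert-cong (positions a) (insertAll-cong as F≗G)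

  insertAll-++ : ∀ as bs F → insertAll (as ++ bs) F ≡ insertAll as (insertAll bs F)
  insertAll-++ []       bs F = refl
  insertAll-++ (a ∷ as) bs F = cong (insert (positions a)) (insertAll-++ as bs F)

  insert-++ : ∀ ιs κs F κ → insert ιs (insert κs F) κ ≡ insert (ιs ++ κs) F κ
  insert-++ []       κs F κ = refl
  insert-++ (ι ∷ ιs) κs F κ = cong ((ι == κ) ∨_) (insert-++ ιs κs F κ)

  insert-∷ : ∀ ι κs F κ → insert κs (insert (ι ∷ []) F) κ ≡ (ι == κ) ∨ insert κs F κ
  insert-∷ ι []        F κ = refl
  insert-∷ ι (κ′ ∷ κs) F κ rewrite insert-∷ ι κs F κ with ι == κ | κ′ == κ
  ... | false | _     = refl
  ... | true  | false = refl
  ... | true  | true  = refl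

  insert-comm : ∀ ιs κs F κ → insert ιs (insert κs F) κ ≡ insert κs (insert ιs F) κ
  insert-comm []       κs F κ = refl
  insert-comm (ι ∷ ιs) κs F κ rewrite insert-comm ιs κs F κ = ≡.sym (insert-∷ ι κs (insert ιs F) κ)

  insertAll-resp-∼ : ∀ {as bs} → as ∼ bs → ∀ F κ → insertAll as F κ ≡ insertAll bs F κ
  insertAll-resp-∼ (swap {a} {b} _) F κ = insert-comm (positions a) (positions b) F κ
  insertAll-resp-∼ (++-cong {as} {as′} {bs} {bs′} p q) F κ = begin
    insertAll (as ++ bs) F κ         ≡⟨ cong (λ G → G κ) (insertAll-++ as bs F) ⟩
    insertAll as (insertAll bs F) κ  ≡⟨ insertAll-cong as (insertAll-resp-∼ q F) κ ⟩
    insertAll as (insertAll bs′ F) κ ≡⟨ insertAll-resp-∼ p _ κ ⟩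
    insertAll as′ (insertAll bs′ F) κ ≡⟨ cong (λ G → G κ) (insertAll-++ as′ bs′ F) ⟨
    insertAll (as′ ++ bs′) F κ       ∎
    where open ≡.≡-Reasoning
  insertAll-resp-∼ refl F κ = refl
  insertAll-resp-∼ (sym p) F κ = ≡.sym (insertAll-resp-∼ p F κ)
  insertAll-resp-∼ (trans p q) F κ = ≡.trans (insertAll-resp-∼ p F κ) (insertAll-resp-∼ q F κ)

  homotopic⇒state≡ : ∀ {P} (ρ σ : MaximalSequence P) → ρ ≈ₕ σ → state (end ρ) ≡ state (end σ)
  homotopic⇒state≡ {P} ρ σ p = begin
    state (end ρ)                                       ≡⟨ state-end (path ρ) ⟩
    stateAfter P (insertAll (labels ρ) (λ _ → false))   ≡⟨ stateAfter-cong P (insertAll-resp-∼ p _) ⟩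
    stateAfter P (insertAll (labels σ) (λ _ → false))   ≡⟨ state-end (path σ) ⟨
    state (end σ)                                       ∎
    where open ≡.≡-Reasoning

  -- Runs of a parallel composition, and the two halves of such a run

  data Run : Term → Term → Carrier → Set c where
    stop  : ∀ {P R} → Stuck (P ∣ R) → Run P R (state P * state R)
    left  : ∀ {P R P′ ι κ v} → P —[ int ι κ ]→ P′ → Run P′ R v → Run P R v
    right : ∀ {P R R′ ι κ v} → R —[ int ι κ ]→ R′ → Run P R′ v → Run P R v
    both  : ∀ {P R P′ R′ u ε ι κ v} → P —[ vis u ε ι ]→ P′ → R —[ vis u (opposite ε) κ ]→ R′ →
            Run P′ R′ v → Run P R v

  Reaches : Term → Carrier → Set c
  Reaches P v = ∃ λ as → ∃ λ Q → P ⟶*[ as ] Q × Stuck Q × state Q ≡ v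

  reaches-ν : ∀ {P v} → Reaches P v → Reaches (ν P) v
  reaches-ν (as , Q , p , ¬q , eq) = as , ν Q , lift p , (λ { (step (νⁱ d)) → ¬q (step d) }) , eq
    where
    lift : ∀ {P as Q} → P ⟶*[ as ] Q → ν P ⟶*[ as ] ν Q
    lift []      = []
    lift (d ∷ p) = νⁱ d ∷ lift p

  reaches-∷ : ∀ {P ι κ P′ v} → P —[ int ι κ ]→ P′ → Reaches P′ v → Reaches P v
  reaches-∷ d (as , Q , p , r) = _ , Q , d ∷ p , r

  run⇒reaches : ∀ {P R v} → Run P R v → Reaches (P ∣ R) v
  run⇒reaches (stop ¬d)    = [] , _ , [] , ¬d , refl
  run⇒reaches (left d r)   = reaches-∷ (∣ˡⁱ d) (run⇒reaches r)
  run⇒reaches (right d r)  = reaches-∷ (∣ʳⁱ d) (run⇒reaches r)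
  run⇒reaches (both d e r) = reaches-∷ (sync d e) (reaches-ν (run⇒reaches r))

  -- Synchronisations leave restrictions around the composition; `n` counts those created so far.
  -- They block no internal step and do not change the state, so `Run` omits them.
  path⇒run : ∀ n {P R as Q} → ν^ n (P ∣ R) ⟶*[ as ] Q → Stuck Q → Run P R (state Q)
  path⇒run n p ¬q = go n p ¬q refl
    where
    stuck-ν^ : ∀ n {P} → Stuck (ν^ n P) → Stuck P
    stuck-ν^ zero    s = s
    stuck-ν^ (suc n) s = stuck-ν^ n (λ { (step d) → s (step (νⁱ d)) })

    state-ν^ : ∀ n P → state (ν^ n P) ≡ state P
    state-ν^ zero    P = refl
    state-ν^ (suc n) P = state-ν^ n P

    step-ν^ : ∀ n {P ι κ Q} → ν^ n P —[ int ι κ ]→ Q → ∃ λ P′ → P —[ int ι κ ]→ P′ × Q ≡ ν^ n P′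
    step-ν^ zero    d      = _ , d , refl
    step-ν^ (suc n) (νⁱ d) with step-ν^ n d
    ... | _ , d′ , refl = _ , d′ , refl

    ν^-ν : ∀ n P → ν^ n (ν P) ≡ ν^ (suc n) P
    ν^-ν zero    P = refl
    ν^-ν (suc n) P = cong ν (ν^-ν n P)

    go : ∀ n {P R as Q X} → X ⟶*[ as ] Q → Stuck Q → X ≡ ν^ n (P ∣ R) → Run P R (state Q)
    go n {P} {R} [] ¬q refl = subst (Run P R) (≡.sym (state-ν^ n (P ∣ R))) (stop (stuck-ν^ n ¬q))
    go n (d ∷ p) ¬q refl with step-ν^ n d
    ... | _ , ∣ˡⁱ d′ , eq       = left d′ (go n p ¬q eq)
    ... | _ , ∣ʳⁱ d′ , eq       = right d′ (go n p ¬q eq)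
    ... | _ , sync d′ e′ , eq   = both d′ e′ (go (suc n) p ¬q (≡.trans eq (ν^-ν n _)))

  -- The i-th entry of a word is a name in the scope of the objects of the
  -- previous entries, the most recent object being index 0.
  Word : Set
  Word = List (Name × Polarity)

  data Observes : Term → Word → Term → Set c where
    stop     : ∀ {P} → Stuck P → Observes P [] P
    internal : ∀ {P ι κ P′ w E} → P —[ int ι κ ]→ P′ → Observes P′ w E → Observes P w E
    visible  : ∀ {P u ε ι P′ w E} → P —[ vis u ε ι ]→ P′ → Observes P′ w E →
               Observes P ((u , ε) ∷ w) E

  offers : Term → List (Polarity × Name)
  offers P = map (λ { (step {u} {ε} _) → ε , u }) (visibleSteps P)

  ∈-offers : ∀ {P u ε ι P′} → P —[ vis u ε ι ]→ P′ → (ε , u) ∈ offers P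
  ∈-offers d = ∈-map⁺ _ (∈-visibleSteps d)

  offers⇒step : ∀ P {u ε} → (ε , u) ∈ offers P → ∃ λ ι → ∃ λ P′ → P —[ vis u ε ι ]→ P′
  offers⇒step P p with ∈-map⁻ _ p
  ... | step d , _ , refl = _ , _ , d

  Blocks : Term → List (Polarity × Name) → Set c
  Blocks R N = ∀ {ε u ι R′} → (ε , u) ∈ N → ¬ (R —[ vis u (opposite ε) ι ]→ R′)

  -- `N` lists names in the scope reached after the whole word, so only `stop` consults it. Letters
  -- carry the polarities of the other half of the run, and `R` answers with the opposite ones.
  data Accepts : Term → Word → List (Polarity × Name) → Carrier → Set c where
    stop     : ∀ {R N} → Stuck R → Blocks R N → Accepts R [] N (state R)
    internal : ∀ {R ι κ R′ w N r} → R —[ int ι κ ]→ R′ → Accepts R′ w N r → Accepts R w N r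
    visible  : ∀ {R u ε ι R′ w N r} → R —[ vis u (opposite ε) ι ]→ R′ → Accepts R′ w N r →
               Accepts R ((u , ε) ∷ w) N r

  run⇒observes : ∀ {P R v} → Run P R v →
    ∃ λ w → ∃ λ E → ∃ λ r → Observes P w E × Accepts R w (offers E) r × v ≡ state E * r
  run⇒observes {P} {R} (stop ¬d) = [] , P , _ , stop (λ { (step d) → ¬d (step (∣ˡⁱ d)) }) ,
    stop (λ { (step d) → ¬d (step (∣ʳⁱ d)) }) (λ p e → let _ , _ , d = offers⇒step P p in ¬d (step (sync d e))) , refl
  run⇒observes (left d r) with run⇒observes r
  ... | w , E , _ , o , a , eq = w , E , _ , internal d o , a , eq
  run⇒observes (right d r) with run⇒observes r
  ... | w , E , _ , o , a , eq = w , E , _ , o , internal d a , eq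
  run⇒observes (both d e r) with run⇒observes r
  ... | w , E , _ , o , a , eq = _ , E , _ , visible d o , visible e a , eq

  -- The halves constrain each other only at the letters and at the end. Before each letter, the
  -- internal steps of `P` are taken first, then those of `R`.
  observes⇒run : ∀ {P w E R r} → Observes P w E → Accepts R w (offers E) r → Run P R (state E * r)
  observes⇒run (stop ¬p) (stop ¬r blk) = stop
    λ { (step (∣ˡⁱ d)) → ¬p (step d) ; (step (∣ʳⁱ d)) → ¬r (step d) ; (step (sync d e)) → blk (∈-offers d) e }
  observes⇒run (internal d o) a                = left d (observes⇒run o a)
  observes⇒run o@(stop _)      (internal e a)  = right e (observes⇒run o a)
  observes⇒run o@(visible _ _) (internal e a)  = right e (observes⇒run o a)
  observes⇒run (visible d o)   (visible e a)   = both d e (observes⇒run o a)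

  Observation : Term → Set c
  Observation P = ∃ λ w → ∃ λ E → Observes P w E

  unmoved : ∀ P → List (Observation P)
  unmoved P with stuck? P
  ... | yes ¬d = ([] , P , stop ¬d) ∷ []
  ... | no  _  = []

  -- Repetitions in this list are harmless: each merely repeats a summand of an idempotent sum.
  observations′ : ∀ P → Acc ℕ._<_ (actions P) → List (Observation P)

  afterInternal : ∀ {P} → (∀ {m} → m ℕ.< actions P → Acc ℕ._<_ m) → InternalStep P → List (Observation P)
  afterInternal rs (step d) = map (λ (w , E , o) → w , E , internal d o) (observations′ _ (rs (actions-< d)))

  afterVisible : ∀ {P} → (∀ {m} → m ℕ.< actions P → Acc ℕ._<_ m) → VisibleStep P → List (Observation P)
  afterVisible rs (step {u} {ε} d) =
    map (λ (w , E , o) → (u , ε) ∷ w , E , visible d o) (observations′ _ (rs (actions-< d)))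

  observations′ P (acc rs) =
    unmoved P ++ concatMap (afterInternal rs) (internalSteps P) ++ concatMap (afterVisible rs) (visibleSteps P)

  Same : ∀ {P} → Word → Term → Observation P → Set c
  Same w E (w′ , E′ , _) = w ≡ w′ × E ≡ E′

  observations′-complete : ∀ {P} (rs : Acc ℕ._<_ (actions P)) {w E} → Observes P w E →
    Any (Same w E) (observations′ P rs)
  observations′-complete {P} (acc rs) (stop ¬d) = Any.++⁺ˡ unmoved-complete
    where
    unmoved-complete : Any (Same [] P) (unmoved P)
    unmoved-complete with stuck? P
    ... | yes _ = here (refl , refl)
    ... | no ¬s = contradiction ¬d ¬s
  observations′-complete {P} (acc rs) (internal d o) =
    Any.++⁺ʳ (unmoved P) (Any.++⁺ˡ (Any.concat⁺ (Any.map⁺ (lose (∈-internalSteps d)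
      (Any.map⁺ (observations′-complete (rs (actions-< d)) o))))))
  observations′-complete {P} (acc rs) (visible d o) =
    Any.++⁺ʳ (unmoved P) (Any.++⁺ʳ (concatMap (afterInternal rs) (internalSteps P)) (Any.concat⁺ (Any.map⁺ (lose (∈-visibleSteps d)
      (Any.map⁺ (Any.map (λ { (refl , eq) → refl , eq }) (observations′-complete (rs (actions-< d)) o)))))))

  observations : ∀ P → List (Observation P)
  observations P = observations′ P (<-wellFounded _)

  observations-complete : ∀ {P w E} → Observes P w E → Any (Same w E) (observations P)
  observations-complete = observations′-complete (<-wellFounded _)

  -- The idealised calculus and its implementation

  -- Linear prefixes and sums are primitive; ⊗ composes a forest of events with
  -- its relays.
  infixr 6 _∥ₗ_ _⊗_
  infixr 5 _⊕ₗ_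

  data Ideal : Set c where
    val  : Carrier → Ideal
    off  : Shared → Polarity → Ideal
    pre  : Action → Ideal → Ideal
    _∥ₗ_ _⊗_ _⊕ₗ_ : Ideal → Ideal → Ideal

  infix 4 _—⟨_⟩→_ _⇝_

  data _—⟨_⟩→_ : Ideal → Action → Ideal → Set c where
    pre : ∀ {α l} → pre α l —⟨ α ⟩→ l
    ∥ˡ  : ∀ {α l l′ m} → l —⟨ α ⟩→ l′ → l ∥ₗ m —⟨ α ⟩→ l′ ∥ₗ m
    ∥ʳ  : ∀ {α l m m′} → m —⟨ α ⟩→ m′ → l ∥ₗ m —⟨ α ⟩→ l ∥ₗ m′
    ⊗ˡ  : ∀ {α l l′ m} → l —⟨ α ⟩→ l′ → l ⊗ m —⟨ α ⟩→ l′ ⊗ m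
    ⊗ʳ  : ∀ {α l m m′} → m —⟨ α ⟩→ m′ → l ⊗ m —⟨ α ⟩→ l ⊗ m′

  -- No rule reduces inside a side of `⊗`: the sides are kept `Flat`, so the only reductions there
  -- are synchronisations between them on wires.
  data _⇝_ : Ideal → Ideal → Set c where
    sync : ∀ {l l′ m m′ p ε} → l —⟨ wire p ε ⟩→ l′ → m —⟨ wire p (opposite ε) ⟩→ m′ → l ⊗ m ⇝ l′ ⊗ m′
    ⊕ˡ   : ∀ {l m} → l ⊕ₗ m ⇝ l
    ⊕ʳ   : ∀ {l m} → l ⊕ₗ m ⇝ m
    ∥ˡ   : ∀ {l l′ m} → l ⇝ l′ → l ∥ₗ m ⇝ l′ ∥ₗ m
    ∥ʳ   : ∀ {l m m′} → m ⇝ m′ → l ∥ₗ m ⇝ l ∥ₗ m′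

  data Offers (s : Shared) (ε : Polarity) : Ideal → Set c where
    off : Offers s ε (off s ε)
    ∥ˡ  : ∀ {l m} → Offers s ε l → Offers s ε (l ∥ₗ m)
    ∥ʳ  : ∀ {l m} → Offers s ε m → Offers s ε (l ∥ₗ m)
    ⊗ˡ  : ∀ {l m} → Offers s ε l → Offers s ε (l ⊗ m)
    ⊗ʳ  : ∀ {l m} → Offers s ε m → Offers s ε (l ⊗ m)

  Flat : Ideal → Set
  Flat (val k)   = ⊤
  Flat (off s ε) = ⊤
  Flat (pre α l) = Flat l
  Flat (l ∥ₗ m)  = Flat l × Flat m
  Flat (l ⊗ m)   = ⊥
  Flat (l ⊕ₗ m)  = ⊥

  -- The condition on the relays; it makes every synchronisation across `⊗` take place on a wire.
  Wires : Ideal → Set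
  Wires (val k)               = ⊤
  Wires (off s ε)             = ⊥
  Wires (pre (event s ε a) l) = ⊥
  Wires (pre (wire p ε) l)    = Wires l
  Wires (l ∥ₗ m)              = Wires l × Wires m
  Wires (l ⊗ m)               = ⊥
  Wires (l ⊕ₗ m)              = ⊥

  Done : Ideal → Set
  Done (val k)   = ⊤
  Done (off s ε) = ⊤
  Done (pre α l) = ⊥
  Done (l ∥ₗ m)  = Done l × Done m
  Done (l ⊗ m)   = Done l × Done m
  Done (l ⊕ₗ m)  = ⊥

  valueₗ : Ideal → Carrier
  valueₗ (val k)   = k
  valueₗ (off s ε) = 1#
  valueₗ (pre α l) = 1#
  valueₗ (l ∥ₗ m)  = valueₗ l * valueₗ m
  valueₗ (l ⊗ m)   = valueₗ l * valueₗ m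
  valueₗ (l ⊕ₗ m)  = 1#

  wires⇒flat : ∀ l → Wires l → Flat l
  wires⇒flat (val k)            w       = w
  wires⇒flat (pre (wire p ε) l) w       = wires⇒flat l w
  wires⇒flat (l ∥ₗ m)           (w , v) = wires⇒flat l w , wires⇒flat m v

  flat-step : ∀ {l α l′} → l —⟨ α ⟩→ l′ → Flat l → Flat l′
  flat-step pre    f       = f
  flat-step (∥ˡ d) (f , g) = flat-step d f , g
  flat-step (∥ʳ d) (f , g) = f , flat-step d g

  flat-¬⇝ : ∀ {l l′} → l ⇝ l′ → ¬ Flat l
  flat-¬⇝ (∥ˡ d) (f , g) = flat-¬⇝ d f
  flat-¬⇝ (∥ʳ d) (f , g) = flat-¬⇝ d g

  wires-step : ∀ {l α l′} → l —⟨ α ⟩→ l′ → Wires l → Wires l′ × ∃ λ p → ∃ λ ε → α ≡ wire p ε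
  wires-step (pre {wire p ε}) w = w , p , ε , refl
  wires-step (∥ˡ d) (w , v) = let w′ , r = wires-step d w in (w′ , v) , r
  wires-step (∥ʳ d) (w , v) = let v′ , r = wires-step d v in (w , v′) , r

  wires-¬offers : ∀ {l s ε} → Offers s ε l → ¬ Wires l
  wires-¬offers (∥ˡ o) (w , v) = wires-¬offers o w
  wires-¬offers (∥ʳ o) (w , v) = wires-¬offers o v

  done-¬step : ∀ {l α l′} → l —⟨ α ⟩→ l′ → ¬ Done l
  done-¬step (∥ˡ d) (f , g) = done-¬step d f
  done-¬step (∥ʳ d) (f , g) = done-¬step d g
  done-¬step (⊗ˡ d) (f , g) = done-¬step d f
  done-¬step (⊗ʳ d) (f , g) = done-¬step d g

  -- A zero has been uncovered, so that every run ends in a state equal to 0.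
  data Dead : Term → Set c where
    zero : Dead (const 0#)
    ◇    : ∀ {P} → Dead P → Dead (◇ P)
    ∣ˡ   : ∀ {P Q} → Dead P → Dead (P ∣ Q)
    ∣ʳ   : ∀ {P Q} → Dead Q → Dead (P ∣ Q)
    ∥ˡ   : ∀ {P Q} → Dead P → Dead (P ∥ Q)
    ∥ʳ   : ∀ {P Q} → Dead Q → Dead (P ∥ Q)
    ν    : ∀ {P} → Dead P → Dead (ν P)

  dead-rename : ∀ {P} ρ → Dead P → Dead (rename ρ P)
  dead-rename ρ zero   = zero
  dead-rename ρ (◇ d)  = ◇ (dead-rename ρ d)
  dead-rename ρ (∣ˡ d) = ∣ˡ (dead-rename ρ d)
  dead-rename ρ (∣ʳ d) = ∣ʳ (dead-rename ρ d)
  dead-rename ρ (∥ˡ d) = ∥ˡ (dead-rename ρ d)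
  dead-rename ρ (∥ʳ d) = ∥ʳ (dead-rename ρ d)
  dead-rename ρ (ν d)  = ν (dead-rename (ext ρ) d)

  dead-step : ∀ {P a Q} → P —[ a ]→ Q → Dead P → Dead Q
  dead-step (◇ᵛ d)     (◇ z)  = ◇ (dead-step d z)
  dead-step (◇ⁱ d)     (◇ z)  = ◇ (dead-step d z)
  dead-step (∣ˡᵛ d)    (∣ˡ z) = ∣ˡ (dead-step d z)
  dead-step (∣ˡᵛ d)    (∣ʳ z) = ∣ʳ (dead-rename suc z)
  dead-step (∣ˡⁱ d)    (∣ˡ z) = ∣ˡ (dead-step d z)
  dead-step (∣ˡⁱ d)    (∣ʳ z) = ∣ʳ z
  dead-step (∣ʳᵛ d)    (∣ˡ z) = ∣ˡ (dead-rename suc z)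
  dead-step (∣ʳᵛ d)    (∣ʳ z) = ∣ʳ (dead-step d z)
  dead-step (∣ʳⁱ d)    (∣ˡ z) = ∣ˡ z
  dead-step (∣ʳⁱ d)    (∣ʳ z) = ∣ʳ (dead-step d z)
  dead-step (∥ˡᵛ d)    (∥ˡ z) = ∥ˡ (dead-step d z)
  dead-step (∥ˡᵛ d)    (∥ʳ z) = ∥ʳ (dead-rename suc z)
  dead-step (∥ˡⁱ d)    (∥ˡ z) = ∥ˡ (dead-step d z)
  dead-step (∥ˡⁱ d)    (∥ʳ z) = ∥ʳ z
  dead-step (∥ʳᵛ d)    (∥ˡ z) = ∥ˡ (dead-rename suc z)
  dead-step (∥ʳᵛ d)    (∥ʳ z) = ∥ʳ (dead-step d z)
  dead-step (∥ʳⁱ d)    (∥ˡ z) = ∥ˡ z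
  dead-step (∥ʳⁱ d)    (∥ʳ z) = ∥ʳ (dead-step d z)
  dead-step (νᵛ d)     (ν z)  = ν (dead-rename exchange (dead-step d z))
  dead-step (νⁱ d)     (ν z)  = ν (dead-step d z)
  dead-step (sync d e) (∣ˡ z) = ν (∣ˡ (dead-step d z))
  dead-step (sync d e) (∣ʳ z) = ν (∣ʳ (dead-step e z))

  dead-state : ∀ {P} → Dead P → state P ≈ 0#
  dead-state zero   = ≈-refl
  dead-state (◇ z)  = dead-state z
  dead-state (∣ˡ z) = ≈-trans (*-cong (dead-state z) ≈-refl) (zeroˡ _)
  dead-state (∣ʳ z) = ≈-trans (*-cong ≈-refl (dead-state z)) (zeroʳ _)
  dead-state (∥ˡ z) = ≈-trans (*-cong (dead-state z) ≈-refl) (zeroˡ _)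
  dead-state (∥ʳ z) = ≈-trans (*-cong ≈-refl (dead-state z)) (zeroʳ _)
  dead-state (ν z)  = dead-state z

  𝟘 𝟙 : Term
  𝟘 = const 0#
  𝟙 = const 1#

  -- The inert remainder of a linear action that has received its
  -- acknowledgement, and of a sum whose left or right summand has been chosen.
  data Wrapper : Set c where
    acknowledged      : Wrapper
    chosenˡ chosenʳ   : Term → Wrapper

  plug : Wrapper → Name → Term → Term
  plug acknowledged i t = ◇ (t ∣ ◇ 𝟙) ∣ (act i Sign.+ 𝟘 ∣ ◇ 𝟙)
  plug (chosenˡ Q)  i t = (◇ t ∣ act i Sign.+ Q) ∣ ◇ 𝟙
  plug (chosenʳ Q)  i t = (act i Sign.+ Q ∣ ◇ t) ∣ ◇ 𝟙

  renameWrapper : (Name → Name) → Wrapper → Wrapper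
  renameWrapper ρ acknowledged = acknowledged
  renameWrapper ρ (chosenˡ Q)  = chosenˡ (rename (ext ρ) Q)
  renameWrapper ρ (chosenʳ Q)  = chosenʳ (rename (ext ρ) Q)

  rename-plug : ∀ ρ W i t → rename ρ (plug W i t) ≡ plug (renameWrapper ρ W) (ρ i) (rename ρ t)
  rename-plug ρ acknowledged i t = refl
  rename-plug ρ (chosenˡ Q)  i t = refl
  rename-plug ρ (chosenʳ Q)  i t = refl

  pending : Name → Polarity → Term → Term
  pending u ε t = act (suc u) ε (t ∣ act 1 Sign.+ 𝟙) ∣ (act 0 Sign.+ 𝟘 ∣ act 0 Sign.- 𝟙)

  -- The stage between firing and acknowledgement: `w.1` inside `◇` competes with `w.0` for the
  -- single co-action on `w`, and a zero is uncovered if `w.0` wins.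
  awaiting : Term → Term
  awaiting t = ◇ (t ∣ act 0 Sign.+ 𝟙) ∣ (act 0 Sign.+ 𝟘 ∣ act 0 Sign.- 𝟙)

  choice : Term → Term → Term
  choice t t′ = (act 0 Sign.+ t ∣ act 0 Sign.+ t′) ∣ act 0 Sign.- 𝟙

  -- Relates all stages of an encoding to one idealised term: `fired` and `wrap` add administrative
  -- context only and leave that term unchanged. In `ten`, `Flat` keeps reductions out of the two
  -- sides, `Wires` makes their synchronisations private, and injectivity makes these possible
  -- whenever the ideal has them. In `scale`, `∣` may stand for `∥ₗ` because a constant cannot
  -- synchronise.
  data Implements : Env → Term → Ideal → Set c where
    val   : ∀ {η k} → Implements η (const k) (val k)
    off   : ∀ {η u s ε} → η u ≡ just (inj₁ s) → Implements η (act u ε 𝟘) (off s ε)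
    ◇     : ∀ {η t l} → Implements η t l → Implements η (◇ t) l
    ν     : ∀ {η x t l m} → NotShared x → Implements (x ◂ η) t (l ⊗ m) → Implements η (ν t) (l ⊗ m)
    par   : ∀ {η t t′ l l′} → Implements η t l → Implements η t′ l′ → Implements η (t ∥ t′) (l ∥ₗ l′)
    scale : ∀ {η k t l} → Implements η t l → Implements η (const k ∣ t) (val k ∥ₗ l)
    pre   : ∀ {η u α t l} → η u ≡ just (subjectOf α) → Implements (objectOf α ◂ nothing ◂ η) t l →
            Implements η (ν (pending u (polarityOf α) t)) (pre α l)
    fired : ∀ {η t l} → Implements (nothing ◂ η) t l → Implements η (ν (awaiting t)) l
    wrap  : ∀ {η t l} W → Implements (nothing ◂ nothing ◂ η) t l → Implements η (ν (ν (plug W 1 t))) l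
    ten   : ∀ {η t t′ l m} → Implements η t l → Implements η t′ m → Flat l → Wires m →
            PrivateInjective η → Implements η (t ∣ t′) (l ⊗ m)
    choose : ∀ {η t t′ l l′} → Implements (nothing ◂ nothing ◂ η) t l →
            Implements (nothing ◂ nothing ◂ η) t′ l′ → Implements η (ν (choice t t′)) (l ⊕ₗ l′)

  implements-rename : ∀ {η ρ η′ t l} → Renaming η ρ η′ → Implements η t l → Implements η′ (rename ρ t) l
  implements-rename r val           = val
  implements-rename r (off p)       = off (≡.trans (resp r _) p)
  implements-rename r (◇ i)         = ◇ (implements-rename r i)
  implements-rename r (ν ns i)      = ν ns (implements-rename (renaming-ext r) i)
  implements-rename r (par i j)     = par (implements-rename r i) (implements-rename r j)
  implements-rename r (scale i)     = scale (implements-rename r i)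
  implements-rename r (pre p i)     =
    pre (≡.trans (resp r _) p) (implements-rename (renaming-ext (renaming-ext r)) i)
  implements-rename r (fired i)     = fired (implements-rename (renaming-ext r) i)
  implements-rename {ρ = ρ} r (wrap {t = t} W i)
    rewrite rename-plug (ext (ext ρ)) W 1 t = wrap _ (implements-rename (renaming-ext (renaming-ext r)) i)
  implements-rename r (ten i j f w inj) =
    ten (implements-rename r i) (implements-rename r j) f w (renaming-privateInjective r inj)
  implements-rename r (choose i j)     =
    choose (implements-rename (renaming-ext (renaming-ext r)) i) (implements-rename (renaming-ext (renaming-ext r)) j)

  implements-weaken : ∀ {η x t l} → NotPrivate x → Implements η t l → Implements (x ◂ η) (weaken t) l
  implements-weaken np = implements-rename (renaming-suc np)

  implements-exchange : ∀ {η x y t l} → Implements (x ◂ y ◂ η) t l → Implements (y ◂ x ◂ η) (rename exchange t) l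
  implements-exchange = implements-rename renaming-exchange

  -- Soundness and completeness of the transitions of an encoding

  data VisibleSound (η : Env) (l : Ideal) (u : Name) (ε : Polarity) (t′ : Term) : Set c where
    dies  : ∀ s → η u ≡ just (inj₁ s) → Offers s ε l → Dead t′ → VisibleSound η l u ε t′
    fires : ∀ α {l′} → η u ≡ just (subjectOf α) → polarityOf α ≡ ε → l —⟨ α ⟩→ l′ →
            Implements (objectOf α ◂ η) t′ l′ → VisibleSound η l u ε t′

  data InternalSound (η : Env) (l : Ideal) (t′ : Term) : Set c where
    dies : Dead t′ → InternalSound η l t′
    idle : Implements η t′ l → InternalSound η l t′
    move : ∀ {l′} → l ⇝ l′ → Implements η t′ l′ → InternalSound η l t′

  act-visible : ∀ {v δ P u ε ι t} → act v δ P —[ vis u ε ι ]→ t → u ≡ v × ε ≡ δ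
  act-visible act = refl , refl

  guard-visible : ∀ {u ε ι t} → (act 0 Sign.+ 𝟘 ∣ act 0 Sign.- 𝟙) —[ vis u ε ι ]→ t → u ≡ 0
  guard-visible (∣ˡᵛ act) = refl
  guard-visible (∣ʳᵛ act) = refl

  guard-internal : ∀ {ι κ t} → (act 0 Sign.+ 𝟘 ∣ act 0 Sign.- 𝟙) —[ int ι κ ]→ t → Dead t
  guard-internal (sync act act) = ν (∣ˡ (◇ zero))

  plug-visible : ∀ W {i t u ε ι s} → plug W i t —[ vis u ε ι ]→ s →
    u ≡ i ⊎ ∃ λ t′ → ∃ λ κ → t —[ vis u ε κ ]→ t′ × s ≡ plug (renameWrapper suc W) (suc i) t′
  plug-visible acknowledged (∣ˡᵛ (◇ᵛ (∣ˡᵛ d))) = inj₂ (_ , _ , d , refl)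
  plug-visible acknowledged (∣ˡᵛ (◇ᵛ (∣ʳᵛ (◇ᵛ ()))))
  plug-visible acknowledged (∣ʳᵛ (∣ˡᵛ act))    = inj₁ refl
  plug-visible acknowledged (∣ʳᵛ (∣ʳᵛ (◇ᵛ ())))
  plug-visible (chosenˡ Q)  (∣ˡᵛ (∣ˡᵛ (◇ᵛ d))) = inj₂ (_ , _ , d , refl)
  plug-visible (chosenˡ Q)  (∣ˡᵛ (∣ʳᵛ act))    = inj₁ refl
  plug-visible (chosenˡ Q)  (∣ʳᵛ (◇ᵛ ()))
  plug-visible (chosenʳ Q)  (∣ˡᵛ (∣ˡᵛ act))    = inj₁ refl
  plug-visible (chosenʳ Q)  (∣ˡᵛ (∣ʳᵛ (◇ᵛ d))) = inj₂ (_ , _ , d , refl)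
  plug-visible (chosenʳ Q)  (∣ʳᵛ (◇ᵛ ()))

  plug-visible⁺ : ∀ W {i t u ε κ t′} → t —[ vis u ε κ ]→ t′ →
    ∃ λ ι → plug W i t —[ vis u ε ι ]→ plug (renameWrapper suc W) (suc i) t′
  plug-visible⁺ acknowledged d = _ , ∣ˡᵛ (◇ᵛ (∣ˡᵛ d))
  plug-visible⁺ (chosenˡ Q)  d = _ , ∣ˡᵛ (∣ˡᵛ (◇ᵛ d))
  plug-visible⁺ (chosenʳ Q)  d = _ , ∣ˡᵛ (∣ʳᵛ (◇ᵛ d))

  -- The second alternative is a communication between the body and the inert prefix on `i`. In an
  -- implementation `i` denotes `nothing`, and `visible-named` then excludes it.
  plug-internal : ∀ W {i t ι κ s} → plug W i t —[ int ι κ ]→ s →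
    (∃ λ t′ → ∃ λ ι′ → ∃ λ κ′ → t —[ int ι′ κ′ ]→ t′ × s ≡ plug W i t′) ⊎
    (∃ λ t′ → ∃ λ ε → ∃ λ ι′ → t —[ vis i ε ι′ ]→ t′)
  plug-internal acknowledged (∣ˡⁱ (◇ⁱ (∣ˡⁱ d)))        = inj₁ (_ , _ , _ , d , refl)
  plug-internal acknowledged (∣ˡⁱ (◇ⁱ (∣ʳⁱ (◇ⁱ ()))))
  plug-internal acknowledged (∣ˡⁱ (◇ⁱ (sync d (◇ᵛ ()))))
  plug-internal acknowledged (∣ʳⁱ (∣ʳⁱ (◇ⁱ ())))
  plug-internal acknowledged (∣ʳⁱ (sync d (◇ᵛ ())))
  plug-internal acknowledged (sync (◇ᵛ (∣ˡᵛ d)) (∣ˡᵛ e)) with act-visible e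
  ... | refl , _ = inj₂ (_ , _ , _ , d)
  plug-internal acknowledged (sync d (∣ʳᵛ (◇ᵛ ())))
  plug-internal acknowledged (sync (◇ᵛ (∣ʳᵛ (◇ᵛ ()))) (∣ˡᵛ e))
  plug-internal (chosenˡ Q) (∣ˡⁱ (∣ˡⁱ (◇ⁱ d)))         = inj₁ (_ , _ , _ , d , refl)
  plug-internal (chosenˡ Q) (∣ˡⁱ (sync (◇ᵛ d) e)) with act-visible e
  ... | refl , _ = inj₂ (_ , _ , _ , d)
  plug-internal (chosenˡ Q) (∣ʳⁱ (◇ⁱ ()))
  plug-internal (chosenˡ Q) (sync d (◇ᵛ ()))
  plug-internal (chosenʳ Q) (∣ˡⁱ (∣ʳⁱ (◇ⁱ d)))         = inj₁ (_ , _ , _ , d , refl)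
  plug-internal (chosenʳ Q) (∣ˡⁱ (sync act (◇ᵛ d)))    = inj₂ (_ , _ , _ , d)
  plug-internal (chosenʳ Q) (∣ʳⁱ (◇ⁱ ()))
  plug-internal (chosenʳ Q) (sync d (◇ᵛ ()))

  plug-internal⁺ : ∀ W {i t ι κ t′} → t —[ int ι κ ]→ t′ →
    ∃ λ ι′ → ∃ λ κ′ → plug W i t —[ int ι′ κ′ ]→ plug W i t′
  plug-internal⁺ acknowledged d = _ , _ , ∣ˡⁱ (◇ⁱ (∣ˡⁱ d))
  plug-internal⁺ (chosenˡ Q)  d = _ , _ , ∣ˡⁱ (∣ˡⁱ (◇ⁱ d))
  plug-internal⁺ (chosenʳ Q)  d = _ , _ , ∣ˡⁱ (∣ʳⁱ (◇ⁱ d))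

  plug-dead : ∀ W {i t} → Dead t → Dead (plug W i t)
  plug-dead acknowledged z = ∣ˡ (◇ (∣ˡ z))
  plug-dead (chosenˡ Q)  z = ∣ˡ (∣ˡ (◇ z))
  plug-dead (chosenʳ Q)  z = ∣ˡ (∣ʳ (◇ z))

  plug-shift : ∀ W t → rename (ext exchange) (rename exchange (plug (renameWrapper suc W) 2 t)) ≡
    plug (renameWrapper (ext exchange) (renameWrapper exchange (renameWrapper suc W))) 1
      (rename (ext exchange) (rename exchange t))
  plug-shift acknowledged t = refl
  plug-shift (chosenˡ Q)  t = refl
  plug-shift (chosenʳ Q)  t = refl

  -- A visible step out of two restrictions moves its fresh object past both by two exchanges, and
  -- the index of the inert prefix, weakened to 2, returns to 1.
  wrap-shift : ∀ {η o t l} W → Implements (o ◂ nothing ◂ nothing ◂ η) t l →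
    Implements (o ◂ η) (ν (rename exchange (ν (rename exchange (plug (renameWrapper suc W) 2 t))))) l
  wrap-shift {t = t} W i rewrite plug-shift W t =
    wrap _ (implements-rename (renaming-ext renaming-exchange) (implements-exchange i))

  visible-sound : ∀ {η t l u ε ι t′} → Implements η t l → t —[ vis u ε ι ]→ t′ → VisibleSound η l u ε t′
  visible-sound (off p) act = dies _ p off (◇ zero)
  visible-sound (◇ i) (◇ᵛ d) with visible-sound i d
  ... | dies s p o z      = dies s p o (◇ z)
  ... | fires α p q e i′  = fires α p q e (◇ i′)
  visible-sound (ν ns i) (νᵛ d) with visible-sound i d
  ... | dies s p o z          = dies s p o (ν (dead-rename exchange z))
  ... | fires α p q (⊗ˡ e) i′ = fires α p q (⊗ˡ e) (ν ns (implements-exchange i′))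
  ... | fires α p q (⊗ʳ e) i′ = fires α p q (⊗ʳ e) (ν ns (implements-exchange i′))
  visible-sound (par i j) (∥ˡᵛ d) with visible-sound i d
  ... | dies s p o z     = dies s p (∥ˡ o) (∥ˡ z)
  ... | fires α p q e i′ = fires α p q (∥ˡ e) (par i′ (implements-weaken (objectOf-notPrivate α) j))
  visible-sound (par i j) (∥ʳᵛ d) with visible-sound j d
  ... | dies s p o z     = dies s p (∥ʳ o) (∥ʳ z)
  ... | fires α p q e j′ = fires α p q (∥ʳ e) (par (implements-weaken (objectOf-notPrivate α) i) j′)
  visible-sound (scale i) (∣ʳᵛ d) with visible-sound i d
  ... | dies s p o z     = dies s p (∥ʳ o) (∣ʳ z)
  ... | fires α p q e i′ = fires α p q (∥ʳ e) (scale i′)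
  visible-sound (pre {α = α} p i) (νᵛ (∣ˡᵛ act)) = fires α p refl pre (fired (implements-exchange i))
  visible-sound (pre p i) (νᵛ (∣ʳᵛ d)) with guard-visible d
  ... | ()
  visible-sound (fired i) (νᵛ (∣ˡᵛ (◇ᵛ (∣ˡᵛ d)))) with visible-sound i d
  ... | dies s p o z     = dies s p o (ν (∣ˡ (◇ (∣ˡ (dead-rename exchange z)))))
  ... | fires α p q e i′ = fires α p q e (fired (implements-exchange i′))
  visible-sound (fired i) (νᵛ (∣ˡᵛ (◇ᵛ (∣ʳᵛ d)))) with act-visible d
  ... | () , _
  visible-sound (fired i) (νᵛ (∣ʳᵛ d)) with guard-visible d
  ... | ()
  visible-sound (wrap W i) (νᵛ (νᵛ d)) with plug-visible W d
  ... | inj₂ (t′ , κ , d′ , refl) with visible-sound i d′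
  ...   | dies s p o z     = dies s p o
    (ν (dead-rename exchange (ν (dead-rename exchange (plug-dead (renameWrapper suc W) z)))))
  ...   | fires α p q e i′ = fires α p q e (wrap-shift W i′)
  visible-sound (ten i j f w inj) (∣ˡᵛ d) with visible-sound i d
  ... | dies s p o z     = dies s p (⊗ˡ o) (∣ˡ z)
  ... | fires α p q e i′ = fires α p q (⊗ˡ e) (ten i′ (implements-weaken (objectOf-notPrivate α) j)
    (flat-step e f) w (privateInjective-◂ (objectOf-notPrivate α) inj))
  visible-sound (ten i j f w inj) (∣ʳᵛ d) with visible-sound j d
  ... | dies s p o z     = dies s p (⊗ʳ o) (∣ʳ z)
  ... | fires α p q e j′ = fires α p q (⊗ʳ e) (ten (implements-weaken (objectOf-notPrivate α) i) j′
    f (proj₁ (wires-step e w)) (privateInjective-◂ (objectOf-notPrivate α) inj))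
  visible-sound (choose i j) (νᵛ (∣ˡᵛ (∣ˡᵛ d))) with act-visible d
  ... | () , _
  visible-sound (choose i j) (νᵛ (∣ˡᵛ (∣ʳᵛ d))) with act-visible d
  ... | () , _
  visible-sound (choose i j) (νᵛ (∣ʳᵛ d)) with act-visible d
  ... | () , _

  -- Keeps administrative names apart from all others: the body of a linear action or of a chosen
  -- summand can neither steal an acknowledgement nor meet an inert prefix.
  visible-named : ∀ {η t l u ε ι t′} → Implements η t l → t —[ vis u ε ι ]→ t′ → η u ≢ nothing
  visible-named i d eq with visible-sound i d
  ... | dies s p _ _    = contradiction (≡.trans (≡.sym p) eq) λ ()
  ... | fires α p _ _ _ = contradiction (≡.trans (≡.sym p) eq) λ ()

  -- The right side acts on wires only and both partners use one index, so the left action is on the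
  -- same wire. The object of a wire is administrative, hence `nothing` for the new restriction. If
  -- a partner used an offer, a zero has been uncovered.
  sync-sound : ∀ {η t t′ l m u ε ι κ s s′} → Implements η t l → Implements η t′ m → Flat l → Wires m →
    PrivateInjective η → t —[ vis u ε ι ]→ s → t′ —[ vis u (opposite ε) κ ]→ s′ →
    InternalSound η (l ⊗ m) (ν (s ∣ s′))
  sync-sound i j f w inj d e with visible-sound i d | visible-sound j e
  ... | dies _ _ _ z    | _ = dies (ν (∣ˡ z))
  ... | fires _ _ _ _ _ | dies _ _ _ z = dies (ν (∣ʳ z))
  ... | fires α p q a i′ | fires β p′ q′ b j′ with wires-step b w
  ...   | w′ , x , δ , refl with α | just-injective (≡.trans (≡.sym p) p′)
  ...     | wire _ _ | refl with q | q′
  ...       | refl | refl = move (sync a b)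
    (ν notShared-nothing (ten i′ j′ (flat-step a f) w′ (privateInjective-◂ notPrivate-nothing inj)))

  internal-sound : ∀ {η t l ι κ t′} → Implements η t l → t —[ int ι κ ]→ t′ → InternalSound η l t′
  internal-sound (◇ i) (◇ⁱ d) with internal-sound i d
  ... | dies z    = dies (◇ z)
  ... | idle i′   = idle (◇ i′)
  ... | move e i′ = move e (◇ i′)
  internal-sound (ν ns i) (νⁱ d) with internal-sound i d
  ... | dies z               = dies (ν z)
  ... | idle i′              = idle (ν ns i′)
  ... | move (sync a b) i′   = move (sync a b) (ν ns i′)
  internal-sound (par i j) (∥ˡⁱ d) with internal-sound i d
  ... | dies z    = dies (∥ˡ z)
  ... | idle i′   = idle (par i′ j)
  ... | move e i′ = move (∥ˡ e) (par i′ j)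
  internal-sound (par i j) (∥ʳⁱ d) with internal-sound j d
  ... | dies z    = dies (∥ʳ z)
  ... | idle j′   = idle (par i j′)
  ... | move e j′ = move (∥ʳ e) (par i j′)
  internal-sound (scale i) (∣ʳⁱ d) with internal-sound i d
  ... | dies z    = dies (∣ʳ z)
  ... | idle i′   = idle (scale i′)
  ... | move e i′ = move (∥ʳ e) (scale i′)
  -- Before it fires, the one internal step of a linear action is that of its guard with itself.
  internal-sound (pre p i) (νⁱ (∣ʳⁱ d)) = dies (ν (∣ʳ (guard-internal d)))
  internal-sound (pre p i) (νⁱ (sync act e)) with guard-visible e
  ... | ()
  internal-sound (fired i) (νⁱ (∣ˡⁱ (◇ⁱ (∣ˡⁱ d)))) with internal-sound i d
  ... | dies z    = dies (ν (∣ˡ (◇ (∣ˡ z))))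
  ... | idle i′   = idle (fired i′)
  ... | move e i′ = move e (fired i′)
  internal-sound (fired i) (νⁱ (∣ˡⁱ (◇ⁱ (sync d e)))) with act-visible e
  ... | refl , _ = contradiction refl (visible-named i d)
  internal-sound (fired i) (νⁱ (∣ʳⁱ d)) = dies (ν (∣ʳ (guard-internal d)))
  internal-sound (fired i) (νⁱ (sync (◇ᵛ (∣ˡᵛ d)) e)) with guard-visible e
  ... | refl = contradiction refl (visible-named i d)
  -- The acknowledgement: the ideal action was matched when the prefix fired, so this step is idle.
  -- The synchronisation adds the second restriction of `wrap`.
  internal-sound (fired i) (νⁱ (sync (◇ᵛ (∣ʳᵛ act)) (∣ʳᵛ act))) =
    idle (wrap acknowledged (implements-weaken notPrivate-nothing i))
  internal-sound (wrap W i) (νⁱ (νⁱ d)) with plug-internal W d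
  ... | inj₂ (_ , _ , _ , d′) = contradiction refl (visible-named i d′)
  ... | inj₁ (_ , _ , _ , d′ , refl) with internal-sound i d′
  ...   | dies z    = dies (ν (ν (plug-dead W z)))
  ...   | idle i′   = idle (wrap W i′)
  ...   | move e i′ = move e (wrap W i′)
  internal-sound (ten i j f w inj) (∣ˡⁱ d) with internal-sound i d
  ... | dies z    = dies (∣ˡ z)
  ... | idle i′   = idle (ten i′ j f w inj)
  ... | move e i′ = contradiction f (flat-¬⇝ e)
  internal-sound (ten {m = m} i j f w inj) (∣ʳⁱ d) with internal-sound j d
  ... | dies z    = dies (∣ʳ z)
  ... | idle j′   = idle (ten i j′ f w inj)
  ... | move e j′ = contradiction (wires⇒flat m w) (flat-¬⇝ e)
  internal-sound (ten i j f w inj) (sync d e) = sync-sound i j f w inj d e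
  internal-sound (choose i j) (νⁱ (∣ˡⁱ (sync act e))) with act-visible e
  ... | _ , ()
  internal-sound (choose i j) (νⁱ (sync (∣ˡᵛ act) act)) =
    move ⊕ˡ (wrap (chosenˡ _) i)
  internal-sound (choose i j) (νⁱ (sync (∣ʳᵛ act) act)) =
    move ⊕ʳ (wrap (chosenʳ _) j)

  IsEvent : Action → Set
  IsEvent (event s ε a) = ⊤
  IsEvent (wire p ε)    = ⊥

  record VisibleComplete (η : Env) (t : Term) (α : Action) (l′ : Ideal) : Set c where
    constructor visibly
    field
      {name}     : Name
      {position} : Position
      {target}   : Term
      named      : η name ≡ just (subjectOf α)
      steps      : t —[ vis name (polarityOf α) position ]→ target
      implements : Implements (objectOf α ◂ η) target l′

  -- A private action may be blocked by the restriction of its wire around a ⊗.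
  visible-complete : ∀ {η t l α l′} → Implements η t l → l —⟨ α ⟩→ l′ → IsEvent α ⊎ Flat l →
    VisibleComplete η t α l′
  visible-complete (◇ i) e f with visible-complete i e f
  ... | visibly p d i′ = visibly p (◇ᵛ d) (◇ i′)
  visible-complete {α = event s ε a} (ν ns i) (⊗ˡ e) f with visible-complete i (⊗ˡ e) f
  ... | visibly {zero}  p d i′ = contradiction p (ns _)
  ... | visibly {suc u} p d i′ = visibly p (νᵛ d) (ν ns (implements-exchange i′))
  visible-complete {α = event s ε a} (ν ns i) (⊗ʳ e) f with visible-complete i (⊗ʳ e) f
  ... | visibly {zero}  p d i′ = contradiction p (ns _)
  ... | visibly {suc u} p d i′ = visibly p (νᵛ d) (ν ns (implements-exchange i′))
  visible-complete {α = wire p ε} (ν ns i) e (inj₁ ())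
  visible-complete {α = wire p ε} (ν ns i) e (inj₂ ())
  visible-complete {α = α} (par i j) (∥ˡ e) f with visible-complete i e (map₂ proj₁ f)
  ... | visibly p d i′ = visibly p (∥ˡᵛ d) (par i′ (implements-weaken (objectOf-notPrivate α) j))
  visible-complete {α = α} (par i j) (∥ʳ e) f with visible-complete j e (map₂ proj₂ f)
  ... | visibly p d j′ = visibly p (∥ʳᵛ d) (par (implements-weaken (objectOf-notPrivate α) i) j′)
  visible-complete (scale i) (∥ʳ e) f with visible-complete i e (map₂ proj₂ f)
  ... | visibly p d i′ = visibly p (∣ʳᵛ d) (scale i′)
  visible-complete (pre p i) pre f = visibly p (νᵛ (∣ˡᵛ act)) (fired (implements-exchange i))
  visible-complete (fired i) e f with visible-complete i e f
  ... | visibly {suc u} p d i′ = visibly p (νᵛ (∣ˡᵛ (◇ᵛ (∣ˡᵛ d)))) (fired (implements-exchange i′))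
  visible-complete (wrap W i) e f with visible-complete i e f
  ... | visibly {suc (suc u)} p d i′ with plug-visible⁺ W d
  ...   | _ , d′ = visibly p (νᵛ (νᵛ d′)) (wrap-shift W i′)
  visible-complete {α = α} (ten i j f w inj) (⊗ˡ e) _ with visible-complete i e (inj₂ f)
  ... | visibly p d i′ = visibly p (∣ˡᵛ d) (ten i′ (implements-weaken (objectOf-notPrivate α) j)
    (flat-step e f) w (privateInjective-◂ (objectOf-notPrivate α) inj))
  visible-complete {α = α} (ten {m = m} i j f w inj) (⊗ʳ e) _ with visible-complete j e (inj₂ (wires⇒flat m w))
  ... | visibly p d j′ = visibly p (∣ʳᵛ d) (ten (implements-weaken (objectOf-notPrivate α) i) j′
    f (proj₁ (wires-step e w)) (privateInjective-◂ (objectOf-notPrivate α) inj))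

  offers-complete : ∀ {η t l s ε} → Implements η t l → Offers s ε l →
    ∃ λ u → ∃ λ ι → ∃ λ t′ → η u ≡ just (inj₁ s) × t —[ vis u ε ι ]→ t′
  offers-complete (off p) off = _ , _ , _ , p , act
  offers-complete (◇ i) o with offers-complete i o
  ... | _ , _ , _ , p , d = _ , _ , _ , p , ◇ᵛ d
  offers-complete (ν ns i) o with offers-complete i o
  ... | zero  , _ , _ , p , d = contradiction p (ns _)
  ... | suc u , _ , _ , p , d = _ , _ , _ , p , νᵛ d
  offers-complete (par i j) (∥ˡ o) with offers-complete i o
  ... | _ , _ , _ , p , d = _ , _ , _ , p , ∥ˡᵛ d
  offers-complete (par i j) (∥ʳ o) with offers-complete j o
  ... | _ , _ , _ , p , d = _ , _ , _ , p , ∥ʳᵛ d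
  offers-complete (scale i) (∥ʳ o) with offers-complete i o
  ... | _ , _ , _ , p , d = _ , _ , _ , p , ∣ʳᵛ d
  offers-complete (fired i) o with offers-complete i o
  ... | suc u , _ , _ , p , d = _ , _ , _ , p , νᵛ (∣ˡᵛ (◇ᵛ (∣ˡᵛ d)))
  offers-complete (wrap W i) o with offers-complete i o
  ... | suc (suc u) , _ , _ , p , d = _ , _ , _ , p , νᵛ (νᵛ (proj₂ (plug-visible⁺ W d)))
  offers-complete (ten i j f w inj) (⊗ˡ o) with offers-complete i o
  ... | _ , _ , _ , p , d = _ , _ , _ , p , ∣ˡᵛ d
  offers-complete (ten i j f w inj) (⊗ʳ o) with offers-complete j o
  ... | _ , _ , _ , p , d = _ , _ , _ , p , ∣ʳᵛ d

  internal-complete : ∀ {η t l l′} → Implements η t l → l ⇝ l′ →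
    ∃ λ ι → ∃ λ κ → ∃ λ t′ → t —[ int ι κ ]→ t′ × Implements η t′ l′
  internal-complete (◇ i) e with internal-complete i e
  ... | _ , _ , _ , d , i′ = _ , _ , _ , ◇ⁱ d , ◇ i′
  internal-complete (ν ns i) e@(sync _ _) with internal-complete i e
  ... | _ , _ , _ , d , i′ = _ , _ , _ , νⁱ d , ν ns i′
  internal-complete (par i j) (∥ˡ e) with internal-complete i e
  ... | _ , _ , _ , d , i′ = _ , _ , _ , ∥ˡⁱ d , par i′ j
  internal-complete (par i j) (∥ʳ e) with internal-complete j e
  ... | _ , _ , _ , d , j′ = _ , _ , _ , ∥ʳⁱ d , par i j′
  internal-complete (scale i) (∥ʳ e) with internal-complete i e
  ... | _ , _ , _ , d , i′ = _ , _ , _ , ∣ʳⁱ d , scale i′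
  internal-complete (fired i) e with internal-complete i e
  ... | _ , _ , _ , d , i′ = _ , _ , _ , νⁱ (∣ˡⁱ (◇ⁱ (∣ˡⁱ d))) , fired i′
  internal-complete (wrap W i) e with internal-complete i e
  ... | _ , _ , _ , d , i′ = _ , _ , _ , νⁱ (νⁱ (proj₂ (proj₂ (plug-internal⁺ W d)))) , wrap W i′
  internal-complete (choose i j) ⊕ˡ = _ , _ , _ , νⁱ (sync (∣ˡᵛ act) act) , wrap (chosenˡ _) i
  internal-complete (choose i j) ⊕ʳ = _ , _ , _ , νⁱ (sync (∣ʳᵛ act) act) , wrap (chosenʳ _) j
  internal-complete (ten {m = m} i j f w inj) (sync e e′)
    with visible-complete i e (inj₂ f) | visible-complete j e′ (inj₂ (wires⇒flat m w))
  -- Both sides denote the wire `p`, so injectivity gives the common index that the transition rule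
  -- requires.
  ... | visibly p d i′ | visibly q d′ j′ with inj p q
  ...   | refl = _ , _ , _ , sync d d′ , ν notShared-nothing
    (ten i′ j′ (flat-step e f) (proj₁ (wires-step e′ w)) (privateInjective-◂ notPrivate-nothing inj))

  plug-stuck : ∀ W {i t} → (∀ {ε ι t′} → ¬ (t —[ vis i ε ι ]→ t′)) → Stuck t → Stuck (plug W i t)
  plug-stuck W ¬vis ¬int (step d) with plug-internal W d
  ... | inj₁ (_ , _ , _ , d′ , _) = ¬int (step d′)
  ... | inj₂ (_ , _ , _ , d′)     = ¬vis d′

  Progress : Env → Term → Ideal → Set c
  Progress η t l = Stuck t ⊎ ∃ λ ι → ∃ λ κ → ∃ λ t′ → t —[ int ι κ ]→ t′ × Implements η t′ l

  -- A finished ideal may have an encoding still waiting for acknowledgements; each can be performed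
  -- without uncovering a zero and without changing the ideal. Across `⊗` no synchronisation
  -- remains, as the relays have neither prefixes nor offers left.
  progress : ∀ {η t l} → Implements η t l → Done l → Progress η t l
  progress val _ = inj₁ λ { (step ()) }
  progress (off p) _ = inj₁ λ { (step ()) }
  progress (◇ i) f with progress i f
  ... | inj₁ s = inj₁ λ { (step (◇ⁱ d)) → s (step d) }
  ... | inj₂ (_ , _ , _ , d , i′) = inj₂ (_ , _ , _ , ◇ⁱ d , ◇ i′)
  progress (ν ns i) f with progress i f
  ... | inj₁ s = inj₁ λ { (step (νⁱ d)) → s (step d) }
  ... | inj₂ (_ , _ , _ , d , i′) = inj₂ (_ , _ , _ , νⁱ d , ν ns i′)
  progress (par i j) (f , g) with progress i f | progress j g
  ... | inj₂ (_ , _ , _ , d , i′) | _ = inj₂ (_ , _ , _ , ∥ˡⁱ d , par i′ j)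
  ... | inj₁ _ | inj₂ (_ , _ , _ , d , j′) = inj₂ (_ , _ , _ , ∥ʳⁱ d , par i j′)
  ... | inj₁ s | inj₁ s′ = inj₁ λ { (step (∥ˡⁱ d)) → s (step d) ; (step (∥ʳⁱ d)) → s′ (step d) }
  progress (scale i) (_ , f) with progress i f
  ... | inj₁ s = inj₁ λ { (step (∣ʳⁱ d)) → s (step d) ; (step (sync () _)) }
  ... | inj₂ (_ , _ , _ , d , i′) = inj₂ (_ , _ , _ , ∣ʳⁱ d , scale i′)
  progress (fired i) f = inj₂ (_ , _ , _ , νⁱ (sync (◇ᵛ (∣ʳᵛ act)) (∣ʳᵛ act)) ,
    wrap acknowledged (implements-weaken notPrivate-nothing i))
  progress (wrap W i) f with progress i f
  ... | inj₁ s = inj₁ λ { (step (νⁱ (νⁱ d))) → plug-stuck W (λ e → visible-named i e refl) s (step d) }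
  ... | inj₂ (_ , _ , _ , d , i′) = inj₂ (_ , _ , _ , νⁱ (νⁱ (proj₂ (proj₂ (plug-internal⁺ W d)))) , wrap W i′)
  progress (ten i j f w inj) (g , h) with progress i g | progress j h
  ... | inj₂ (_ , _ , _ , d , i′) | _ = inj₂ (_ , _ , _ , ∣ˡⁱ d , ten i′ j f w inj)
  ... | inj₁ _ | inj₂ (_ , _ , _ , d , j′) = inj₂ (_ , _ , _ , ∣ʳⁱ d , ten i j′ f w inj)
  ... | inj₁ s | inj₁ s′ = inj₁ λ
    { (step (∣ˡⁱ d)) → s (step d) ; (step (∣ʳⁱ d)) → s′ (step d) ; (step (sync d e)) → idle-wires (visible-sound j e) }
    where
    idle-wires : ∀ {u ε t′} → ¬ VisibleSound _ _ u ε t′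
    idle-wires (dies s p o _)    = wires-¬offers o w
    idle-wires (fires α _ _ e _) = done-¬step e h

  plug-unstuck : ∀ W {i t} → Stuck (plug W i t) → Stuck t
  plug-unstuck W s (step d) = s (step (proj₂ (proj₂ (plug-internal⁺ W d))))

  plug-state : ∀ W i t → state (plug W i t) ≈ state t
  plug-state acknowledged i t =
    ≈-trans (*-cong (*-identityʳ _) (*-identityʳ _)) (*-identityʳ _)
  plug-state (chosenˡ Q)  i t = ≈-trans (*-identityʳ _) (*-identityʳ _)
  plug-state (chosenʳ Q)  i t = ≈-trans (*-identityʳ _) (*-identityˡ _)

  -- As long as a linear action has not fired or not been acknowledged, its guard can synchronise
  -- with itself, and a sum can always choose. A stuck term therefore contains neither, and its
  -- inert remainders contribute factors 1.
  stuck⇒done : ∀ {η t l} → Implements η t l → Stuck t → Done l × state t ≈ valueₗ l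
  stuck⇒done val       s = _ , ≈-refl
  stuck⇒done (off p)   s = _ , ≈-refl
  stuck⇒done (◇ i)     s = stuck⇒done i λ { (step d) → s (step (◇ⁱ d)) }
  stuck⇒done (ν ns i)  s = stuck⇒done i λ { (step d) → s (step (νⁱ d)) }
  stuck⇒done (par i j) s with stuck⇒done i (λ { (step d) → s (step (∥ˡⁱ d)) })
                            | stuck⇒done j (λ { (step d) → s (step (∥ʳⁱ d)) })
  ... | f , p | g , q = (f , g) , *-cong p q
  stuck⇒done (scale i) s with stuck⇒done i (λ { (step d) → s (step (∣ʳⁱ d)) })
  ... | f , p = (_ , f) , *-cong ≈-refl p
  stuck⇒done (pre p i) s = contradiction (step (νⁱ (∣ʳⁱ (sync act act)))) s
  stuck⇒done (fired i) s = contradiction (step (νⁱ (∣ʳⁱ (sync act act)))) s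
  stuck⇒done (wrap W i) s with stuck⇒done i (plug-unstuck W (λ { (step d) → s (step (νⁱ (νⁱ d))) }))
  ... | f , p = f , ≈-trans (plug-state W _ _) p
  stuck⇒done (ten i j f w inj) s with stuck⇒done i (λ { (step d) → s (step (∣ˡⁱ d)) })
                                    | stuck⇒done j (λ { (step d) → s (step (∣ʳⁱ d)) })
  ... | g , p | h , q = (g , h) , *-cong p q
  stuck⇒done (choose i j) s = contradiction (step (νⁱ (sync (∣ˡᵛ act) act))) s

  -- Performs the outstanding acknowledgements before a conclusion is drawn; `X` is any property
  -- inherited backwards along internal steps.
  settle : ∀ {η t l} → Implements η t l → Done l → ∀ {p} {X : Term → Set p} →
    (∀ {t′} → Stuck t′ → Implements η t′ l → X t′) →
    (∀ {t ι κ t′} → t —[ int ι κ ]→ t′ → X t′ → X t) → X t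
  settle {η} {t} {l} i f {X = X} base back = go t (<-wellFounded _) i
    where
    go : ∀ t → Acc ℕ._<_ (actions t) → Implements η t l → X t
    go t (acc rs) i with progress i f
    ... | inj₁ s = base s i
    ... | inj₂ (_ , _ , t′ , d , i′) = back d (go t′ (rs (actions-< d)) i′)

  implements-cong : ∀ {η η′ t l} → (∀ u → η u ≡ η′ u) → Implements η t l → Implements η′ t l
  implements-cong e val       = val
  implements-cong e (off p)   = off (≡.trans (≡.sym (e _)) p)
  implements-cong e (◇ i)     = ◇ (implements-cong e i)
  implements-cong e (ν ns i)  = ν ns (implements-cong (λ { zero → refl ; (suc u) → e u }) i)
  implements-cong e (par i j) = par (implements-cong e i) (implements-cong e j)
  implements-cong e (scale i) = scale (implements-cong e i)
  implements-cong e (pre p i) = pre (≡.trans (≡.sym (e _)) p)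
    (implements-cong (λ { zero → refl ; (suc zero) → refl ; (suc (suc u)) → e u }) i)
  implements-cong e (fired i) = fired (implements-cong (λ { zero → refl ; (suc u) → e u }) i)
  implements-cong e (wrap W i) =
    wrap W (implements-cong (λ { zero → refl ; (suc zero) → refl ; (suc (suc u)) → e u }) i)
  implements-cong e (ten i j f w inj) = ten (implements-cong e i) (implements-cong e j) f w
    (λ p q → inj (≡.trans (e _) p) (≡.trans (e _) q))
  implements-cong e (choose i j) =
    choose (implements-cong (λ { zero → refl ; (suc zero) → refl ; (suc (suc u)) → e u }) i)
        (implements-cong (λ { zero → refl ; (suc zero) → refl ; (suc (suc u)) → e u }) j)

  implements-lin : ∀ {η u α t l} → η u ≡ just (subjectOf α) → Implements (objectOf α ◂ η) t l →
    Implements η (lin u (polarityOf α) t) (pre α l)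
  implements-lin p i = pre p (implements-rename (renaming-ext (renaming-suc notPrivate-nothing)) i)

  implements-lin₀ : ∀ {η u α t l} → η u ≡ just (subjectOf α) → Implements η t l →
    Implements η (lin₀ u (polarityOf α) t) (pre α l)
  implements-lin₀ {α = α} p i = implements-lin p (implements-weaken (objectOf-notPrivate α) i)

  implements-ν^ : ∀ m {η t l l′} → (∀ {j} → j ℕ.< m → NotShared (η j)) →
    Implements η t (l ⊗ l′) → Implements (λ u → η (m ℕ.+ u)) (ν^ m t) (l ⊗ l′)
  implements-ν^ zero    ns i = i
  implements-ν^ (suc m) {η} ns i = ν (ns (ℕ.n<1+n m)) (implements-cong e (implements-ν^ m (ns ∘ ℕ.m<n⇒m<1+n) i))
    where
    e : ∀ u → η (m ℕ.+ u) ≡ (η m ◂ (λ v → η (suc m ℕ.+ v))) u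
    e zero    = cong η (ℕ.+-identityʳ m)
    e (suc u) = cong η (ℕ.+-suc m u)

  ∏ₗ : List Ideal → Ideal
  ∏ₗ = foldr _∥ₗ_ (val 1#)

  implements-∏ : ∀ {η} {a} {A : Set a} {f : A → Term} {g : A → Ideal} xs →
    (∀ {x} → x ∈ xs → Implements η (f x) (g x)) → Implements η (∏ (map f xs)) (∏ₗ (map g xs))
  implements-∏ []       i = val
  implements-∏ (x ∷ xs) i = par (i (here refl)) (implements-∏ xs (i ∘ there))

  flat-∏ : ∀ {a} {A : Set a} (g : A → Ideal) xs → (∀ x → Flat (g x)) → Flat (∏ₗ (map g xs))
  flat-∏ g []       f = tt
  flat-∏ g (x ∷ xs) f = f x , flat-∏ g xs f

  wires-∏ : ∀ {a} {A : Set a} (g : A → Ideal) xs → (∀ x → Wires (g x)) → Wires (∏ₗ (map g xs))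
  wires-∏ g []       f = tt
  wires-∏ g (x ∷ xs) f = f x , wires-∏ g xs f

  -- The idealised form of a trace and its implementation

  module IdealTrace (T : Trace) where
    open Trace T
    open TraceProperties T
    module Impl = Implementation T

    shared : Name ⊎ Fin size → Shared
    shared (inj₁ u) = free u
    shared (inj₂ a) = object (toℕ a)

    eventOf : Fin size → Action
    eventOf a = event (shared (subj a)) (pol a) (toℕ a)

    xOf yOf : Fin size → Fin size → Polarity → Action
    xOf a b ε = wire (wx (toℕ a) (toℕ b)) ε
    yOf a b ε = wire (wy (toℕ a) (toℕ b)) ε

    chain : List (Fin size) → Fin size → Ideal → Ideal
    chain bs a l = foldr (λ b → pre (xOf b a Sign.+)) (pre (eventOf a) l) bs

    signal : Fin size → Fin size → Ideal
    signal a e = pre (yOf a e Sign.-) (val 1#)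

    refusal : Fin size → Polarity → Ideal
    refusal a ε = off (object (toℕ a)) ε

    Subtrees : Fin size → Set
    Subtrees a = ∀ {e} → a < e → Acc (flip _<_) e

    tree    : ∀ a → Acc (flip _<_) a → Ideal
    subtree : ∀ a → Subtrees a → (∃ λ e → subj e ≡ inj₂ a) → Ideal

    body : ∀ a → Subtrees a → Ideal
    body a rs = ∏ₗ (map (signal a) (above a)) ∥ₗ ∏ₗ (map (subtree a rs) (children a)) ∥ₗ ∏ₗ (map (refusal a) (N-at a))

    tree a (acc rs) = chain (below a) a (body a rs)

    subtree a rs (e , eq) = tree e (rs (subj-< eq))

    rootTree : Fin size × Name → Ideal
    rootTree (a , _) = tree a (>-wellFounded a)

    relayₗ : Fin size × Fin size → Ideal
    relayₗ (a , b) = pre (yOf a b Sign.+) (pre (xOf a b Sign.-) (val 1#))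

    forest relays refusals traceₗ : Ideal
    forest   = ∏ₗ (map rootTree roots)
    relays   = ∏ₗ (map relayₗ <-pairs)
    refusals = ∏ₗ (map (λ (ε , u) → off (free u) ε) N-free)
    traceₗ   = (forest ⊗ relays) ∥ₗ refusals

    WiresAt : ℕ → Env → Set
    WiresAt d η = ∀ a b → η (Impl.x d a b) ≡ just (inj₂ (wx (toℕ a) (toℕ b))) ×
                          η (Impl.y d a b) ≡ just (inj₂ (wy (toℕ a) (toℕ b)))

    implements-tree : ∀ {d v a η} (rs : Acc (flip _<_) a) → WiresAt d η → η v ≡ just (inj₁ (shared (subj a))) →
      Implements η (Impl.A d v a rs) (tree a rs)
    implements-tree {d} {v} {a} {η} (acc rs) ws p = prefixes (below a)
      where
      bodyₜ = ∏ (map (λ e → lin₀ (Impl.y (suc d) a e) Sign.- (const 1#)) (above a))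
             ∥ ∏ (map (λ (e , se≡a) → Impl.A (suc d) 0 e (rs (subj-< se≡a))) (children a))
             ∥ ∏ (map (λ ε → act₀ 0 ε (const 0#)) (N-at a))
      η′ = just (inj₁ (object (toℕ a))) ◂ η
      implements-body : Implements η′ bodyₜ (body a rs)
      implements-body = par
        (implements-∏ (above a) λ {e} _ → implements-lin₀ {α = yOf a e Sign.-} (proj₂ (ws a e)) val)
        (par
          (implements-∏ (children a) λ {(e , eq)} _ →
            -- `ws` serves again one binder deeper, because a successor index in the extended
            -- environment reduces to the old index in the old one.
            implements-tree (rs (subj-< eq)) ws (cong (just ∘ inj₁ ∘ shared) (≡.sym eq)))
          (implements-∏ (N-at a) λ _ → off refl))
      prefixes : ∀ bs → Implements η
        (foldr (λ b P → lin₀ (Impl.x d b a) Sign.+ P) (lin v (pol a) bodyₜ) bs) (chain bs a (body a rs))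
      prefixes []       = implements-lin {α = eventOf a} p implements-body
      prefixes (b ∷ bs) = implements-lin₀ {α = xOf b a Sign.+} (proj₁ (ws b a)) (prefixes bs)

    flat-tree : ∀ a rs → Flat (tree a rs)
    flat-tree a (acc rs) = prefixes (below a)
      where
      prefixes : ∀ bs → Flat (chain bs a (body a rs))
      prefixes []       = flat-∏ (signal a) (above a) (λ _ → tt) ,
        flat-∏ (subtree a rs) (children a) (λ (e , eq) → flat-tree e (rs (subj-< eq))) , flat-∏ (refusal a) (N-at a) (λ _ → tt)
      prefixes (b ∷ bs) = prefixes bs

    implements-trace : Implements freeEnv ⦅ T ⦆ traceₗ
    implements-trace = par
      (implements-cong wireEnv-free (implements-ν^ #xy wireEnv-notShared
        (ten (implements-∏ roots λ {(a , u)} p →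
                implements-tree (>-wellFounded a) (λ a b → wireEnv-x a b , wireEnv-y a b)
                  (≡.trans (wireEnv-free u) (cong (just ∘ inj₁ ∘ shared) (≡.sym (∈-roots⁻ p)))))
             (implements-∏ <-pairs λ {(a , b)} _ →
                implements-lin₀ {α = yOf a b Sign.+} (wireEnv-y a b)
                  (implements-lin₀ {α = xOf a b Sign.-} (wireEnv-x a b) val))
             (flat-∏ rootTree roots λ (a , _) → flat-tree a (>-wellFounded a))
             (wires-∏ relayₗ <-pairs λ _ → tt)
             wireEnv-privateInjective)))
      (implements-∏ N-free λ _ → off refl)
      where open WireEnv size

  -- Counting actions and offers in the forest of a trace

  weight : (Item → ℕ) → Ideal → ℕ
  weight f (val k)   = 0
  weight f (off s ε) = f (inj₂ (s , ε))
  weight f (pre α l) = f (inj₁ α) ℕ.+ weight f l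
  weight f (l ∥ₗ m)  = weight f l ℕ.+ weight f m
  weight f (l ⊗ m)   = weight f l ℕ.+ weight f m
  weight f (l ⊕ₗ m)  = weight f l ℕ.+ weight f m

  weight-∏ : ∀ f {a} {A : Set a} (g : A → Ideal) xs → weight f (∏ₗ (map g xs)) ≡ sum (map (weight f ∘ g) xs)
  weight-∏ f g []       = refl
  weight-∏ f g (x ∷ xs) = cong (weight f (g x) ℕ.+_) (weight-∏ f g xs)

  -- Items under prefixes are counted too, so a step removes one occurrence of its action and merely
  -- brings others to the surface.
  weight-step : ∀ f {l α l′} → l —⟨ α ⟩→ l′ → weight f l ≡ f (inj₁ α) ℕ.+ weight f l′
  weight-step f pre            = refl
  weight-step f (∥ˡ {m = m} d) rewrite weight-step f d = ℕ.+-assoc (f _) _ (weight f m)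
  weight-step f (∥ʳ {l = l} {m′ = m′} d) rewrite weight-step f d = x∙yz≈y∙xz (weight f l) (f _) (weight f m′)
  weight-step f (⊗ˡ {m = m} d) rewrite weight-step f d = ℕ.+-assoc (f _) _ (weight f m)
  weight-step f (⊗ʳ {l = l} {m′ = m′} d) rewrite weight-step f d = x∙yz≈y∙xz (weight f l) (f _) (weight f m′)

  module _ (T : Trace) where
    open Trace T
    open TraceProperties T
    open IdealTrace T

    -- The part of the tree of `a` outside its subtrees: signals received, the event, signals sent,
    -- refusals.
    own : (Item → ℕ) → Fin size → ℕ
    own f a = sum (map (λ b → f (inj₁ (xOf b a Sign.+))) (below a)) ℕ.+ (f (inj₁ (eventOf a)) ℕ.+
      (sum (map (λ e → f (inj₁ (yOf a e Sign.-))) (above a)) ℕ.+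
       sum (map (λ ε → f (inj₂ (object (toℕ a) , ε))) (N-at a))))

    weight-tree : ∀ f a rs → weight f (tree a rs) ≡ treeSum (own f) a rs
    weight-tree f a (acc rs) = begin
      weight f (tree a (acc rs)) ≡⟨ prefixes (below a) ⟩
      X ℕ.+ (E ℕ.+ (weight f (∏ₗ (map (signal a) (above a))) ℕ.+ (weight f (∏ₗ (map (subtree a rs) (children a))) ℕ.+
        weight f (∏ₗ (map (refusal a) (N-at a))))))
        ≡⟨ cong (λ k → X ℕ.+ (E ℕ.+ k)) (cong₂ ℕ._+_
             (≡.trans (weight-∏ f (signal a) (above a)) (cong sum (map-cong (λ e → ℕ.+-identityʳ _) (above a))))
             (cong₂ ℕ._+_
               (≡.trans (weight-∏ f (subtree a rs) (children a)) (cong sum (map-cong (λ (e , eq) → weight-tree f e (rs (subj-< eq))) (children a))))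
               (weight-∏ f (refusal a) (N-at a)))) ⟩
      X ℕ.+ (E ℕ.+ (Y ℕ.+ (C ℕ.+ O))) ≡⟨ rearrange X E Y C O ⟩
      (X ℕ.+ (E ℕ.+ (Y ℕ.+ O))) ℕ.+ C ∎
      where
      open ≡.≡-Reasoning
      X = sum (map (λ b → f (inj₁ (xOf b a Sign.+))) (below a))
      E = f (inj₁ (eventOf a))
      Y = sum (map (λ e → f (inj₁ (yOf a e Sign.-))) (above a))
      O = sum (map (λ ε → f (inj₂ (object (toℕ a) , ε))) (N-at a))
      C = sum (map (λ (e , eq) → treeSum (own f) e (rs (subj-< eq))) (children a))
      prefixes : ∀ {l} bs → weight f (chain bs a l) ≡
        sum (map (λ b → f (inj₁ (xOf b a Sign.+))) bs) ℕ.+ (E ℕ.+ weight f l)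
      prefixes []       = refl
      prefixes (b ∷ bs) = ≡.trans (cong (f _ ℕ.+_) (prefixes bs)) (≡.sym (ℕ.+-assoc (f _) _ _))
      rearrange : ∀ X E Y C O → X ℕ.+ (E ℕ.+ (Y ℕ.+ (C ℕ.+ O))) ≡ (X ℕ.+ (E ℕ.+ (Y ℕ.+ O))) ℕ.+ C
      rearrange = solve 5 (λ X E Y C O → X :+ (E :+ (Y :+ (C :+ O))) := (X :+ (E :+ (Y :+ O))) :+ C) refl
        where open +-*-Solver

    weight-forest : ∀ f {e} → (∀ a → a ≢ e → own f a ≡ 0) → weight f forest ≡ own f e
    weight-forest f sup = ≡.trans (weight-∏ f rootTree roots)
      (≡.trans (cong sum (map-cong (λ (a , _) → weight-tree f a (>-wellFounded a)) roots)) (forestSum-single (own f) sup))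

  -- Executions of totally ordered traces

  data Component : Ideal → Ideal → Set c where
    here : ∀ {l} → Component l l
    ∥ˡ   : ∀ {l m d} → Component l d → Component (l ∥ₗ m) d
    ∥ʳ   : ∀ {l m d} → Component m d → Component (l ∥ₗ m) d

  -- `opens` exposes what the consumed prefix guarded. For `keeps` it suffices that the actions
  -- differ, since a prefix with another action is not the one consumed.
  record ComponentStep (l : Ideal) (α : Action) (k : Ideal) : Set c where
    field
      {target} : Ideal
      steps    : l —⟨ α ⟩→ target
      opens    : ∀ {d} → Component k d → Component target d
      keeps    : ∀ {β k′} → β ≢ α → Component l (pre β k′) → Component target (pre β k′)

  component-step : ∀ {l α k} → Component l (pre α k) → ComponentStep l α k
  component-step here = record { steps = pre ; opens = id ; keeps = λ { β≢α here → contradiction refl β≢α } }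
  component-step (∥ˡ p) = let open ComponentStep (component-step p) in record
    { steps = ∥ˡ steps ; opens = ∥ˡ ∘ opens ; keeps = λ { β≢α (∥ˡ q) → ∥ˡ (keeps β≢α q) ; β≢α (∥ʳ q) → ∥ʳ q } }
  component-step (∥ʳ p) = let open ComponentStep (component-step p) in record
    { steps = ∥ʳ steps ; opens = ∥ʳ ∘ opens ; keeps = λ { β≢α (∥ˡ q) → ∥ˡ q ; β≢α (∥ʳ q) → ∥ʳ (keeps β≢α q) } }

  component-∏ : ∀ {a} {A : Set a} (g : A → Ideal) {x xs} → x ∈ xs → Component (∏ₗ (map g xs)) (g x)
  component-∏ g (here refl) = ∥ˡ here
  component-∏ g (there p)   = ∥ʳ (component-∏ g p)

  module TotallyOrdered (T : Trace)
    (<⇒ : ∀ {a b} → Trace._<_ T a b → toℕ a ℕ.< toℕ b)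
    (<⇐ : ∀ {a b} → toℕ a ℕ.< toℕ b → Trace._<_ T a b) where

    open Trace T
    open TraceProperties T
    open IdealTrace T

    eventFact : Fin size → Fact
    eventFact a = inj₂ (toℕ a)

    xFact yFact : Fin size → Fin size → Fact
    xFact a b = inj₁ (wx (toℕ a) (toℕ b))
    yFact a b = inj₁ (wy (toℕ a) (toℕ b))

    Refused : Shared → Polarity → Set
    Refused s ε = ∃ λ x → (ε , x) ∈ N × s ≡ shared x

    data ForestGuard (K : List Fact) : Action → Set where
      onEvent : ∀ a → (∀ {b} → b < a → xFact b a ∈ K) → ForestGuard K (eventOf a)
      onX     : ∀ {a b} → a < b → ForestGuard K (xOf a b Sign.+)
      onY     : ∀ {a b} → a < b → eventFact a ∈ K → ForestGuard K (yOf a b Sign.-)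

    -- The wire is given up to an equation so that the guards of both partners of a synchronisation
    -- can be analysed on a common `p`.
    data RelayGuard (K : List Fact) : Action → Set where
      onX : ∀ {a b p} → p ≡ wx (toℕ a) (toℕ b) → a < b → yFact a b ∈ K → RelayGuard K (wire p Sign.-)
      onY : ∀ {a b p} → p ≡ wy (toℕ a) (toℕ b) → a < b → RelayGuard K (wire p Sign.+)

    -- Guarded G K l: every prefix of l satisfies its guard when the facts of K
    -- and those of the enclosing prefixes hold.
    data Guarded (G : List Fact → Action → Set) : List Fact → Ideal → Set c where
      val : ∀ {K} → Guarded G K (val 1#)
      off : ∀ {K s ε} → Refused s ε → Guarded G K (off s ε)
      pre : ∀ {K α l} → G K α → Guarded G (factOf α ∷ K) l → Guarded G K (pre α l)
      par : ∀ {K l m} → Guarded G K l → Guarded G K m → Guarded G K (l ∥ₗ m)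

    Monotone : (List Fact → Action → Set) → Set
    Monotone G = ∀ {K K′ α} → K ⊆ K′ → G K α → G K′ α

    forestGuard-mono : Monotone ForestGuard
    forestGuard-mono i (onEvent a p) = onEvent a (i ∘ p)
    forestGuard-mono i (onX p)       = onX p
    forestGuard-mono i (onY p q)     = onY p (i q)

    relayGuard-mono : Monotone RelayGuard
    relayGuard-mono i (onX e p q) = onX e p (i q)
    relayGuard-mono i (onY e p)   = onY e p

    guarded-mono : ∀ {G K K′ l} → Monotone G → K ⊆ K′ → Guarded G K l → Guarded G K′ l
    guarded-mono m i val       = val
    guarded-mono m i (off r)   = off r
    guarded-mono m i (pre g w) = pre (m i g) (guarded-mono m (∷⁺ʳ _ i) w)
    guarded-mono m i (par v w) = par (guarded-mono m i v) (guarded-mono m i w)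

    guarded-step : ∀ {G K l α l′} → Monotone G → Guarded G K l → l —⟨ α ⟩→ l′ →
      G K α × Guarded G (factOf α ∷ K) l′
    guarded-step m (pre g w) pre    = g , w
    guarded-step m (par v w) (∥ˡ d) = let g , v′ = guarded-step m v d in g , par v′ (guarded-mono m there w)
    guarded-step m (par v w) (∥ʳ d) = let g , w′ = guarded-step m w d in g , par (guarded-mono m there v) w′

    guarded-offers : ∀ {G K l s ε} → Guarded G K l → Offers s ε l → Refused s ε
    guarded-offers (off r)   off    = r
    guarded-offers (par v w) (∥ˡ o) = guarded-offers v o
    guarded-offers (par v w) (∥ʳ o) = guarded-offers w o

    guarded-∏ : ∀ {G K} {a} {A : Set a} {g : A → Ideal} xs → (∀ {x} → x ∈ xs → Guarded G K (g x)) →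
      Guarded G K (∏ₗ (map g xs))
    guarded-∏ []       w = val
    guarded-∏ (x ∷ xs) w = par (w (here refl)) (guarded-∏ xs (w ∘ there))

    guarded-tree : ∀ {K} a rs → Guarded ForestGuard K (tree a rs)
    guarded-tree {K} a (acc rs) = prefixes (below a) ∈-below⁻ (λ b<a → inj₁ (∈-below⁺ b<a))
      where
      guarded-body : ∀ {K} → eventFact a ∈ K → Guarded ForestGuard K (body a rs)
      guarded-body p = par (guarded-∏ (above a) λ q → pre (onY (∈-above⁻ q) p) val)
        (par (guarded-∏ (children a) λ {(e , eq)} _ → guarded-tree e (rs (subj-< eq)))
             (guarded-∏ (N-at a) λ q → off (inj₂ a , ∈-N-at⁻ q , refl)))
      prefixes : ∀ {K} bs → (∀ {b} → b ∈ bs → b < a) → (∀ {b} → b < a → b ∈ bs ⊎ xFact b a ∈ K) →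
        Guarded ForestGuard K (chain bs a (body a rs))
      prefixes []       p q = pre (onEvent a (λ b<a → [ (λ ()) , id ]′ (q b<a))) (guarded-body (here refl))
      prefixes (b ∷ bs) p q = pre (onX (p (here refl))) (prefixes bs (p ∘ there)
        (λ b<a → [ (λ { (here refl) → inj₂ (here refl) ; (there r) → inj₁ r }) , inj₂ ∘ there ]′ (q b<a)))

    guarded-forest : Guarded ForestGuard [] forest
    guarded-forest = guarded-∏ roots λ {(a , _)} _ → guarded-tree a (>-wellFounded a)

    ∈-<-pairs⁻ : ∀ {a b} → (a , b) ∈ <-pairs → a < b
    ∈-<-pairs⁻ {a} {b} p = proj₂ (∈-filter⁻ (uncurry _<?_) {v = a , b} {xs = cartesianProduct events events} p)

    ∈-<-pairs⁺ : ∀ {a b} → a < b → (a , b) ∈ <-pairs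
    ∈-<-pairs⁺ {a} {b} p = ∈-filter⁺ (uncurry _<?_) (∈-cartesianProduct⁺ (∈-allFin a) (∈-allFin b)) p

    guarded-relays : Guarded RelayGuard [] relays
    guarded-relays = guarded-∏ <-pairs λ {(a , b)} p →
      pre (onY refl (∈-<-pairs⁻ p)) (pre (onX refl (∈-<-pairs⁻ p) (here refl)) val)

    <-pairs-unique : Unique <-pairs
    <-pairs-unique = filter⁺ (uncurry _<?_) (cartesianProduct⁺ (allFin⁺ size) (allFin⁺ size))

    data Slot : Set where
      eventSlot : Fin size → Slot
      xSlot ySlot : ∀ a b → a < b → Slot

    slotFact : Slot → Fact
    slotFact (eventSlot a) = eventFact a
    slotFact (xSlot a b _) = xFact a b
    slotFact (ySlot a b _) = yFact a b

    data WireSlot : Slot → Set where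
      xSlot : ∀ {a b} (p : a < b) → WireSlot (xSlot a b p)
      ySlot : ∀ {a b} (p : a < b) → WireSlot (ySlot a b p)

    -- For a wire, these are its two ends. Relays perform no events, so occurrences of `relayAction`
    -- are counted for `WireSlot` only.
    forestAction relayAction : Slot → Action
    forestAction (eventSlot a) = eventOf a
    forestAction (xSlot a b _) = xOf a b Sign.+
    forestAction (ySlot a b _) = yOf a b Sign.-
    relayAction (eventSlot a) = eventOf a
    relayAction (xSlot a b _) = xOf a b Sign.-
    relayAction (ySlot a b _) = yOf a b Sign.+

    forestAction-fact : ∀ s → factOf (forestAction s) ≡ slotFact s
    forestAction-fact (eventSlot a) = refl
    forestAction-fact (xSlot a b _) = refl
    forestAction-fact (ySlot a b _) = refl

    relayAction-fact : ∀ s → factOf (relayAction s) ≡ slotFact s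
    relayAction-fact (eventSlot a) = refl
    relayAction-fact (xSlot a b _) = refl
    relayAction-fact (ySlot a b _) = refl

    forestGuard-slot : ∀ {K α} → ForestGuard K α → ∃ λ s → α ≡ forestAction s
    forestGuard-slot (onEvent a _) = eventSlot a , refl
    forestGuard-slot (onX p)       = xSlot _ _ p , refl
    forestGuard-slot (onY p _)     = ySlot _ _ p , refl

    relayGuard-slot : ∀ {K α} → RelayGuard K α → ∃ λ s → WireSlot s × α ≡ relayAction s
    relayGuard-slot (onX refl p _) = xSlot _ _ p , xSlot p , refl
    relayGuard-slot (onY refl p)   = ySlot _ _ p , ySlot p , refl

    xFact-injective : ∀ {a b a′ b′} → wx (toℕ {size} a) (toℕ {size} b) ≡ wx (toℕ a′) (toℕ b′) → a ≡ a′ × b ≡ b′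
    xFact-injective eq = Fin.toℕ-injective (cong (λ { (wx i j) → i ; (wy i j) → i }) eq) ,
                         Fin.toℕ-injective (cong (λ { (wx i j) → j ; (wy i j) → j }) eq)

    yFact-injective : ∀ {a b a′ b′} → wy (toℕ {size} a) (toℕ {size} b) ≡ wy (toℕ a′) (toℕ b′) → a ≡ a′ × b ≡ b′
    yFact-injective eq = Fin.toℕ-injective (cong (λ { (wx i j) → i ; (wy i j) → i }) eq) ,
                         Fin.toℕ-injective (cong (λ { (wx i j) → j ; (wy i j) → j }) eq)

    slotFact-forestAction : ∀ s t → slotFact s ≡ slotFact t → forestAction s ≡ forestAction t
    slotFact-forestAction (eventSlot a) (eventSlot b) eq with Fin.toℕ-injective (Sum.inj₂-injective eq)
    ... | refl = refl
    slotFact-forestAction (xSlot a b _) (xSlot c d _) eq = cong (λ p → wire p Sign.+) (Sum.inj₁-injective eq)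
    slotFact-forestAction (ySlot a b _) (ySlot c d _) eq = cong (λ p → wire p Sign.-) (Sum.inj₁-injective eq)

    slotFact-relayAction : ∀ s t → slotFact s ≡ slotFact t → relayAction s ≡ relayAction t
    slotFact-relayAction (eventSlot a) (eventSlot b) eq with Fin.toℕ-injective (Sum.inj₂-injective eq)
    ... | refl = refl
    slotFact-relayAction (xSlot a b _) (xSlot c d _) eq = cong (λ p → wire p Sign.-) (Sum.inj₁-injective eq)
    slotFact-relayAction (ySlot a b _) (ySlot c d _) eq = cong (λ p → wire p Sign.+) (Sum.inj₁-injective eq)

    occurrences : Action → Ideal → ℕ
    occurrences α = weight (indicator (inj₁ α))

    occurrences-step : ∀ {l l′ α} → l —⟨ α ⟩→ l′ → occurrences α l ≡ suc (occurrences α l′)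
    occurrences-step {l′ = l′} {α} d = ≡.trans (weight-step _ d)
      (cong (ℕ._+ occurrences α l′) (indicator-≡ (inj₁ α)))

    occurrences-other : ∀ {l l′ α β} → l —⟨ α ⟩→ l′ → α ≢ β → occurrences β l ≡ occurrences β l′
    occurrences-other {l′ = l′} {α} {β} d α≢β = ≡.trans (weight-step _ d)
      (cong (ℕ._+ occurrences β l′) (indicator-≢ (inj₁ β) (α≢β ∘ Sum.inj₁-injective)))

    count-step : ∀ {K f n m} → Count K f n → n ≡ suc m → Count (f ∷ K) f m
    count-step (inj₂ (_ , refl)) refl = inj₁ (here refl , refl)

    -- By hypothesis an action with the fact of `α` is `α`, whose single occurrence is spent just
    -- when the fact becomes known. All other counts are untouched.
    count-update : ∀ {K l l′ α β} → l —⟨ α ⟩→ l′ → (factOf β ≡ factOf α → β ≡ α) →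
      Count K (factOf β) (occurrences β l) → Count (factOf α ∷ K) (factOf β) (occurrences β l′)
    count-update {K} {l′ = l′} {α} {β} d inj k with factOf β ≟ᶠ factOf α
    ... | yes p with inj p
    ...   | refl = count-step k (occurrences-step d)
    count-update {K} {l′ = l′} {α} {β} d inj k | no ¬p =
      subst (Count (factOf α ∷ K) (factOf β)) (occurrences-other d (λ { refl → ¬p refl })) (count-weaken ¬p k)

    -- `i` events have occurred, those with numbers below `i`, and `K` collects the facts so far.
    -- The implications trace a signal back from `x` to `y` to its source event, and an event to all
    -- signals it awaited. The counts say that an action is present until its fact holds. Refusals
    -- are consumed by no ideal step.
    record Invariant (i : ℕ) (K : List Fact) (l m : Ideal) : Set c where
      field
        i≤size       : i ℕ.≤ size
        guarded-l    : Guarded ForestGuard K l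
        guarded-m    : Guarded RelayGuard K m
        x⇒y          : ∀ {a b} → xFact a b ∈ K → yFact a b ∈ K
        y⇒event      : ∀ {a b} → yFact a b ∈ K → eventFact a ∈ K
        event⇒x      : ∀ {a b} → eventFact a ∈ K → b < a → xFact b a ∈ K
        fired⇒<      : ∀ {a} → eventFact a ∈ K → toℕ a ℕ.< i
        <⇒fired      : ∀ {a} → toℕ a ℕ.< i → eventFact a ∈ K
        count-l      : ∀ s → Count K (slotFact s) (occurrences (forestAction s) l)
        count-m      : ∀ {s} → WireSlot s → Count K (slotFact s) (occurrences (relayAction s) m)
        refused-l    : ∀ {a ε} → (ε , inj₂ a) ∈ N → 1 ℕ.≤ weight (indicator (inj₂ (object (toℕ a) , ε))) l

    refused-step : ∀ {l l′ α x} → l —⟨ α ⟩→ l′ → 1 ℕ.≤ weight (indicator (inj₂ x)) l → 1 ℕ.≤ weight (indicator (inj₂ x)) l′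
    refused-step {l′ = l′} {α} {x} d p = subst (1 ℕ.≤_) (≡.trans (weight-step _ d)
      (cong (ℕ._+ weight (indicator (inj₂ x)) l′) (indicator-≢ (inj₂ x) {inj₁ α} λ ()))) p

    count-l-step : ∀ {i K l m l′ α} → Invariant i K l m → ForestGuard K α → l —⟨ α ⟩→ l′ →
      ∀ s → Count (factOf α ∷ K) (slotFact s) (occurrences (forestAction s) l′)
    count-l-step {K = K} {l} {l′ = l′} {α} inv g d s with forestGuard-slot g
    ... | t , refl = subst (λ f → Count (factOf α ∷ K) f (occurrences (forestAction s) l′)) (forestAction-fact s)
      (count-update d (λ p → slotFact-forestAction s t
          (≡.trans (≡.sym (forestAction-fact s)) (≡.trans p (forestAction-fact t))))
        (subst (λ f → Count K f (occurrences (forestAction s) l)) (≡.sym (forestAction-fact s)) (Invariant.count-l inv s)))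

    count-m-step : ∀ {i K l m m′ α} → Invariant i K l m → RelayGuard K α → m —⟨ α ⟩→ m′ →
      ∀ {s} → WireSlot s → Count (factOf α ∷ K) (slotFact s) (occurrences (relayAction s) m′)
    count-m-step {K = K} {m = m} {m′} {α} inv g d {s} ws with relayGuard-slot g
    ... | t , _ , refl = subst (λ f → Count (factOf α ∷ K) f (occurrences (relayAction s) m′)) (relayAction-fact s)
      (count-update d (λ p → slotFact-relayAction s t
          (≡.trans (≡.sym (relayAction-fact s)) (≡.trans p (relayAction-fact t))))
        (subst (λ f → Count K f (occurrences (relayAction s) m)) (≡.sym (relayAction-fact s)) (Invariant.count-m inv ws)))

    -- A new `x` fact is justified by the guard of the relay, a new `y` fact by the guard of the
    -- forest; polarities exclude the mixed cases.
    invariant-sync : ∀ {i K l m l′ m′ p ε} → Invariant i K l m →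
      l —⟨ wire p ε ⟩→ l′ → m —⟨ wire p (opposite ε) ⟩→ m′ → Invariant i (inj₁ p ∷ K) l′ m′
    invariant-sync {K = K} {l′ = l′} {m′} inv d e
      with guarded-step forestGuard-mono (Invariant.guarded-l inv) d | guarded-step relayGuard-mono (Invariant.guarded-m inv) e
    ... | g@(onX {a} {b} a<b) , v | h@(onX eq a<b′ y∈K) , w with xFact-injective eq
    ...   | refl , refl = record
      { i≤size = i≤size ; guarded-l = v ; guarded-m = w
      ; x⇒y = λ { (here p) → let eq = xFact-injective (Sum.inj₁-injective p) in
                   there (subst₂ (λ a b → yFact a b ∈ K) (≡.sym (proj₁ eq)) (≡.sym (proj₂ eq)) y∈K)
                ; (there p) → there (x⇒y p) }
      ; y⇒event = λ { (there p) → there (y⇒event p) }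
      ; event⇒x = λ { (there p) q → there (event⇒x p q) }
      ; fired⇒< = λ { (there p) → fired⇒< p }
      ; <⇒fired = there ∘ <⇒fired
      ; count-l = count-l-step inv g d ; count-m = count-m-step inv h e
      ; refused-l = refused-step d ∘ refused-l }
      where open Invariant inv
    invariant-sync {K = K} {l′ = l′} {m′} inv d e | g@(onY {a} {b} a<b a∈K) , v | h@(onY eq a<b′) , w with yFact-injective eq
    ...   | refl , refl = record
      { i≤size = i≤size ; guarded-l = v ; guarded-m = w
      ; x⇒y = λ { (there p) → there (x⇒y p) }
      ; y⇒event = λ { (here p) → there (subst (λ a → eventFact a ∈ K)
                        (≡.sym (proj₁ (yFact-injective (Sum.inj₁-injective p)))) a∈K)
                    ; (there p) → there (y⇒event p) }
      ; event⇒x = λ { (there p) q → there (event⇒x p q) }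
      ; fired⇒< = λ { (there p) → fired⇒< p }
      ; <⇒fired = there ∘ <⇒fired
      ; count-l = count-l-step inv g d ; count-m = count-m-step inv h e
      ; refused-l = refused-step d ∘ refused-l }
      where open Invariant inv

    -- An event numbered below `i` has no occurrence left. One above `i` would, by totality of the
    -- order, have received a signal from event `i`; tracing it back through `x` and `y` shows that
    -- event `i` had occurred, which it has not.
    invariant-event : ∀ {i K l m l′ s ε k} → Invariant i K l m → l —⟨ event s ε k ⟩→ l′ →
      ∃ λ a → toℕ a ≡ i × event s ε k ≡ eventOf a × Invariant (suc i) (inj₂ k ∷ K) l′ m
    invariant-event {i} {K} {l} {m} {l′} inv d with guarded-step forestGuard-mono (Invariant.guarded-l inv) d
    ... | g@(onEvent a xs) , v = a , a≡i , refl , record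
      { i≤size = subst (ℕ._≤ size) (cong suc a≡i) (Fin.toℕ<n a)
      ; guarded-l = v ; guarded-m = guarded-mono relayGuard-mono there guarded-m
      ; x⇒y = λ { (there p) → there (x⇒y p) }
      ; y⇒event = λ { (there p) → there (y⇒event p) }
      ; event⇒x = λ { (here p) q → there (enabled (Fin.toℕ-injective (Sum.inj₂-injective p)) q)
                    ; (there p) q → there (event⇒x p q) }
      ; fired⇒< = λ { (here p) → ℕ.≤-reflexive (cong suc (≡.trans (Sum.inj₂-injective p) a≡i))
                    ; (there p) → ℕ.m<n⇒m<1+n (fired⇒< p) }
      ; <⇒fired = λ {b} b<1+i → case-≤ b (ℕ.m≤n⇒m<n∨m≡n (ℕ.s≤s⁻¹ b<1+i))
      ; count-l = count-l-step inv g d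
      ; count-m = λ { w@(xSlot p) → count-weaken (λ ()) (count-m w) ; w@(ySlot p) → count-weaken (λ ()) (count-m w) }
      ; refused-l = refused-step d ∘ refused-l }
      where
      open Invariant inv
      enabled : ∀ {a′ b} → a′ ≡ a → b < a′ → xFact b a′ ∈ K
      enabled refl q = xs q
      unfired : eventFact a ∉ K
      unfired p = contradiction (≡.trans (≡.sym (occurrences-step d)) (count-∈ (count-l (eventSlot a)) p)) λ ()
      earlier-fired : ∀ b → toℕ b ℕ.< toℕ a → toℕ b ℕ.< i
      earlier-fired b b<a = fired⇒< (y⇒event (x⇒y (xs (<⇐ b<a))))
      a≡i : toℕ a ≡ i
      a≡i with ℕ.<-cmp (toℕ a) i
      ... | tri< a<i _ _ = contradiction (<⇒fired a<i) unfired
      ... | tri≈ _ eq _  = eq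
      ... | tri> _ _ i<a = contradiction
        (earlier-fired (fromℕ< (ℕ.<-trans i<a (Fin.toℕ<n a))) (subst (ℕ._< toℕ a) (≡.sym (Fin.toℕ-fromℕ< _)) i<a))
        (ℕ.<-irrefl (Fin.toℕ-fromℕ< _))
      case-≤ : ∀ b → toℕ b ℕ.< i ⊎ toℕ b ≡ i → eventFact b ∈ eventFact a ∷ K
      case-≤ b (inj₁ p) = there (<⇒fired p)
      case-≤ b (inj₂ p) = here (cong inj₂ (≡.trans p (≡.sym a≡i)))

    -- Guards admit only actions of slots, so any prefix would be an occurrence; what remains are
    -- offers and constants 1.
    guarded-done : ∀ {K l} → Guarded ForestGuard K l → (∀ s → occurrences (forestAction s) l ≡ 0) →
      Done l × valueₗ l ≈ 1#
    guarded-done val     z = _ , ≈-refl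
    guarded-done (off r) z = _ , ≈-refl
    guarded-done {l = pre α l} (pre g w) z with forestGuard-slot g
    ... | s , refl = contradiction (≡.trans (≡.sym (occurrences-step {l = pre α l} pre)) (z s)) λ ()
    guarded-done {l = l ∥ₗ m} (par v w) z
      with guarded-done v (λ s → ℕ.m+n≡0⇒m≡0 (occurrences (forestAction s) l) (z s))
         | guarded-done w (λ s → ℕ.m+n≡0⇒n≡0 (occurrences (forestAction s) l) (z s))
    ... | f , p | g , q = (f , g) , ≈-trans (*-cong p q) (*-identityˡ _)

    guarded-done′ : ∀ {K l} → Guarded RelayGuard K l → (∀ {s} → WireSlot s → occurrences (relayAction s) l ≡ 0) →
      Done l × valueₗ l ≈ 1#
    guarded-done′ val     z = _ , ≈-refl
    guarded-done′ (off r) z = _ , ≈-refl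
    guarded-done′ {l = pre α l} (pre g w) z with relayGuard-slot g
    ... | s , ws , refl = contradiction (≡.trans (≡.sym (occurrences-step {l = pre α l} pre)) (z ws)) λ ()
    guarded-done′ {l = l ∥ₗ m} (par v w) z
      with guarded-done′ v (λ {s} ws → ℕ.m+n≡0⇒m≡0 (occurrences (relayAction s) l) (z ws))
         | guarded-done′ w (λ {s} ws → ℕ.m+n≡0⇒n≡0 (occurrences (relayAction s) l) (z ws))
    ... | f , p | g , q = (f , g) , ≈-trans (*-cong p q) (*-identityˡ _)

    invariant-final : ∀ {K l m} → Invariant size K l m → (Done l × valueₗ l ≈ 1#) × (Done m × valueₗ m ≈ 1#)
    invariant-final {K} inv = guarded-done guarded-l (λ s → count-∈ (count-l s) (known s)) ,
                          guarded-done′ guarded-m (λ {s} ws → count-∈ (count-m ws) (known s))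
      where
      open Invariant inv
      fired′ : ∀ a → eventFact a ∈ K
      fired′ a = <⇒fired (Fin.toℕ<n a)
      known : ∀ s → slotFact s ∈ K
      known (eventSlot a)     = fired′ a
      known (xSlot a b a<b)   = event⇒x (fired′ b) a<b
      known (ySlot a b a<b)   = x⇒y (event⇒x (fired′ b) a<b)

    done-offers : ∀ l {s ε} → Done l → 1 ℕ.≤ weight (indicator (inj₂ (s , ε))) l → Offers s ε l
    done-offers (off t δ) {s} {ε} _ p = go (inj₂ (t , δ) ≟ⁱ inj₂ (s , ε))
      where
      go : Dec (inj₂ (t , δ) ≡ inj₂ (s , ε)) → Offers s ε (off t δ)
      go (yes refl) = off
      go (no ne)    = contradiction (subst (1 ℕ.≤_) (indicator-≢ (inj₂ (s , ε)) ne) p) λ ()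
    done-offers (l ∥ₗ m) {s} {ε} (f , g) p with weight (indicator (inj₂ (s , ε))) l in eq
    ... | zero  = ∥ʳ (done-offers m g p)
    ... | suc _ = ∥ˡ (done-offers l f (subst (1 ℕ.≤_) (≡.sym eq) (s≤s z≤n)))
    done-offers (l ⊗ m) {s} {ε} (f , g) p with weight (indicator (inj₂ (s , ε))) l in eq
    ... | zero  = ⊗ʳ (done-offers m g p)
    ... | suc _ = ⊗ˡ (done-offers l f (subst (1 ℕ.≤_) (≡.sym eq) (s≤s z≤n)))

    done-occurrences : ∀ l {α} → Done l → occurrences α l ≡ 0
    done-occurrences (val k)   d       = refl
    done-occurrences (off s ε) d       = refl
    done-occurrences (l ∥ₗ m)  (d , e) = cong₂ ℕ._+_ (done-occurrences l d) (done-occurrences m e)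
    done-occurrences (l ⊗ m)   (d , e) = cong₂ ℕ._+_ (done-occurrences l d) (done-occurrences m e)

    -- Were `i` below `size`, event `i` would still occur as a prefix in `l`, and `Done` excludes
    -- prefixes.
    done⇒final : ∀ {i K l m} → Invariant i K l m → Done l → i ≡ size
    done⇒final {i} {K} {l} inv d with ℕ.m≤n⇒m<n∨m≡n (Invariant.i≤size inv)
    ... | inj₂ eq  = eq
    ... | inj₁ i<n = contradiction (≡.trans (≡.sym (done-occurrences l d)) (count-∉ (Invariant.count-l inv (eventSlot (fromℕ< i<n)))
      (λ p → ℕ.<-irrefl (Fin.toℕ-fromℕ< i<n) (Invariant.fired⇒< inv p)))) λ ()

    -- The event whose part of the forest contains the action of the slot: `x` is received by the
    -- later event, `y` is sent by the earlier one.
    owner : Slot → Fin size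
    owner (eventSlot a) = a
    owner (xSlot a b _) = b
    owner (ySlot a b _) = a

    own-x own-event own-y own-off : Slot → Fin size → ℕ
    own-x s a     = sum (map (λ b → indicator (inj₁ (forestAction s)) (inj₁ (xOf b a Sign.+))) (below a))
    own-event s a = indicator (inj₁ (forestAction s)) (inj₁ (eventOf a))
    own-y s a     = sum (map (λ e → indicator (inj₁ (forestAction s)) (inj₁ (yOf a e Sign.-))) (above a))
    own-off s a   = sum (map (λ ε → indicator (inj₁ (forestAction s)) (inj₂ (object (toℕ a) , ε))) (N-at a))

    private
      distinct : ∀ j i → i ≢ j → indicator (inj₁ j) (inj₁ i) ≡ 0
      distinct j i i≢j = indicator-≢ (inj₁ j) (i≢j ∘ Sum.inj₁-injective)

      own-x-zero : ∀ s a → (∀ b → xOf b a Sign.+ ≢ forestAction s) → own-x s a ≡ 0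
      own-x-zero s a p = sum-zero′ _ (below a) (λ b → distinct (forestAction s) (xOf b a Sign.+) (p b))

      own-y-zero : ∀ s a → (∀ e → yOf a e Sign.- ≢ forestAction s) → own-y s a ≡ 0
      own-y-zero s a p = sum-zero′ _ (above a) (λ e → distinct (forestAction s) (yOf a e Sign.-) (p e))

      own-off-zero : ∀ s a → own-off s a ≡ 0
      own-off-zero s a = sum-zero′ _ (N-at a) (λ ε → indicator-≢ (inj₁ (forestAction s)) {inj₂ (object (toℕ a) , ε)} λ ())

      sum₄ : ∀ {a b c d a′ b′ c′ d′} → a ≡ a′ → b ≡ b′ → c ≡ c′ → d ≡ d′ →
        a ℕ.+ (b ℕ.+ (c ℕ.+ d)) ≡ a′ ℕ.+ (b′ ℕ.+ (c′ ℕ.+ d′))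
      sum₄ refl refl refl refl = refl

      own-owner : ∀ s → own T (indicator (inj₁ (forestAction s))) (owner s) ≡ 1
      own-owner s@(eventSlot a) = sum₄ (own-x-zero s a λ b ()) (indicator-≡ (inj₁ (eventOf a))) (own-y-zero s a λ e ()) (own-off-zero s a)
      own-owner s@(xSlot a b p) = sum₄
        (≡.trans (sum-single _ (below-unique b) (∈-below⁺ p)
           (λ e e≢a → distinct (forestAction s) (xOf e b Sign.+) (e≢a ∘ proj₁ ∘ xFact-injective ∘ wire-injective)))
           (indicator-≡ (inj₁ (forestAction s))))
        (distinct (forestAction s) (eventOf b) λ ()) (own-y-zero s b λ e ()) (own-off-zero s b)
      own-owner s@(ySlot a b p) = sum₄ (own-x-zero s a λ b ()) (distinct (forestAction s) (eventOf a) λ ())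
        (≡.trans (sum-single _ (above-unique a) (∈-above⁺ p)
           (λ e e≢b → distinct (forestAction s) (yOf a e Sign.-) (e≢b ∘ proj₂ ∘ yFact-injective ∘ wire-injective)))
           (indicator-≡ (inj₁ (forestAction s))))
        (own-off-zero s a)

      own-other : ∀ s a → a ≢ owner s → own T (indicator (inj₁ (forestAction s))) a ≡ 0
      own-other s@(eventSlot e) a a≢e = sum₄ (own-x-zero s a λ b ())
        (distinct (forestAction s) (eventOf a) (a≢e ∘ Fin.toℕ-injective ∘ event-injective)) (own-y-zero s a λ e ()) (own-off-zero s a)
      own-other s@(xSlot e b p) a a≢b = sum₄
        (own-x-zero s a (λ e′ → a≢b ∘ proj₂ ∘ xFact-injective ∘ wire-injective))
        (distinct (forestAction s) (eventOf a) λ ()) (own-y-zero s a λ e ()) (own-off-zero s a)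
      own-other s@(ySlot e b p) a a≢e = sum₄ (own-x-zero s a λ b ()) (distinct (forestAction s) (eventOf a) λ ())
        (own-y-zero s a (λ e′ → a≢e ∘ proj₁ ∘ yFact-injective ∘ wire-injective)) (own-off-zero s a)

    forest-occurrences : ∀ s → occurrences (forestAction s) forest ≡ 1
    forest-occurrences s = ≡.trans (weight-forest T _ (own-other s)) (own-owner s)

    relays-occurrences : ∀ {s} → WireSlot s → occurrences (relayAction s) relays ≡ 1
    relays-occurrences (xSlot {a} {b} a<b) = ≡.trans (weight-∏ _ relayₗ <-pairs)
      (≡.trans (sum-single _ <-pairs-unique (∈-<-pairs⁺ a<b) other)
        (cong₂ (λ m n → m ℕ.+ (n ℕ.+ 0)) (distinct (xOf a b Sign.-) (yOf a b Sign.+) λ ()) (indicator-≡ (inj₁ (xOf a b Sign.-)))))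
      where
      other : ∀ x → x ≢ (a , b) → occurrences (xOf a b Sign.-) (relayₗ x) ≡ 0
      other (a′ , b′) ne = cong₂ (λ m n → m ℕ.+ (n ℕ.+ 0)) (distinct (xOf a b Sign.-) (yOf a′ b′ Sign.+) λ ())
        (distinct (xOf a b Sign.-) (xOf a′ b′ Sign.-) (ne ∘ uncurry (cong₂ _,_) ∘ xFact-injective ∘ wire-injective))
    relays-occurrences (ySlot {a} {b} a<b) = ≡.trans (weight-∏ _ relayₗ <-pairs)
      (≡.trans (sum-single _ <-pairs-unique (∈-<-pairs⁺ a<b) other)
        (cong₂ (λ m n → m ℕ.+ (n ℕ.+ 0)) (indicator-≡ (inj₁ (yOf a b Sign.+))) (distinct (yOf a b Sign.+) (xOf a b Sign.-) λ ())))
      where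
      other : ∀ x → x ≢ (a , b) → occurrences (yOf a b Sign.+) (relayₗ x) ≡ 0
      other (a′ , b′) ne = cong₂ (λ m n → m ℕ.+ (n ℕ.+ 0))
        (distinct (yOf a b Sign.+) (yOf a′ b′ Sign.+) (ne ∘ uncurry (cong₂ _,_) ∘ yFact-injective ∘ wire-injective))
        (distinct (yOf a b Sign.+) (xOf a′ b′ Sign.-) λ ())

    forest-refuses : ∀ {a ε} → (ε , inj₂ a) ∈ N → 1 ℕ.≤ weight (indicator (inj₂ (object (toℕ a) , ε))) forest
    forest-refuses {a} {ε} p = subst (1 ℕ.≤_) (≡.sym (weight-forest T _ other)) at
      where
      j : Item
      j = inj₂ (object (toℕ a) , ε)
      other : ∀ b → b ≢ a → own T (indicator j) b ≡ 0
      other b b≢a = sum₄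
        (sum-zero′ _ (below b) (λ e → indicator-≢ j {inj₁ (xOf e b Sign.+)} λ ())) (indicator-≢ j {inj₁ (eventOf b)} λ ())
        (sum-zero′ _ (above b) (λ e → indicator-≢ j {inj₁ (yOf b e Sign.-)} λ ()))
        (sum-zero′ _ (N-at b) (λ δ → indicator-≢ j {inj₂ (object (toℕ b) , δ)} (b≢a ∘ Fin.toℕ-injective ∘ object-injective)))
        where
        object-injective : ∀ {i k δ δ′} → _≡_ {A = Item} (inj₂ (object i , δ)) (inj₂ (object k , δ′)) → i ≡ k
        object-injective refl = refl
      at : 1 ℕ.≤ own T (indicator j) a
      at = begin
        1                                                      ≡⟨ indicator-≡ j ⟨
        indicator j j                                          ≤⟨ sum-∈′ (∈-N-at⁺ p) ⟩
        O                                                      ≤⟨ ℕ.m≤n+m O Y ⟩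
        Y ℕ.+ O                                                ≤⟨ ℕ.m≤n+m (Y ℕ.+ O) E ⟩
        E ℕ.+ (Y ℕ.+ O)                                        ≤⟨ ℕ.m≤n+m (E ℕ.+ (Y ℕ.+ O)) X ⟩
        own T (indicator j) a                                  ∎
        where
        open ℕ.≤-Reasoning
        X = sum (map (λ b → indicator j (inj₁ (xOf b a Sign.+))) (below a))
        E = indicator j (inj₁ (eventOf a))
        Y = sum (map (λ e → indicator j (inj₁ (yOf a e Sign.-))) (above a))
        f : Polarity → ℕ
        f δ = indicator j (inj₂ (object (toℕ a) , δ))
        O = sum (map f (N-at a))
        sum-∈′ : ∀ {δ} → δ ∈ N-at a → f δ ℕ.≤ O
        sum-∈′ q = sum-∈ f q

    invariant-initial : Invariant 0 [] forest relays
    invariant-initial = record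
      { i≤size = z≤n ; guarded-l = guarded-forest ; guarded-m = guarded-relays
      ; x⇒y = λ () ; y⇒event = λ () ; event⇒x = λ () ; fired⇒< = λ () ; <⇒fired = λ ()
      ; count-l = λ s → inj₂ ((λ ()) , forest-occurrences s)
      ; count-m = λ ws → inj₂ ((λ ()) , relays-occurrences ws)
      ; refused-l = forest-refuses }

    -- Complete executions of the forest with its relays, from the i-th event on.
    data Path : ℕ → Ideal → Ideal → Set c where
      done  : ∀ {l m} → Path size l m
      sync  : ∀ {i l m l′ m′ p ε} → l —⟨ wire p ε ⟩→ l′ → m —⟨ wire p (opposite ε) ⟩→ m′ →
              Path i l′ m′ → Path i l m
      event : ∀ {i l m l′} a → toℕ a ≡ i → l —⟨ eventOf a ⟩→ l′ → Path (suc i) l′ m → Path i l m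

    ParentBefore : ℕ → Fin size → Set
    ParentBefore i a = ∀ {p} → subj a ≡ inj₂ p → toℕ p ℕ.< i

    -- What the execution in numerical order can rely on before event `i`. Signals and relays are
    -- required only towards events from `i` on, since those towards earlier events have been used
    -- up; a tree surfaces once its parent has fired.
    record Live (i : ℕ) (l m : Ideal) : Set c where
      field
        live-tree   : ∀ a → i ℕ.≤ toℕ a → ParentBefore i a → ∃ λ rs → Component l (tree a rs)
        live-signal : ∀ {a e} → toℕ a ℕ.< i → i ℕ.≤ toℕ e → a < e → Component l (signal a e)
        live-relay  : ∀ {a b} → a < b → i ℕ.≤ toℕ b → Component m (relayₗ (a , b))

    -- The i-th event a₀ is being prepared and still waits for the events of bs.
    record Preparing (i : ℕ) (a₀ : Fin size) (rs : Subtrees a₀) (bs : List (Fin size)) (l m : Ideal) : Set c where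
      field
        unique  : Unique bs
        before  : ∀ {b} → b ∈ bs → b < a₀
        current : Component l (chain bs a₀ (body a₀ rs))
        tree-at : ∀ a → a ≢ a₀ → i ℕ.≤ toℕ a → ParentBefore i a → ∃ λ rs → Component l (tree a rs)
        signal-at : ∀ {a e} → toℕ a ℕ.< i → i ℕ.≤ toℕ e → a < e → (e ≡ a₀ → a ∈ bs) → Component l (signal a e)
        relay-at  : ∀ {a b} → a < b → i ℕ.≤ toℕ b → (b ≡ a₀ → a ∈ bs) → Component m (relayₗ (a , b))

    Keeps : Action → Ideal → Ideal → Set c
    Keeps α l l′ = ∀ {β k} → β ≢ α → Component l (pre β k) → Component l′ (pre β k)

    keeps-chain : ∀ {α l l′} bs {a k} → Keeps α l l′ → (∀ b → xOf b a Sign.+ ≢ α) → eventOf a ≢ α →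
      Component l (chain bs a k) → Component l′ (chain bs a k)
    keeps-chain []       keep nx ne q = keep ne q
    keeps-chain (b ∷ bs) keep nx ne q = keep (nx b) q

    keeps-tree : ∀ {α l l′ a} → Keeps α l l′ → (∀ b → xOf b a Sign.+ ≢ α) → eventOf a ≢ α →
      (∃ λ rs → Component l (tree a rs)) → ∃ λ rs → Component l′ (tree a rs)
    keeps-tree {a = a} keep nx ne (acc rs , q) = acc rs , keeps-chain (below a) keep nx ne q

    -- Firing `a₀` exposes its signals and the trees of its children, which are exactly the
    -- components newly required; the others carry different actions and are kept.
    fire : ∀ {i a₀} {rs : Subtrees a₀} {l m} → toℕ a₀ ≡ i → Preparing i a₀ rs [] l m →
      (∀ {l′} → Live (suc i) l′ m → Path (suc i) l′ m) → Path i l m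
    fire {i} {a₀} {rs} {l} {m} refl prep continue = event a₀ refl steps (continue record
      { live-tree   = tree′
      ; live-signal = λ p q r → signal′ (ℕ.m≤n⇒m<n∨m≡n (ℕ.s≤s⁻¹ p)) q r
      ; live-relay  = λ p q → relay-at p (ℕ.<⇒≤ q) λ { refl → contradiction q (ℕ.<-irrefl refl) } })
      where
      open Preparing prep
      open ComponentStep (component-step current)
      tree′ : ∀ a → i ℕ.< toℕ a → ParentBefore (suc i) a → ∃ λ rs → Component target (tree a rs)
      tree′ a i<a parent with subj a in eq
      ... | inj₁ u = keeps-tree keeps (λ b ()) (λ e → ℕ.<-irrefl (≡.sym (event-injective e)) i<a)
        (tree-at a (λ { refl → ℕ.<-irrefl refl i<a }) (ℕ.<⇒≤ i<a) λ q → contradiction (≡.trans (≡.sym eq) q) λ ())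
      ... | inj₂ p with p Fin.≟ a₀
      ...   | yes refl = let eq′ , q = ∈-children⁺ eq in
        rs (subj-< eq′) , opens (∥ʳ (∥ˡ (component-∏ (subtree a₀ rs) q)))
      ...   | no p≢a₀ = keeps-tree keeps (λ b ()) (λ e → ℕ.<-irrefl (≡.sym (event-injective e)) i<a)
        (tree-at a (λ { refl → ℕ.<-irrefl refl i<a }) (ℕ.<⇒≤ i<a) λ q → earlier (parent refl) (≡.trans (≡.sym eq) q))
        where
        earlier : ∀ {p′} → toℕ p ℕ.< suc i → inj₂ p ≡ inj₂ p′ → toℕ p′ ℕ.< i
        earlier r refl = ℕ.≤∧≢⇒< (ℕ.s≤s⁻¹ r) (p≢a₀ ∘ Fin.toℕ-injective)
      signal′ : ∀ {a e} → toℕ a ℕ.< i ⊎ toℕ a ≡ i → i ℕ.< toℕ e → a < e → Component target (signal a e)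
      signal′ (inj₁ p) q r = keeps (λ ()) (signal-at p (ℕ.<⇒≤ q) r λ { refl → contradiction q (ℕ.<-irrefl refl) })
      signal′ (inj₂ p) q r with Fin.toℕ-injective p
      ... | refl = opens (∥ˡ (component-∏ (signal a₀) (∈-above⁺ r)))

    -- For each awaited `b` the signal makes a round trip: from the forest to the relay on `y`, then
    -- from the relay to the head of the chain on `x`.
    prepare : ∀ {i a₀} {rs : Subtrees a₀} {l m} bs → toℕ a₀ ≡ i → Preparing i a₀ rs bs l m →
      (∀ {l′ m′} → Live (suc i) l′ m′ → Path (suc i) l′ m′) → Path i l m
    prepare [] eq prep continue = fire eq prep continue
    prepare {i} {a₀} {rs} {l} {m} (b ∷ bs) refl prep continue =
      sync Y.steps Y′.steps (sync X.steps X′.steps (prepare bs refl next continue))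
      where
      open Preparing prep
      b<a₀ : b < a₀
      b<a₀ = before (here refl)
      b∉bs : b ∉ bs
      b∉bs = Unique[x∷xs]⇒x∉xs unique
      module Y  = ComponentStep (component-step (signal-at (<⇒ b<a₀) ℕ.≤-refl b<a₀ λ _ → here refl))
      module Y′ = ComponentStep (component-step (relay-at b<a₀ ℕ.≤-refl λ _ → here refl))
      module X  = ComponentStep (component-step (Y.keeps (λ ()) current))
      module X′ = ComponentStep (component-step (Y′.opens here))
      other : ∀ {a e} → (e ≡ a₀ → a ∈ bs) → wy (toℕ a) (toℕ e) ≢ wy (toℕ b) (toℕ a₀)
      other q eq with yFact-injective eq
      ... | refl , refl = b∉bs (q refl)
      next : Preparing i a₀ rs bs X.target X′.target
      next = record
        { unique    = tail-unique unique
        ; before    = before ∘ there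
        ; current   = X.opens here
        ; tree-at   = λ a a≢a₀ p q → keeps-tree X.keeps
            (λ e eq → a≢a₀ (proj₂ (xFact-injective (wire-injective eq)))) (λ ())
            (keeps-tree Y.keeps (λ e ()) (λ ()) (tree-at a a≢a₀ p q))
        ; signal-at = λ p q r s → X.keeps (λ ()) (Y.keeps (other s ∘ wire-injective) (signal-at p q r (there ∘ s)))
        ; relay-at  = λ p q s → X′.keeps (λ ()) (Y′.keeps (other s ∘ wire-injective) (relay-at p q (there ∘ s)))
        }
        where
        tail-unique : ∀ {x xs} → Unique {A = Fin size} (x ∷ xs) → Unique xs
        tail-unique (_ ∷ u) = u

    -- `k` counts the events to come. The tree of event `i` is at the surface because its parent
    -- precedes it in the order, hence has a smaller number and has fired.
    live⇒path : ∀ k {i l m} → i ℕ.+ k ≡ size → Live i l m → Path i l m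
    live⇒path zero {i} eq live with ≡.trans (≡.sym (ℕ.+-identityʳ i)) eq
    ... | refl = done
    live⇒path (suc k) {i} {l} {m} eq live with live-tree a₀ (ℕ.≤-reflexive (≡.sym a₀≡i)) parent
      where
      open Live live
      a₀ : Fin size
      a₀ = fromℕ< (subst (i ℕ.<_) eq (ℕ.m<m+n i (s≤s z≤n)))
      a₀≡i : toℕ a₀ ≡ i
      a₀≡i = Fin.toℕ-fromℕ< _
      parent : ParentBefore i a₀
      parent p = subst (_ ℕ.<_) a₀≡i (<⇒ (subj-< p))
    ... | acc rs , q = prepare {rs = rs} (below a₀) a₀≡i record
        { unique    = below-unique a₀
        ; before    = ∈-below⁻
        ; current   = q
        ; tree-at   = λ a _ → live-tree a
        ; signal-at = λ p q r _ → live-signal p q r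
        ; relay-at  = λ p q _ → live-relay p q
        } (live⇒path k (≡.trans (≡.sym (ℕ.+-suc i k)) eq))
      where
      open Live live
      a₀ : Fin size
      a₀ = fromℕ< (subst (i ℕ.<_) eq (ℕ.m<m+n i (s≤s z≤n)))
      a₀≡i : toℕ a₀ ≡ i
      a₀≡i = Fin.toℕ-fromℕ< _

    initially-live : Live 0 forest relays
    initially-live = record
      { live-tree   = λ a _ → root a
      ; live-signal = λ ()
      ; live-relay  = λ p _ → component-∏ relayₗ (∈-<-pairs⁺ p)
      }
      where
      root : ∀ a → ParentBefore 0 a → ∃ λ rs → Component forest (tree a rs)
      root a parent with subj a in eq
      ... | inj₁ u = >-wellFounded a , component-∏ rootTree (∈-roots⁺ eq)
      ... | inj₂ p = contradiction (parent refl) λ ()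

    complete-path : Path 0 forest relays
    complete-path = live⇒path size refl initially-live

  -- Runs of the trace of a word in an arbitrary context

  dead-run : ∀ {t R v} → Dead t → Run t R v → v ≈ 0#
  dead-run z (stop _)     = ≈-trans (*-cong (dead-state z) ≈-refl) (zeroˡ _)
  dead-run z (left d r)   = dead-run (dead-step d z) r
  dead-run z (right d r)  = dead-run z r
  dead-run z (both d e r) = dead-run (dead-step d z) r

  offers-∏ : ∀ {a} {A : Set a} {g : A → Ideal} {s ε} xs → Offers s ε (∏ₗ (map g xs)) → ∃ λ x → x ∈ xs × Offers s ε (g x)
  offers-∏ (x ∷ xs) (∥ˡ o) = x , here refl , o
  offers-∏ (x ∷ xs) (∥ʳ o) = let y , p , q = offers-∏ xs o in y , there p , q

  module TraceRuns (κ : Carrier) (w : Word) (M : List (Polarity × Name)) where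
    T : Trace
    T = traceOf w M
    open Trace T
    open TraceProperties T
    open IdealTrace T

    <⇒ : ∀ {a b} → a < b → toℕ a ℕ.< toℕ b
    <⇒ (a≤b , a≢b) = ℕ.≤∧≢⇒< a≤b (a≢b ∘ Fin.toℕ-injective)

    <⇐ : ∀ {a b} → toℕ a ℕ.< toℕ b → a < b
    <⇐ a<b = ℕ.<⇒≤ a<b , λ { refl → ℕ.<-irrefl refl a<b }

    open TotallyOrdered T <⇒ <⇐

    -- The map `f` absorbs the embeddings `inject₁` met in the recursion; only its numbering
    -- matters, as objects are denoted by the numbers of their events.
    scope-resolve : ∀ i (f : Fin i → Fin size) → (∀ j → toℕ (f j) ≡ toℕ j) → ∀ u →
      scope i u ≡ just (inj₁ (shared (map₂ f (resolve i u))))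
    scope-resolve zero    f p u       = refl
    scope-resolve (suc i) f p zero    = cong (just ∘ inj₁ ∘ object) (≡.sym (≡.trans (p _) (Fin.toℕ-fromℕ i)))
    scope-resolve (suc i) f p (suc u) = ≡.trans
      (scope-resolve i (f ∘ inject₁) (λ j → ≡.trans (p _) (Fin.toℕ-inject₁ j)) u)
      (cong (just ∘ inj₁ ∘ shared) (compose (resolve i u)))
      where
      compose : ∀ (s : Name ⊎ Fin i) → map₂ (f ∘ inject₁) s ≡ map₂ f (map₂ inject₁ s)
      compose (inj₁ _) = refl
      compose (inj₂ _) = refl

    scope-subject : ∀ a → scope (toℕ a) (proj₁ (lookup w a)) ≡ just (inj₁ (shared (subj a)))
    scope-subject a = scope-resolve (toℕ a) inject Fin.toℕ-inject _

    scope-refusal : ∀ u → scope size u ≡ just (inj₁ (shared (resolve size u)))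
    scope-refusal u = ≡.trans (scope-resolve size id (λ _ → refl) u) (cong (just ∘ inj₁ ∘ shared) (map₂-id _))
      where
      map₂-id : ∀ (s : Name ⊎ Fin size) → map₂ id s ≡ s
      map₂-id (inj₁ _) = refl
      map₂-id (inj₂ _) = refl

    ∈-N⁺ : ∀ {ε u} → (ε , u) ∈ M → (ε , resolve size u) ∈ N
    ∈-N⁺ p = ∈-deduplicate⁺ _≟ʳ_ (∈-map⁺ _ p)

    ∈-N⁻ : ∀ {ε x} → (ε , x) ∈ N → ∃ λ u → (ε , u) ∈ M × x ≡ resolve size u
    ∈-N⁻ p with ∈-map⁻ _ (∈-deduplicate⁻ _≟ʳ_ (map _ M) p)
    ... | (ε , u) , q , refl = u , q , refl

    refused⇒∈ : ∀ {u s ε} → scope size u ≡ just (inj₁ s) → Refused s ε → (ε , u) ∈ M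
    refused⇒∈ {u} {ε = ε} p (x , q , refl) with ∈-N⁻ q
    ... | v , r , refl = subst (λ v → (ε , v) ∈ M) (scope-injective size (≡.trans (scope-refusal v) (≡.sym p))) r

    whole : Ideal → Ideal → Ideal
    whole l m = val κ ∥ₗ ((l ⊗ m) ∥ₗ refusals)

    done-∏-off : ∀ (xs : List (Polarity × Name)) → let l = ∏ₗ (map (λ (ε , u) → off (free u) ε) xs) in
      Done l × Flat l × valueₗ l ≈ 1#
    done-∏-off []       = _ , _ , ≈-refl
    done-∏-off (x ∷ xs) = let d , f , v = done-∏-off xs in
      (_ , d) , (_ , f) , ≈-trans (*-identityˡ _) v

    refusals-done : Done refusals
    refusals-done = proj₁ (done-∏-off N-free)

    refusals-flat : Flat refusals
    refusals-flat = proj₁ (proj₂ (done-∏-off N-free))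

    whole-value : ∀ l m → valueₗ l ≈ 1# → valueₗ m ≈ 1# → valueₗ (whole l m) ≈ κ
    whole-value l m p q = ≈-trans (*-cong ≈-refl (≈-trans (*-cong (≈-trans (*-cong p q) (*-identityˡ _))
      (proj₂ (proj₂ (done-∏-off N-free)))) (*-identityˡ _))) (*-identityʳ _)

    whole-offers : ∀ {i K l m} → Invariant i K l m → Done l → ∀ {ε u} → (ε , u) ∈ M →
      Offers (shared (resolve size u)) ε (whole l m)
    whole-offers {l = l} inv d {ε} {u} p with resolve size u | ∈-N⁺ p
    ... | inj₁ v | q = ∥ʳ (∥ʳ (in-refusals (∈-N-free⁺ q)))
      where
      in-refusals : ∀ {xs} → (ε , v) ∈ xs → Offers (free v) ε (∏ₗ (map (λ (ε , u) → off (free u) ε) xs))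
      in-refusals (here refl) = ∥ˡ off
      in-refusals (there r)   = ∥ʳ (in-refusals r)
    ... | inj₂ a | q = ∥ʳ (∥ˡ (⊗ˡ (done-offers l d (Invariant.refused-l inv q))))

    whole-refused : ∀ {i K l m s ε} → Invariant i K l m → Offers s ε (whole l m) → Refused s ε
    whole-refused inv (∥ʳ (∥ˡ (⊗ˡ o))) = guarded-offers (Invariant.guarded-l inv) o
    whole-refused inv (∥ʳ (∥ˡ (⊗ʳ o))) = guarded-offers (Invariant.guarded-m inv) o
    whole-refused inv (∥ʳ (∥ʳ o)) with offers-∏ N-free o
    ... | (ε , u) , p , off = inj₁ u , ∈-N-free⁻ p , refl

    analyse-event : ∀ {i u} (a : Fin size) → toℕ a ≡ i → scope i u ≡ just (inj₁ (shared (subj a))) →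
      drop i w ≡ (u , pol a) ∷ drop (suc i) w
    analyse-event {u = u} a refl p = ≡.trans (drop-lookup w a)
      (cong (λ v → (v , pol a) ∷ drop (suc (toℕ a)) w) (scope-injective (toℕ a) (≡.trans (scope-subject a) (≡.sym p))))

    Explained : Term → ℕ → Carrier → Set (c ⊔ ℓ)
    Explained R i v = v ≈ 0# ⊎ ∃ λ r → Accepts R (drop i w) M r × v ≈ κ * r

    -- The left half of the run is matched by ideal steps. The invariant lets only event `i` fire,
    -- whose subject and polarity are those of the letter that `R` then answers, and stopping forces
    -- all events to have occurred. In every other case a zero has been uncovered.
    analyse : ∀ {t R v i K l m} → Invariant i K l m → Implements (scope i) t (whole l m) →
      Run t R v → Explained R i v
    analyse {t} {R} {l = l} {m} inv im (stop s)
      with stuck⇒done im (λ { (step d) → s (step (∣ˡⁱ d)) })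
    ... | (_ , (dl , dm) , _) , st with done⇒final inv dl
    ...   | refl = inj₂ (state R , subst (λ w → Accepts R w M (state R)) (≡.sym (drop-all size w ℕ.≤-refl))
              (stop (λ { (step d) → s (step (∣ʳⁱ d)) }) blocks) ,
            *-cong (≈-trans st (whole-value l m (proj₂ (proj₁ fin)) (proj₂ (proj₂ fin)))) ≈-refl)
      where
      fin = invariant-final inv
      -- Each offer of `M` is still made by the finished trace, so a matching co-action of `R` would
      -- prolong a maximal run.
      blocks : Blocks R M
      blocks {u = u} p e with offers-complete im (whole-offers inv dl p)
      ... | v , _ , _ , q , d with scope-injective size (≡.trans q (≡.sym (scope-refusal u)))
      ...   | refl = s (step (sync d e))
    analyse inv im (left d r) with internal-sound im d
    ... | dies z   = inj₁ (dead-run z r)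
    ... | idle im′ = analyse inv im′ r
    ... | move (∥ʳ (∥ˡ (sync a b))) im′ = analyse (invariant-sync inv a b) im′ r
    ... | move (∥ʳ (∥ʳ e)) im′ = contradiction refusals-flat (flat-¬⇝ e)
    analyse inv im (right d r) with analyse inv im r
    ... | inj₁ z = inj₁ z
    ... | inj₂ (_ , a , eq) = inj₂ (_ , internal d a , eq)
    analyse {i = i} inv im (both d e r) with visible-sound im d
    ... | dies _ _ _ z = inj₁ (dead-run z r)
    -- Wires are restricted: no index of `scope i` denotes one.
    ... | fires (wire _ _) p _ _ _ = contradiction p (scope-notPrivate i _)
    ... | fires (event _ _ _) p _ (∥ʳ (∥ʳ a)) _ = contradiction refusals-done (done-¬step a)
    ... | fires (event _ _ _) p _ (∥ʳ (∥ˡ (⊗ʳ b))) _ with guarded-step relayGuard-mono (Invariant.guarded-m inv) b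
    ...   | () , _
    analyse {R = R} {i = i} inv im (both d e r) | fires (event _ _ _) p q (∥ʳ (∥ˡ (⊗ˡ a))) im′ with invariant-event inv a
    ...   | b , refl , refl , inv′ with analyse inv′ im′ r | q
    ...     | inj₁ z | _ = inj₁ z
    ...     | inj₂ (r′ , as , eq) | refl = inj₂ (r′ ,
      subst (λ w → Accepts R w M r′) (≡.sym (analyse-event b refl p)) (visible e as) , eq)

    -- Plays a fixed execution against `R`: internal steps of `R` are taken as they come, wire
    -- synchronisations before the next letter, and each event meets one letter. Path and acceptance
    -- therefore end together.
    synthesise : ∀ {t R w′ r i K l m} → Path i l m → Invariant i K l m → Implements (scope i) t (whole l m) →
      Accepts R w′ M r → w′ ≡ drop i w → ∃ λ v → Run t R v × v ≈ κ * r
    synthesise path inv im (internal d a) eq = let v , r , p = synthesise path inv im a eq in v , right d r , p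
    synthesise (sync d e path) inv im a@(stop _ _) eq with internal-complete im (∥ʳ (∥ˡ (sync d e)))
    ... | _ , _ , _ , f , im′ = let v , r , p = synthesise path (invariant-sync inv d e) im′ a eq in v , left f r , p
    synthesise (sync d e path) inv im a@(visible _ _) eq with internal-complete im (∥ʳ (∥ˡ (sync d e)))
    ... | _ , _ , _ , f , im′ = let v , r , p = synthesise path (invariant-sync inv d e) im′ a eq in v , left f r , p
    synthesise done inv im (visible e a) eq = contradiction (≡.trans eq (drop-all size w ℕ.≤-refl)) λ ()
    synthesise (event a refl d path) inv im (stop _ _) eq = contradiction (≡.trans eq (drop-lookup w a)) λ ()
    synthesise (event a refl d path) inv im (visible e as) eq
      with visible-complete im (∥ʳ (∥ˡ (⊗ˡ d))) (inj₁ tt) | invariant-event inv d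
    ... | visibly {u} p f im′ | _ , _ , _ , inv′ with ≡.trans eq (analyse-event a refl p)
    ...   | refl = let v , r , q = synthesise path inv′ im′ as refl in v , both f e r , q
    -- All events have fired, but acknowledgements may be outstanding and must be performed before
    -- the run is maximal.
    synthesise {R = R} {l = l} {m} done inv im (stop s blk) eq = settle im final
      {X = λ t → ∃ λ v → Run t R v × v ≈ κ * state R} base (λ d (v , r , p) → v , left d r , p)
      where
      fin = invariant-final inv
      final : Done (whole l m)
      final = _ , (proj₁ (proj₁ fin) , proj₁ (proj₂ fin)) , refusals-done
      base : ∀ {t′} → Stuck t′ → Implements (scope size) t′ (whole l m) → ∃ λ v → Run t′ R v × v ≈ κ * state R
      base {t′} s′ im′ = _ , stop stuck , *-cong (≈-trans (proj₂ (stuck⇒done im′ s′))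
          (whole-value l m (proj₂ (proj₁ fin)) (proj₂ (proj₂ fin)))) ≈-refl
        where
        stuck : Stuck (t′ ∣ R)
        stuck (step (∣ˡⁱ d)) = s′ (step d)
        stuck (step (∣ʳⁱ d)) = s (step d)
        stuck (step (sync d e)) with visible-sound im′ d
        ... | dies _ p o _     = blk (refused⇒∈ p (whole-refused inv o)) e
        ... | fires _ _ _ a _  = done-¬step a final

  -- The sum of the traces of all observations

  module _ {P : Term} where

    weighted : Observation P → Carrier × Trace
    weighted (w , E , _) = state E , traceOf w (offers E)

    summands : List (Observation P) → Term
    summands os = ⨁ (map (λ (k , T) → k · ⦅ T ⦆) (map weighted os))

    summand : Observation P → Ideal
    summand (w , E , _) = val (state E) ∥ₗ IdealTrace.traceₗ (traceOf w (offers E))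

    sumₗ : List (Observation P) → Ideal
    sumₗ = foldr (λ o → summand o ⊕ₗ_) (val 0#)

    implements-sum : ∀ os → Implements freeEnv (summands os) (sumₗ os)
    implements-sum []                 = val
    implements-sum ((w , E , o) ∷ os) = choose
      -- In `⊕` each summand is weakened twice: for the restricted name of the choice and for the
      -- object of its prefix.
      (twice (scale (IdealTrace.implements-trace (traceOf w (offers E))))) (twice (implements-sum os))
      where
      twice : ∀ {t l} → Implements freeEnv t l → Implements (nothing ◂ nothing ◂ freeEnv) (weaken (weaken t)) l
      twice = implements-weaken notPrivate-nothing ∘ implements-weaken notPrivate-nothing

    -- A run cannot stop at an unresolved sum: its choice is always available, and it has no visible
    -- action. Choosing a summand leaves a run of one scaled trace, and reaching the empty sum gives
    -- value 0.
    analyse-sum : ∀ os {t R v} → Implements freeEnv t (sumₗ os) → Run t R v →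
      v ≈ 0# ⊎ ∃ λ w → ∃ λ E → ∃ λ r → Observes P w E × Accepts R w (offers E) r × v ≈ state E * r
    analyse-sum os im (right d r) with analyse-sum os im r
    ... | inj₁ z = inj₁ z
    ... | inj₂ (_ , _ , _ , o , a , eq) = inj₂ (_ , _ , _ , o , internal d a , eq)
    analyse-sum [] im (stop s) =
      inj₁ (≈-trans (*-cong (proj₂ (stuck⇒done im (λ { (step d) → s (step (∣ˡⁱ d)) }))) ≈-refl) (zeroˡ _))
    analyse-sum [] im (left d r) with internal-sound im d
    ... | dies z   = inj₁ (dead-run z r)
    ... | idle im′ = analyse-sum [] im′ r
    analyse-sum [] im (both d e r) with visible-sound im d
    ... | dies _ _ () _
    ... | fires _ _ _ () _
    analyse-sum (o ∷ os) im (stop s) with stuck⇒done im (λ { (step d) → s (step (∣ˡⁱ d)) })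
    ... | () , _
    analyse-sum (o ∷ os) im (both d e r) with visible-sound im d
    ... | dies _ _ () _
    ... | fires _ _ _ () _
    analyse-sum (o@(w , E , obs) ∷ os) im (left d r) with internal-sound im d
    ... | dies z      = inj₁ (dead-run z r)
    ... | idle im′    = analyse-sum (o ∷ os) im′ r
    ... | move ⊕ʳ im′ = analyse-sum os im′ r
    ... | move ⊕ˡ im′ with analyse invariant-initial im′ r
      where open TraceRuns (state E) w (offers E)
            open TotallyOrdered T <⇒ <⇐
    ...   | inj₁ z = inj₁ z
    ...   | inj₂ (r′ , a , eq) = inj₂ (w , E , r′ , obs , a , eq)

    synthesise-sum : ∀ {os w E obs t R r} → (w , E , obs) ∈ os → Implements freeEnv t (sumₗ os) →
      Accepts R w (offers E) r → ∃ λ v → Run t R v × v ≈ state E * r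
    synthesise-sum (there p) im a with internal-complete im ⊕ʳ
    ... | _ , _ , _ , d , im′ = let v , r , q = synthesise-sum p im′ a in v , left d r , q
    synthesise-sum {w = w} {E} (here refl) im a with internal-complete im ⊕ˡ
    ... | _ , _ , _ , d , im′ = let v , r , q = synthesise complete-path invariant-initial im′ a refl in v , left d r , q
      where open TraceRuns (state E) w (offers E)
            open TotallyOrdered T <⇒ <⇐

  -- Outcomes over an idempotent addition

  module Idempotent (+-idem : ∀ x → (x + x) ≈ x) where

    infix 4 _⊑_

    -- The natural order of an idempotent addition, for which `+` is the join. Antisymmetry splits
    -- an equation between sums into two comparisons.
    _⊑_ : Carrier → Carrier → Set ℓ
    x ⊑ y = (x + y) ≈ y

    ⊑-antisym : ∀ {x y} → x ⊑ y → y ⊑ x → x ≈ y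
    ⊑-antisym {x} {y} p q = ≈-trans (≈-sym q) (≈-trans (+-comm y x) p)

    Σ-sum : ∀ {a} {A : Set a} → (A → Carrier) → List A → Carrier
    Σ-sum f xs = foldr _+_ 0# (map f xs)

    ⊑-Σ : ∀ {a} {A : Set a} (f : A → Carrier) {x} xs → Any (λ y → x ≈ f y) xs → x ⊑ Σ-sum f xs
    ⊑-Σ f {x} (y ∷ ys) (here p) = ≈-trans (≈-sym (+-assoc _ _ _))
      (+-cong (≈-trans (+-cong p ≈-refl) (+-idem (f y))) ≈-refl)
    ⊑-Σ f {x} (y ∷ ys) (there p) = begin
      x + (f y + Σ-sum f ys) ≈⟨ +-assoc _ _ _ ⟨
      (x + f y) + Σ-sum f ys ≈⟨ +-cong (+-comm _ _) ≈-refl ⟩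
      (f y + x) + Σ-sum f ys ≈⟨ +-assoc _ _ _ ⟩
      f y + (x + Σ-sum f ys) ≈⟨ +-cong ≈-refl (⊑-Σ f ys p) ⟩
      f y + Σ-sum f ys       ∎
      where open ≈-Reasoning setoid

    Σ-⊑ : ∀ {a} {A : Set a} (f : A → Carrier) {z} xs → All (λ y → f y ⊑ z) xs → Σ-sum f xs ⊑ z
    Σ-⊑ f []       []       = +-identityˡ _
    Σ-⊑ f (x ∷ xs) (p ∷ ps) = ≈-trans (+-assoc _ _ _) (≈-trans (+-cong ≈-refl (Σ-⊑ f xs ps)) p)

    value : ∀ {P} → MaximalSequence P → Carrier
    value ρ = state (end ρ)

    representatives : ∀ {P} → List (MaximalSequence P) → List (MaximalSequence P)
    representatives [] = []
    representatives (ρ ∷ ρs) with any? (λ σ → labels ρ ∼? labels σ) (representatives ρs)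
    ... | yes _ = representatives ρs
    ... | no  _ = ρ ∷ representatives ρs

    representatives-distinct : ∀ {P} (ρs : List (MaximalSequence P)) →
      AllPairs (λ ρ σ → ¬ (ρ ≈ₕ σ)) (representatives ρs)
    representatives-distinct [] = []
    representatives-distinct (ρ ∷ ρs) with any? (λ σ → labels ρ ∼? labels σ) (representatives ρs)
    ... | yes _ = representatives-distinct ρs
    ... | no ¬p = All.¬Any⇒All¬ _ ¬p ∷ representatives-distinct ρs

    representatives-complete : ∀ {P} (ρ : MaximalSequence P) ρs → Any (ρ ≈ₕ_) ρs → Any (ρ ≈ₕ_) (representatives ρs)
    representatives-complete ρ (σ ∷ ρs) q with any? (λ τ → labels σ ∼? labels τ) (representatives ρs) | q
    ... | yes p | here r  = Any.map (trans r) p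
    ... | yes p | there r = representatives-complete ρ ρs r
    ... | no  _ | here r  = here r
    ... | no  _ | there r = there (representatives-complete ρ ρs r)

    -- A dropped sequence is homotopic to a kept one, hence has the same final state, and
    -- idempotence absorbs the repeated summand.
    representatives-sum : ∀ {P} (ρs : List (MaximalSequence P)) →
      Σ-sum value ρs ≈ Σ-sum value (representatives ρs)
    representatives-sum [] = ≈-refl
    representatives-sum (ρ ∷ ρs) with any? (λ σ → labels ρ ∼? labels σ) (representatives ρs)
    ... | no  _ = +-cong ≈-refl (representatives-sum ρs)
    ... | yes p = ≈-trans (+-cong ≈-refl (representatives-sum ρs))
      (⊑-Σ value (representatives ρs) (Any.map (λ {σ} r → ≈-reflexive (homotopic⇒state≡ ρ σ r)) p))

    outcome : ∀ P {v} → v ≈ Σ-sum value (maximalSequences P) → Outcome P v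
    outcome P v≈ = record
      { runs     = representatives (maximalSequences P)
      ; distinct = representatives-distinct (maximalSequences P)
      ; complete = λ ρ → representatives-complete ρ (maximalSequences P)
                     (Any.map (λ { {σ} (eq , _) → subst (labels ρ ∼_) eq refl }) (maximalSequences-complete ρ))
      ; sum      = ≈-trans v≈ (representatives-sum (maximalSequences P))
      }

    -- Runs of value 0 ask for no counterpart, 0 being least for `⊑`; this discards the fatal runs
    -- of the encoding. Multiplicities are ignored as well.
    _≤ᵣ_ : Term → Term → Set (c ⊔ ℓ)
    P ≤ᵣ Q = ∀ {R v} → Run P R v → v ≈ 0# ⊎ ∃ λ w → Run Q R w × v ≈ w

    Σ-mono : ∀ {P Q} → P ≤ᵣ Q → ∀ R →
      Σ-sum value (maximalSequences (P ∣ R)) ⊑ Σ-sum value (maximalSequences (Q ∣ R))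
    Σ-mono {P} {Q} P≤Q R = Σ-⊑ value (maximalSequences (P ∣ R)) (All.tabulate λ {ρ} _ → below ρ)
      where
      below : ∀ ρ → value ρ ⊑ Σ-sum value (maximalSequences (Q ∣ R))
      below ρ with P≤Q (path⇒run 0 (path ρ) (λ { (step d) → maximal ρ d }))
      ... | inj₁ v≈0 = ≈-trans (+-cong v≈0 ≈-refl) (+-identityˡ _)
      ... | inj₂ (w , r , v≈w) with run⇒reaches r
      ...   | as , X , p , ¬x , refl = ⊑-Σ value (maximalSequences (Q ∣ R))
        (Any.map (λ { (_ , refl) → v≈w }) (maximalSequences′-complete (<-wellFounded _) p ¬x))

    -- One value serves both sides: the sum for `P`, which by antisymmetry is also the sum for `Q`.
    ≤ᵣ-antisym⇒≃ : ∀ {P Q} → P ≤ᵣ Q → Q ≤ᵣ P → P ≃ Q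
    ≤ᵣ-antisym⇒≃ {P} {Q} P≤Q Q≤P R =
      Σ-sum value (maximalSequences (P ∣ R)) , outcome (P ∣ R) ≈-refl ,
      outcome (Q ∣ R) (⊑-antisym (Σ-mono P≤Q R) (Σ-mono Q≤P R))

    linearisation : ∀ P → P ≃ summands (observations P)
    linearisation P = ≤ᵣ-antisym⇒≃ forth back
      where
      forth : P ≤ᵣ summands (observations P)
      forth r with run⇒observes r
      ... | w , E , r′ , o , a , refl with find (observations-complete o)
      ...   | (_ , _ , o′) , p , refl , refl =
        let v , r″ , eq = synthesise-sum p (implements-sum (observations P)) a in inj₂ (v , r″ , ≈-sym eq)
      back : summands (observations P) ≤ᵣ P
      back r with analyse-sum (observations P) (implements-sum (observations P)) r
      ... | inj₁ z = inj₁ z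
      ... | inj₂ (w , E , r′ , o , a , eq) = inj₂ (_ , observes⇒run o a , eq)

theorem6p1 : {c ℓ : Level} (𝕂 : CommutativeSemiring c ℓ) →
    let open CommutativeSemiring 𝕂
        open Calculus 𝕂
    in
    (∀ x → (x + x) ≈ x) →
    (P : Term) →
    ∃ λ (kTs : List (Carrier × Trace)) →
      All (λ kT → Total (Trace._≤_ (proj₂ kT))) kTs ×
      P ≃ ⨁ (map (λ (k , T) → k · ⦅ T ⦆) kTs)
theorem6p1 𝕂 +-idem P =
  map weighted (observations P) ,
  All.map⁺ (All.tabulate λ _ → Fin.≤-total) ,
  linearisation P
  where
  open Development 𝕂
  open Idempotent +-idem
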